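{- Fix a prime $\ell$. Let $D$ be the discriminant of an order $\mathcal{O}$ in an imaginary quadratic number field such that a $2$-and-$2$ form $(L,M)$ of index $\ell$ arises from a pair of ideal classes in $\mathcal{O}$ (that is, up to rotation and homothety, $L$ and $M$ are proper fractional ideals of $\mathcal{O}$). Then $$|D|\leqslant 4\ell^2 .$$
   Context: A lattice in $\mathbb{R}^2\cong\mathbb{C}$ is the $\mathbb{Z}$-span of an $\mathbb{R}$-basis; $\langle\,,\rangle$ is the standard dot product; a homothety is multiplication by a positive real scalar. Let $\ell$ be a prime, $L$ a lattice and $M\subset L$ a sublattice of index $\ell$. The pair $(L,M)$ is a tempered perfect lattice (or form) of index $\ell$ if, after rescaling $L$ and $M$ by a common positive scalar, there exist non-empty sets $S\subset L-M$ and $S'\subset M-\{0\}$ such that, with $A(v)=\langle v,v\rangle$: (i) $A(v)=1$ for all $v\in S$; (ii) $A(v)>1$ for all $v\in L-M$ with $v\notin S$; (iii) $A(v)$ has a common value $u\geqslant 1$ for all $v\in S'$; (iv) $A(v)>u$ for all $v\in M-\{0\}$ with $v\notin S'$; (v) if $B$ is any positive definite quadratic form on $\mathbb{R}^2$ satisfying (i)--(iv) in place of $A$ with the same $S,S'$ and with common value $u'$ on $S'$, then $B=A$ and $u'=u$. It is called an $s$-and-$s'$ form if $S$ consists of $s$ pairs $\pm v$ and $S'$ consists of $s'$ pairs $\pm v$. For an imaginary quadratic field $K\subset\mathbb{C}$, a fractional ideal in $K$ is a finitely generated $\mathbb{Z}$-submodule of $K$ spanning $K$ over $\mathbb{Q}$;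 its coefficient ring is $\{\alpha\in K\mid \alpha L\subseteq L\}$. It is a proper fractional ideal of the order $\mathcal{O}$ if its coefficient ring equals $\mathcal{O}$. -}

module Defs where

open import Algebra.Apartness.Structures using (IsHeytingField)
open import Data.Fin.Base using (Fin)
open import Data.Integer.Base as ℤ using (ℤ; +_; -[1+_])
open import Data.Nat.Base as ℕ using (ℕ; zero; suc)
open import Data.Nat.Divisibility using (_∣_)
open import Data.Nat.GeneralisedArithmetic using (fold)
open import Data.Product.Base using (Σ-syntax; ∃-syntax; ∃₂; _×_; _,_; proj₁)
open import Data.Rational.Base as ℚ using (ℚ; 0ℚ; 1ℚ)
open import Data.Sum.Base using (_⊎_; inj₂)
open import Data.Vec.Functional using (foldr)
open import Function.Bundles using (_⇔_)
open import Level using (0ℓ)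
open import Relation.Binary.Core using (Rel)
open import Relation.Binary.PropositionalEquality.Core using (_≡_; _≢_)
open import Relation.Binary.Structures using (IsStrictPartialOrder)
open import Relation.Nullary.Negation.Core using (¬_)
open import Relation.Unary using (Pred; _∈_; _∉_; _⊆_; _≐_; Satisfiable)

-- The real numbers, axiomatised as an Archimedean, Cauchy complete ordered
-- field.  Classically these axioms determine ℝ up to unique isomorphism.  The
-- order is not assumed decidable, so that Bishop's constructive reals also
-- qualify; "x ≠ y" is therefore the apartness x < y or y < x.
record RealNumbers : Set₁ where
  infix  4 _≈_ _<_ _#_ _≤_
  infixl 6 _+_ _-_
  infixl 7 _*_
  infix  8 -_
  field
    Carrier : Set
    _≈_ _<_ : Rel Carrier 0ℓ
    _+_ _*_ : Carrier → Carrier → Carrier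
    -_      : Carrier → Carrier
    0# 1#   : Carrier

  _#_ : Rel Carrier 0ℓ
  x # y = x < y ⊎ y < x

  _≤_ : Rel Carrier 0ℓ
  x ≤ y = ¬ (y < x)

  _-_ : Carrier → Carrier → Carrier
  x - y = x + (- y)

  fromℕ : ℕ → Carrier
  fromℕ = fold 0# (λ x → 1# + x)

  Within : Carrier → Rel Carrier 0ℓ
  Within ε x y = x - y < ε × y - x < ε

  IsCauchy : (ℕ → Carrier) → Set
  IsCauchy s = ∀ ε → 0# < ε →
    ∃[ N ] (∀ m n → N ℕ.≤ m → N ℕ.≤ n → Within ε (s m) (s n))

  ConvergesTo : (ℕ → Carrier) → Carrier → Set
  ConvergesTo s x = ∀ ε → 0# < ε →
    ∃[ N ] (∀ n → N ℕ.≤ n → Within ε (s n) x)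

  field
    isHeytingField       : IsHeytingField _≈_ _#_ _+_ _*_ -_ 0# 1#
    isStrictPartialOrder : IsStrictPartialOrder _≈_ _<_
    0<1                  : 0# < 1#
    +-monoˡ-<            : ∀ z {x y} → x < y → x + z < y + z
    *-pos                : ∀ {x y} → 0# < x → 0# < y → 0# < x * y
    archimedean          : ∀ x → ∃[ n ] x < fromℕ n
    complete             : ∀ s → IsCauchy s → ∃[ x ] ConvergesTo s x

  open IsHeytingField isHeytingField public
    using (#⇒invertible; +-identityˡ; +-identityʳ)
  open IsStrictPartialOrder isStrictPartialOrder public
    using (<-respˡ-≈; <-respʳ-≈)
    renaming (trans to <-trans)

  fromℤ : ℤ → Carrier
  fromℤ (+ n)    = fromℕ n
  fromℤ -[1+ n ] = - fromℕ (suc n)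

  fromℕ-pos : ∀ n → 0# < fromℕ (suc n)
  fromℕ-pos zero    = <-respʳ-≈ (IsHeytingField.sym isHeytingField (+-identityʳ 1#)) 0<1
  fromℕ-pos (suc n) = <-trans (fromℕ-pos n)
    (<-respˡ-≈ (+-identityˡ _) (+-monoˡ-< (fromℕ (suc n)) 0<1))

  -- #⇒invertible inverts the difference n - 0.
  fromℚ : ℚ → Carrier
  fromℚ q = fromℤ (ℚ.numerator q)
          * proj₁ (#⇒invertible (inj₂ (fromℕ-pos (ℚ.denominator-1 q))))

module Plane (R : RealNumbers) where
  open RealNumbers R renaming (Carrier to ℝ)

  infix  4 _≈₂_ _#₂_
  infixl 6 _+₂_ _-₂_
  infixr 7 _·_

  ℝ² : Set
  ℝ² = ℝ × ℝ

  Subset : Set₁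
  Subset = Pred ℝ² 0ℓ

  _≈₂_ _#₂_ : Rel ℝ² 0ℓ
  (x , y) ≈₂ (x′ , y′) = x ≈ x′ × y ≈ y′
  (x , y) #₂ (x′ , y′) = x # x′ ⊎ y # y′

  0₂ : ℝ²
  0₂ = 0# , 0#

  _+₂_ _-₂_ : ℝ² → ℝ² → ℝ²
  (x , y) +₂ (x′ , y′) = x + x′ , y + y′
  (x , y) -₂ (x′ , y′) = x - x′ , y - y′

  -₂_ : ℝ² → ℝ²
  -₂ (x , y) = - x , - y

  _·_ : ℝ → ℝ² → ℝ²
  a · (x , y) = a * x , a * y

  ⟨_,_⟩ : ℝ² → ℝ² → ℝ
  ⟨ (x , y) , (x′ , y′) ⟩ = x * x′ + y * y′

  _*ℂ_ : ℝ² → ℝ² → ℝ²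
  (x , y) *ℂ (x′ , y′) = x * x′ - y * y′ , x * y′ + y * x′

  Image : (ℝ² → ℝ²) → Subset → Subset
  Image f X w = ∃[ v ] v ∈ X × w ≈₂ f v

  IsBasis : ℝ² → ℝ² → Set
  IsBasis b₁ b₂ = ∀ v → ∃₂ λ x y → v ≈₂ x · b₁ +₂ y · b₂ ×
    (∀ x′ y′ → v ≈₂ x′ · b₁ +₂ y′ · b₂ → x ≈ x′ × y ≈ y′)

  IsLattice : Subset → Set
  IsLattice L = ∃₂ λ b₁ b₂ → IsBasis b₁ b₂ ×
    (∀ v → v ∈ L ⇔ (∃₂ λ m n → v ≈₂ fromℤ m · b₁ +₂ fromℤ n · b₂))

  -- A complete irredundant system of k coset representatives for L / M.
  HasIndex : ℕ → Subset → Subset → Set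
  HasIndex k L M = Σ[ r ∈ (Fin k → ℝ²) ] (∀ i → r i ∈ L) ×
    (∀ v → v ∈ L → ∃[ i ] v -₂ r i ∈ M × (∀ j → v -₂ r j ∈ M → i ≡ j))

  -- a x² + b x y + c y²
  record QuadraticForm : Set where
    field a b c : ℝ

    value : ℝ² → ℝ
    value (x , y) = a * (x * x) + b * (x * y) + c * (y * y)

    PositiveDefinite : Set
    PositiveDefinite = ∀ v → v #₂ 0₂ → 0# < value v

  open QuadraticForm public using (value; PositiveDefinite)

  A : ℝ² → ℝ
  A v = ⟨ v , v ⟩

  record Conditions[i-iv] (L M S S′ : Subset) (Q : ℝ² → ℝ) (u : ℝ) : Set where
    field
      cond-i   : ∀ v → v ∈ S → Q v ≈ 1#
      cond-ii  : ∀ v → v ∈ L → v ∉ M → v ∉ S → 1# < Q v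
      cond-iii : 1# ≤ u × (∀ v → v ∈ S′ → Q v ≈ u)
      cond-iv  : ∀ v → v ∈ M → ¬ (v ≈₂ 0₂) → v ∉ S′ → u < Q v

  record TemperedPerfect (ℓ : ℕ) (L M : Subset) : Set₁ where
    field
      L-lattice : IsLattice L
      M-lattice : IsLattice M
      M⊆L       : M ⊆ L
      index     : HasIndex ℓ L M
      scale     : ℝ
      scale>0   : 0# < scale

    L₁ : Subset
    L₁ = Image (scale ·_) L

    M₁ : Subset
    M₁ = Image (scale ·_) M

    field
      S S′         : Subset
      S-nonempty   : Satisfiable S
      S′-nonempty  : Satisfiable S′
      S⊆L-M        : ∀ v → v ∈ S → v ∈ L₁ × v ∉ M₁
      S′⊆M-0       : ∀ v → v ∈ S′ → v ∈ M₁ × ¬ (v ≈₂ 0₂)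
      u            : ℝ
      cond-i-iv    : Conditions[i-iv] L₁ M₁ S S′ A u
      cond-v       : ∀ B u′ → PositiveDefinite B →
                     Conditions[i-iv] L₁ M₁ S S′ (value B) u′ →
                     (∀ v → value B v ≈ A v) × u′ ≈ u

  ConsistsOfPairs : ℕ → Subset → Set
  ConsistsOfPairs k X = Σ[ v ∈ (Fin k → ℝ²) ]
    (∀ w → w ∈ X ⇔ (∃[ i ] (w ≈₂ v i ⊎ w ≈₂ -₂ (v i)))) ×
    (∀ i j → i ≢ j → ¬ (v i ≈₂ v j) × ¬ (v i ≈₂ -₂ (v j)))

  record _-and-_FormOfIndex (s s′ ℓ : ℕ) (L M : Subset) : Set₁ where
    field
      temperedPerfect : TemperedPerfect ℓ L M
      S-pairs  : ConsistsOfPairs s  (TemperedPerfect.S  temperedPerfect)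
      S′-pairs : ConsistsOfPairs s′ (TemperedPerfect.S′ temperedPerfect)

-- n = 2 shows that a squarefree number is nonzero.
Squarefree : ℕ → Set
Squarefree d = ∀ n → n ℕ.* n ∣ d → n ≡ 1

-- ℚ(√-d) inside ℂ = ℝ², every imaginary quadratic field being of this form for
-- a unique squarefree d ≥ 1.  The element (p , q) : K stands for p + q √-d.
record ImaginaryQuadraticField (R : RealNumbers) : Set where
  open RealNumbers R using (_≈_; _<_; 0#; fromℕ; fromℚ) renaming (Carrier to ℝ; _*_ to _*ℝ_)
  field
    d            : ℕ
    d-squarefree : Squarefree d
    √d           : ℝ
    √d>0         : 0# < √d
    √d²≈d        : √d *ℝ √d ≈ fromℕ d

  infixl 6 _+_
  infixl 7 _*_
  infixr 7 _·_

  K : Set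
  K = ℚ × ℚ

  embed : K → Plane.ℝ² R
  embed (p , q) = fromℚ p , fromℚ q *ℝ √d

  0K 1K : K
  0K = 0ℚ , 0ℚ
  1K = 1ℚ , 0ℚ

  _+_ _*_ : K → K → K
  (p , q) + (p′ , q′) = p ℚ.+ p′ , q ℚ.+ q′
  (p , q) * (p′ , q′) =
    p ℚ.* p′ ℚ.- (+ d ℚ./ 1) ℚ.* (q ℚ.* q′) , p ℚ.* q′ ℚ.+ q ℚ.* p′

  -_ : K → K
  - (p , q) = ℚ.- p , ℚ.- q

  _·_ : ℚ → K → K
  r · (p , q) = r ℚ.* p , r ℚ.* q

  trace : K → ℚ
  trace (p , q) = p ℚ.+ p

  fromℤ : ℤ → ℚ
  fromℤ m = m ℚ./ 1

  ∑ : ∀ {n} → (Fin n → K) → K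
  ∑ = foldr _+_ 0K

  IsFinitelyGenerated : Pred K 0ℓ → Set
  IsFinitelyGenerated I = ∃[ n ] Σ[ g ∈ (Fin n → K) ]
    (∀ x → x ∈ I ⇔ (Σ[ c ∈ (Fin n → ℤ) ] x ≡ ∑ (λ i → fromℤ (c i) · g i)))

  SpansOverℚ : Pred K 0ℓ → Set
  SpansOverℚ I = ∀ x → ∃[ n ] Σ[ e ∈ (Fin n → K) ] (∀ i → e i ∈ I) ×
    (Σ[ c ∈ (Fin n → ℚ) ] x ≡ ∑ (λ i → c i · e i))

  IsFractionalIdeal : Pred K 0ℓ → Set
  IsFractionalIdeal I = IsFinitelyGenerated I × SpansOverℚ I

  CoefficientRing : Pred K 0ℓ → Pred K 0ℓ
  CoefficientRing I α = ∀ x → x ∈ I → α * x ∈ I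

  record Order : Set₁ where
    field
      elements            : Pred K 0ℓ
      1∈                  : 1K ∈ elements
      +-closed            : ∀ x y → x ∈ elements → y ∈ elements → x + y ∈ elements
      neg-closed          : ∀ x → x ∈ elements → - x ∈ elements
      *-closed            : ∀ x y → x ∈ elements → y ∈ elements → x * y ∈ elements
      isFinitelyGenerated : IsFinitelyGenerated elements
      spansOverℚ          : SpansOverℚ elements

  IsProperFractionalIdeal : Order → Pred K 0ℓ → Set
  IsProperFractionalIdeal 𝒪 I =
    IsFractionalIdeal I × CoefficientRing I ≐ Order.elements 𝒪

  IsℤBasis : Pred K 0ℓ → K → K → Set
  IsℤBasis I ω₁ ω₂ =
    (∀ x → x ∈ I ⇔ (∃₂ λ m n → x ≡ fromℤ m · ω₁ + fromℤ n · ω₂)) ×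
    (∀ m n m′ n′ → fromℤ m · ω₁ + fromℤ n · ω₂ ≡ fromℤ m′ · ω₁ + fromℤ n′ · ω₂ →
      m ≡ m′ × n ≡ n′)

  -- D = det (trace (ωᵢ ωⱼ)), which does not depend on the ℤ-basis ω.
  IsDiscriminant : Order → ℤ → Set
  IsDiscriminant 𝒪 D = ∃₂ λ ω₁ ω₂ → IsℤBasis (Order.elements 𝒪) ω₁ ω₂ ×
    fromℤ D ≡ trace (ω₁ * ω₁) ℚ.* trace (ω₂ * ω₂) ℚ.- trace (ω₁ * ω₂) ℚ.* trace (ω₂ * ω₁)

  embedSet : Pred K 0ℓ → Plane.Subset R
  embedSet I w = ∃[ x ] x ∈ I × Plane._≈₂_ R w (embed x)

-- One rotation (multiplication by ρ with |ρ| = 1) and one homothety take both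
-- members of the pair to proper fractional ideals of 𝒪.
record ArisesFrom {R : RealNumbers} (F : ImaginaryQuadraticField R)
                  (𝒪 : ImaginaryQuadraticField.Order F) (L M : Plane.Subset R) : Set₁ where
  open RealNumbers R using (_≈_; _<_; 0#; 1#) renaming (Carrier to ℝ)
  open Plane R using (ℝ²; ⟨_,_⟩; _*ℂ_; _·_; Image)
  open ImaginaryQuadraticField F using (K; IsProperFractionalIdeal; embedSet)
  field
    ρ      : ℝ²
    ∣ρ∣≈1  : ⟨ ρ , ρ ⟩ ≈ 1#
    c      : ℝ
    c>0    : 0# < c

  rotateScale : ℝ² → ℝ²
  rotateScale v = c · (ρ *ℂ v)

  field
    I J      : Pred K 0ℓ
    I-proper : IsProperFractionalIdeal 𝒪 I
    J-proper : IsProperFractionalIdeal 𝒪 J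
    L↦I      : Image rotateScale L ≐ embedSet I
    M↦J      : Image rotateScale M ≐ embedSet J

module Submission where

open import Defs
open import Algebra.Apartness.Structures using (IsHeytingField)
open import Algebra.Bundles using (CommutativeRing)
import Algebra.Properties.Ring
import Algebra.Properties.Semiring.Mult
import Algebra.Solver.Ring
open import Algebra.Solver.Ring.AlmostCommutativeRing using (AlmostCommutativeRing; fromCommutativeRing; _-Raw-AlmostCommutative⟶_)
open import Data.Fin.Base as Fin using (Fin; toℕ; combine; remQuot)
import Data.Fin.Properties as Fin
open import Data.Integer.Base as ℤ using (ℤ; +_; -[1+_]; ∣_∣)
import Data.Integer.Divisibility.Signed as ℤ∣
import Data.Integer.DivMod as ℤ
import Data.Integer.Properties as ℤ
import Data.Integer.Tactic.RingSolver as ℤ-Solver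
open import Data.Maybe.Base using (Maybe; just; nothing)
open import Data.Nat.Base as ℕ using (ℕ; zero; suc)
import Data.Nat.Divisibility as ℕ
import Data.Nat.GCD as ℕ
open import Data.Nat.Primality using (Prime)
import Data.Nat.Properties as ℕ
open import Data.Product.Base using (∃-syntax; ∃₂; _×_; _,_; proj₁; proj₂)
open import Data.Rational.Base as ℚ using (ℚ; 0ℚ; 1ℚ; mkℚ)
import Data.Rational.Properties as ℚ
import Data.Rational.Unnormalised.Base as ℚᵘ
import Data.Rational.Unnormalised.Properties as ℚᵘ
open import Data.Sum.Base using (_⊎_; inj₁; inj₂)
open import Function.Base using (_∘_; _$_)
open import Function.Bundles using (Equivalence)
open import Level using (0ℓ)
open import Relation.Binary.PropositionalEquality as ≡ using (_≡_; _≢_; cong; cong₂; subst; subst₂)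
import Relation.Binary.Reasoning.Setoid
open import Relation.Binary.Structures using (IsStrictPartialOrder)
open import Relation.Nullary using (¬_; Dec; yes; no; contradiction)
open import Relation.Nullary.Decidable using (dec⇒maybe; decidable-stable)
open import Relation.Unary using (Pred; _∈_; _∉_; _⊆_; _≐_)
import Tactic.RingSolver as RingSolver
import Tactic.RingSolver.Core.AlmostCommutativeRing as ACR

-- Let v₁, v₂ and w₁, w₂ represent the minimal vectors of L ∖ M and of M.  Two independent
-- minimal vectors of a planar lattice generate it, so v₁, v₂ is a basis of L and w₁, w₂ one of
-- M.  Write wᵢ = xᵢ v₁ + yᵢ v₂; then ∣x₁ y₂ - x₂ y₁∣ = ℓ.  As A(v₁) = A(v₂) = 1, we have
-- A(x v₁ + y v₂) = x² + t x y + y², and A(w₁) = A(w₂) reads t δ + σ = 0 with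
-- δ = x₁ y₁ - x₂ y₂ and σ = x₁² + y₁² - x₂² - y₂².  If δ = 0, then t could be varied, against
-- perfection; so δ ≠ 0.  If ξ is the quotient of the elements of K that correspond to v₂ and v₁,
-- then ξ² - t ξ + 1 = 0, hence δ ξ multiplies L into itself and lies in 𝒪.  The discriminant
-- σ² - 4 δ² of ℤ[δ ξ] is a nonzero square multiple of D, and 4 δ² - σ² ≤ 4 (x₁ y₂ - x₂ y₁)².

-- The order of ℝ is not decidable, so whatever needs a case distinction takes place in `K`, whose
-- elements have rational coordinates. `Corresponds` relates the vectors of the rescaled lattices to
-- elements of the two ideals and turns dot products into rational numbers up to one positive
-- factor.
--
-- The obstacle is the variation of `t`: one explicit form must keep the strict inequalities at
-- infinitely many vectors. Arithmetic helps, since `t` is a rational number b/a when v₁ and v₂ come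
-- from `K`. Then a A is integral on L, and a strict inequality is a gap of at least 1. With κ = 4a
-- / (n (4a² - b²)) the perturbed form B satisfies n a B = n (a A) + s x y, where s = ±1. As ∣x y∣
-- never exceeds a A, no strict inequality is lost once n is large against the two minimal values of
-- a A. The sign s is that of x₁ y₁, which keeps the value on S′ at least 1.
--
-- The determinant is compared with ℓ by counting: a box of ∣x₁ y₂ - x₂ y₁∣ points of L is mapped
-- injectively to the cosets of M, which yields the direction that the bound uses.

-- The ring ℝ: the homomorphism from ℤ and a solver for ring identities

module RealProperties (R : RealNumbers) where
  open RealNumbers R public renaming (Carrier to ℝ)
  open IsHeytingField isHeytingField public
    using (refl; sym; trans; reflexive; +-cong; +-congˡ; +-congʳ; *-cong; *-congˡ; *-congʳ; -‿cong;
           *-comm; *-assoc; +-comm; +-assoc; *-identityˡ; *-identityʳ; zeroˡ; zeroʳ; -‿inverseʳ;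
           #-cotrans; invertible⇒#; tight; isCommutativeRing)
  open IsStrictPartialOrder isStrictPartialOrder public using () renaming (irrefl to <-irrefl)

  commutativeRing : CommutativeRing _ _
  commutativeRing = record { isCommutativeRing = isCommutativeRing }

  open CommutativeRing commutativeRing using (ring; semiring; setoid)
  open Algebra.Properties.Ring ring using (-‿distribˡ-*; -‿distribʳ-*; -‿involutive; -0#≈0#; -‿+-comm)
  open Algebra.Properties.Semiring.Mult semiring using (×-homo-+; ×1-homo-*) renaming (_×_ to _⊗_)
  open Relation.Binary.Reasoning.Setoid setoid

  private
    fromℕ-⊗ : ∀ n → fromℕ n ≡ n ⊗ 1#
    fromℕ-⊗ zero    = ≡.refl
    fromℕ-⊗ (suc n) = cong (λ x → 1# + x) (fromℕ-⊗ n)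

  fromℕ-homo-+ : ∀ m n → fromℕ (m ℕ.+ n) ≈ fromℕ m + fromℕ n
  fromℕ-homo-+ m n rewrite fromℕ-⊗ (m ℕ.+ n) | fromℕ-⊗ m | fromℕ-⊗ n = ×-homo-+ 1# m n

  fromℕ-homo-* : ∀ m n → fromℕ (m ℕ.* n) ≈ fromℕ m * fromℕ n
  fromℕ-homo-* m n rewrite fromℕ-⊗ (m ℕ.* n) | fromℕ-⊗ m | fromℕ-⊗ n = ×1-homo-* m n

  fromℤ-homo-neg : ∀ i → fromℤ (ℤ.- i) ≈ - fromℤ i
  fromℤ-homo-neg (+ zero)  = sym -0#≈0#
  fromℤ-homo-neg (+ suc n) = refl
  fromℤ-homo-neg -[1+ n ]  = sym (-‿involutive _)

  fromℤ-⊖ : ∀ m n → fromℤ (m ℤ.⊖ n) ≈ fromℕ m - fromℕ n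
  fromℤ-⊖ m       zero    = sym (trans (+-congˡ -0#≈0#) (+-identityʳ _))
  fromℤ-⊖ zero    (suc n) = sym (+-identityˡ _)
  fromℤ-⊖ (suc m) (suc n) rewrite ℤ.[1+m]⊖[1+n]≡m⊖n m n = trans (fromℤ-⊖ m n) (sym (begin
    (1# + fromℕ m) - (1# + fromℕ n)     ≈⟨ +-cong (+-comm _ _) (sym (-‿+-comm _ _)) ⟩
    (fromℕ m + 1#) + (- 1# - fromℕ n)   ≈⟨ +-assoc _ _ _ ⟩
    fromℕ m + (1# + (- 1# - fromℕ n))   ≈⟨ +-congˡ (+-assoc _ _ _) ⟨
    fromℕ m + ((1# - 1#) - fromℕ n)     ≈⟨ +-congˡ (+-congʳ (-‿inverseʳ 1#)) ⟩
    fromℕ m + (0# - fromℕ n)            ≈⟨ +-congˡ (+-identityˡ _) ⟩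
    fromℕ m - fromℕ n                   ∎))

  fromℤ-homo-+ : ∀ i j → fromℤ (i ℤ.+ j) ≈ fromℤ i + fromℤ j
  fromℤ-homo-+ (+ m)    (+ n)    = fromℕ-homo-+ m n
  fromℤ-homo-+ (+ m)    -[1+ n ] = fromℤ-⊖ m (suc n)
  fromℤ-homo-+ -[1+ m ] (+ n)    = trans (fromℤ-⊖ n (suc m)) (+-comm _ _)
  fromℤ-homo-+ -[1+ m ] -[1+ n ] = begin
    - fromℕ (suc (suc (m ℕ.+ n)))          ≡⟨ cong (λ k → - fromℕ (suc k)) (ℕ.+-suc m n) ⟨
    - fromℕ (suc m ℕ.+ suc n)              ≈⟨ -‿cong (fromℕ-homo-+ (suc m) (suc n)) ⟩
    - (fromℕ (suc m) + fromℕ (suc n))      ≈⟨ -‿+-comm _ _ ⟨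
    - fromℕ (suc m) - fromℕ (suc n)        ∎

  fromℕ-homo-*-fromℤ : ∀ m j → fromℤ (+ m ℤ.* j) ≈ fromℕ m * fromℤ j
  fromℕ-homo-*-fromℤ m (+ n) rewrite ≡.sym (ℤ.pos-* m n) = fromℕ-homo-* m n
  fromℕ-homo-*-fromℤ m -[1+ n ] = begin
    fromℤ (+ m ℤ.* -[1+ n ])            ≡⟨ cong fromℤ (ℤ.neg-distribʳ-* (+ m) (+ suc n)) ⟨
    fromℤ (ℤ.- (+ m ℤ.* + suc n))       ≈⟨ fromℤ-homo-neg (+ m ℤ.* + suc n) ⟩
    - fromℤ (+ m ℤ.* + suc n)           ≈⟨ -‿cong (fromℕ-homo-*-fromℤ m (+ suc n)) ⟩
    - (fromℕ m * fromℕ (suc n))         ≈⟨ -‿distribʳ-* _ _ ⟩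
    fromℕ m * - fromℕ (suc n)           ∎

  fromℤ-homo-* : ∀ i j → fromℤ (i ℤ.* j) ≈ fromℤ i * fromℤ j
  fromℤ-homo-* (+ m)    j = fromℕ-homo-*-fromℤ m j
  fromℤ-homo-* -[1+ m ] j = begin
    fromℤ (-[1+ m ] ℤ.* j)              ≡⟨ cong fromℤ (ℤ.neg-distribˡ-* (+ suc m) j) ⟨
    fromℤ (ℤ.- (+ suc m ℤ.* j))         ≈⟨ fromℤ-homo-neg (+ suc m ℤ.* j) ⟩
    - fromℤ (+ suc m ℤ.* j)             ≈⟨ -‿cong (fromℕ-homo-*-fromℤ (suc m) j) ⟩
    - (fromℕ (suc m) * fromℤ j)         ≈⟨ -‿distribˡ-* _ _ ⟩
    - fromℕ (suc m) * fromℤ j           ∎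

  almostCommutativeRing : AlmostCommutativeRing _ _
  almostCommutativeRing = fromCommutativeRing commutativeRing

  fromℤ-morphism : ℤ.+-*-rawRing -Raw-AlmostCommutative⟶ almostCommutativeRing
  fromℤ-morphism = record
    { ⟦_⟧    = fromℤ
    ; +-homo = fromℤ-homo-+
    ; *-homo = fromℤ-homo-*
    ; -‿homo = fromℤ-homo-neg
    ; 0-homo = refl
    ; 1-homo = +-identityʳ 1#
    }

  fromℤ-≟ : ∀ i j → Maybe (fromℤ i ≈ fromℤ j)
  fromℤ-≟ i j with i ℤ.≟ j
  ... | yes i≡j = just (reflexive (cong fromℤ i≡j))
  ... | no  _   = nothing

  -- Integer coefficients have decidable equality, which real ones lack. Here `con (+ 1)` stands for
  -- `1# + 0#`, whence the appeals to `+-identityʳ 1#`.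
  module Solver = Algebra.Solver.Ring ℤ.+-*-rawRing almostCommutativeRing fromℤ-morphism fromℤ-≟
  open Solver using (solve; _:=_; _:+_; _:*_; _:-_; :-_; con)

  -- Order in ℝ without decidability

  <-asym : ∀ {x y} → x < y → ¬ (y < x)
  <-asym x<y y<x = <-irrefl refl (<-trans x<y y<x)

  ≮∧≯⇒≈ : ∀ {x y} → ¬ (x < y) → ¬ (y < x) → x ≈ y
  ≮∧≯⇒≈ x≮y y≮x = proj₁ (tight _ _) λ { (inj₁ x<y) → x≮y x<y ; (inj₂ y<x) → y≮x y<x }

  <-resp₂-≈ : ∀ {x x′ y y′} → x ≈ x′ → y ≈ y′ → x < y → x′ < y′
  <-resp₂-≈ x≈x′ y≈y′ x<y = <-respˡ-≈ x≈x′ (<-respʳ-≈ y≈y′ x<y)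

  ≤-resp₂-≈ : ∀ {x x′ y y′} → x ≈ x′ → y ≈ y′ → x ≤ y → x′ ≤ y′
  ≤-resp₂-≈ x≈x′ y≈y′ x≤y y′<x′ = x≤y (<-resp₂-≈ (sym y≈y′) (sym x≈x′) y′<x′)

  -- As `x ≤ y` is only a negation, it cannot be split into cases; cotransitivity locates `x`
  -- relative to the pair `y < z`, and the negation discards the wrong positions.
  ≤-<-trans : ∀ {x y z} → x ≤ y → y < z → x < z
  ≤-<-trans {x} {y} {z} y≮x y<z with #-cotrans (inj₁ y<z) x
  ... | inj₁ (inj₁ y<x) = contradiction y<x y≮x
  ... | inj₁ (inj₂ x<y) = <-trans x<y y<z
  ... | inj₂ (inj₁ x<z) = x<z
  ... | inj₂ (inj₂ z<x) = contradiction (<-trans y<z z<x) y≮x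

  x<y⇒0<y-x : ∀ {x y} → x < y → 0# < y - x
  x<y⇒0<y-x {x} x<y = <-respˡ-≈ (-‿inverseʳ x) (+-monoˡ-< (- x) x<y)

  0<y-x⇒x<y : ∀ {x y} → 0# < y - x → x < y
  0<y-x⇒x<y {x} {y} 0<y-x = <-resp₂-≈ (+-identityˡ x)
    (solve 2 (λ y x → y :- x :+ x := y) refl y x) (+-monoˡ-< x 0<y-x)

  x<0⇒0<-x : ∀ {x} → x < 0# → 0# < - x
  x<0⇒0<-x {x} x<0 = <-respʳ-≈ (+-identityˡ _) (x<y⇒0<y-x x<0)

  +-pos-nonNeg : ∀ {x y} → 0# < x → 0# ≤ y → 0# < x + y
  +-pos-nonNeg {x} {y} 0<x 0≤y = ≤-<-trans 0≤y (<-respˡ-≈ (+-identityˡ y) (+-monoˡ-< y 0<x))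

  <-≤-trans : ∀ {x y z} → x < y → y ≤ z → x < z
  <-≤-trans {x} {y} {z} x<y z≮y with #-cotrans (inj₁ x<y) z
  ... | inj₁ (inj₁ x<z) = x<z
  ... | inj₁ (inj₂ z<x) = contradiction (<-trans z<x x<y) z≮y
  ... | inj₂ (inj₁ z<y) = contradiction z<y z≮y
  ... | inj₂ (inj₂ y<z) = <-trans x<y y<z

  +-nonNeg : ∀ {x y} → 0# ≤ x → 0# ≤ y → 0# ≤ x + y
  +-nonNeg {x} {y} 0≤x 0≤y x+y<0 = 0≤x (<-resp₂-≈
    (solve 2 (λ x y → x :+ y :- y := x) refl x y) (-‿inverseʳ y)
    (+-monoˡ-< (- y) (<-≤-trans x+y<0 0≤y)))

  #0⇒0<² : ∀ {x} → x # 0# → 0# < x * x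
  #0⇒0<² {x} (inj₁ x<0) = <-respʳ-≈ (solve 1 (λ x → (:- x) :* (:- x) := x :* x) refl x)
    (*-pos (x<0⇒0<-x x<0) (x<0⇒0<-x x<0))
  #0⇒0<² (inj₂ 0<x) = *-pos 0<x 0<x

  -- The sign of `x` is unknown, but a negative square would forbid `x # 0#`, so that `x ≈ 0#` by
  -- tightness and the square vanishes.
  0≤² : ∀ x → 0# ≤ x * x
  0≤² x x²<0 = <-irrefl (trans (*-congʳ x≈0) (zeroˡ x)) x²<0
    where
    x≈0 : x ≈ 0#
    x≈0 = proj₁ (tight x 0#) λ x#0 → <-asym x²<0 (#0⇒0<² x#0)

  *-monoʳ-<-pos : ∀ {c x y} → 0# < c → x < y → c * x < c * y
  *-monoʳ-<-pos {c} {x} {y} 0<c x<y = 0<y-x⇒x<y (<-respʳ-≈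
    (solve 3 (λ c x y → c :* (y :- x) := c :* y :- c :* x) refl c x y) (*-pos 0<c (x<y⇒0<y-x x<y)))

  *-nonNeg : ∀ {x y} → 0# < x → 0# ≤ y → 0# ≤ x * y
  *-nonNeg {x} {y} 0<x 0≤y xy<0 = <-irrefl (trans (*-congˡ y≈0) (zeroʳ x)) xy<0
    where
    y≈0 : y ≈ 0#
    y≈0 = proj₁ (tight y 0#) λ
      { (inj₁ y<0) → 0≤y y<0
      ; (inj₂ 0<y) → <-asym xy<0 (*-pos 0<x 0<y) }

  invPos : ∀ {x} → 0# < x → ∃[ y ] 0# < y × y * x ≈ 1#
  invPos {x} 0<x with #⇒invertible (inj₂ 0<x)
  ... | y , yx≈1 , xy≈1 = y , 0<y (invertible⇒# (x , trans (*-congˡ (x-0≈x y)) xy≈1′ , trans (*-congʳ (x-0≈x y)) yx≈1′)) , yx≈1′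
    where
    x-0≈x : ∀ x → x - 0# ≈ x
    x-0≈x = solve 1 (λ x → x :- con (+ 0) := x) refl

    yx≈1′ : y * x ≈ 1#
    yx≈1′ = trans (*-congˡ (sym (x-0≈x x))) yx≈1

    xy≈1′ : x * y ≈ 1#
    xy≈1′ = trans (*-comm x y) yx≈1′

    0<y : y # 0# → 0# < y
    0<y (inj₂ 0<y) = 0<y
    -- A negative inverse would make -1, as the product of `- y` and `x`, positive.
    0<y (inj₁ y<0) = contradiction (<-respʳ-≈
      (trans (sym (-‿distribˡ-* y x)) (-‿cong yx≈1′)) (*-pos (x<0⇒0<-x y<0) 0<x))
      λ 0<-1 → <-irrefl (sym (-‿inverseʳ 1#)) (<-trans 0<1 (<-respˡ-≈ (+-identityˡ 1#) (<-respʳ-≈ (+-comm _ _) (+-monoˡ-< 1# 0<-1))))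

  *-cancelˡ-<-pos : ∀ {c x y} → 0# < c → c * x < c * y → x < y
  *-cancelˡ-<-pos {c} {x} {y} 0<c cx<cy with invPos 0<c
  ... | c⁻¹ , 0<c⁻¹ , c⁻¹c≈1 = <-resp₂-≈ (cancel x) (cancel y) (*-monoʳ-<-pos 0<c⁻¹ cx<cy)
    where
    cancel : ∀ x → c⁻¹ * (c * x) ≈ x
    cancel x = trans (sym (*-assoc _ _ _)) (trans (*-congʳ c⁻¹c≈1) (*-identityˡ x))

  *-cancelˡ-pos : ∀ {c x y} → 0# < c → c * x ≈ c * y → x ≈ y
  *-cancelˡ-pos 0<c cx≈cy = ≮∧≯⇒≈
    (λ x<y → <-irrefl cx≈cy (*-monoʳ-<-pos 0<c x<y))
    (λ y<x → <-irrefl (sym cx≈cy) (*-monoʳ-<-pos 0<c y<x))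

  fromℤ-pos : ∀ {i} → + 0 ℤ.< i → 0# < fromℤ i
  fromℤ-pos {+ suc n} _ = fromℕ-pos n
  fromℤ-pos {+ zero}  (ℤ.+<+ ())

  fromℤ-mono-< : ∀ {i j} → i ℤ.< j → fromℤ i < fromℤ j
  fromℤ-mono-< {i} {j} i<j = 0<y-x⇒x<y (<-respʳ-≈
    (trans (fromℤ-homo-+ j (ℤ.- i)) (+-congˡ (fromℤ-homo-neg i)))
    (fromℤ-pos (subst (ℤ._< j ℤ.- i) (ℤ.+-inverseʳ i) (ℤ.+-monoˡ-< (ℤ.- i) i<j))))

  fromℤ-cancel-< : ∀ {i j} → fromℤ i < fromℤ j → i ℤ.< j
  fromℤ-cancel-< {i} {j} fi<fj with i ℤ.<? j
  ... | yes i<j = i<j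
  ... | no  i≮j with i ℤ.≟ j
  ...   | yes i≡j = contradiction fi<fj (<-irrefl (reflexive (cong fromℤ i≡j)))
  ...   | no  i≢j = contradiction (fromℤ-mono-< (ℤ.≤∧≢⇒< (ℤ.≮⇒≥ i≮j) (i≢j ∘ ≡.sym))) (<-asym fi<fj)

  -- The ordered embedding of ℚ in ℝ

  ↧-pos : ∀ q → 0# < fromℤ (ℚ.↧ q)
  ↧-pos q = fromℕ-pos (ℚ.denominator-1 q)

  ↧*fromℚ : ∀ q → fromℤ (ℚ.↧ q) * fromℚ q ≈ fromℤ (ℚ.↥ q)
  ↧*fromℚ q with #⇒invertible (inj₂ (fromℕ-pos (ℚ.denominator-1 q)))
  ... | y , yx≈1 , _ = begin
    d * (n * y)         ≈⟨ solve 3 (λ d n y → d :* (n :* y) := n :* (y :* (d :- con (+ 0)))) refl d n y ⟩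
    n * (y * (d - 0#))  ≈⟨ *-congˡ yx≈1 ⟩
    n * 1#              ≈⟨ *-identityʳ n ⟩
    n                   ∎
    where
    d n : ℝ
    d = fromℤ (ℚ.↧ q)
    n = fromℤ (ℚ.↥ q)

  -- Sums and products in ℚ are reduced to lowest terms, so their numerators are not those of the
  -- usual formulas. By cross multiplication any unreduced fraction for `q` determines `fromℚ q`,
  -- and the homomorphism laws can be checked on unreduced fractions.
  fromℚ-unique : ∀ q n d-1 {x} → ℚ.toℚᵘ q ℚᵘ.≃ ℚᵘ.mkℚᵘ n d-1 →
                 fromℤ (+ suc d-1) * x ≈ fromℤ n → fromℚ q ≈ x
  fromℚ-unique q@(mkℚ m e-1 _) n d-1 {x} (ℚᵘ.*≡* md≡ne) dx≈n =
    *-cancelˡ-pos (*-pos (↧-pos q) (fromℕ-pos d-1)) (begin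
      e * d * fromℚ q    ≈⟨ solve 3 (λ e d y → e :* d :* y := (e :* y) :* d) refl e d (fromℚ q) ⟩
      e * fromℚ q * d    ≈⟨ *-congʳ (↧*fromℚ q) ⟩
      fromℤ m * d        ≈⟨ fromℤ-homo-* m (+ suc d-1) ⟨
      fromℤ (m ℤ.* + suc d-1) ≡⟨ cong fromℤ md≡ne ⟩
      fromℤ (n ℤ.* + suc e-1) ≈⟨ fromℤ-homo-* n (+ suc e-1) ⟩
      fromℤ n * e        ≈⟨ *-congʳ dx≈n ⟨
      d * x * e          ≈⟨ solve 3 (λ e d x → d :* x :* e := e :* d :* x) refl e d x ⟩
      e * d * x          ∎)
    where
    d e : ℝ
    d = fromℤ (+ suc d-1)
    e = fromℤ (+ suc e-1)

  fromℚ-homo-+ : ∀ p q → fromℚ (p ℚ.+ q) ≈ fromℚ p + fromℚ q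
  fromℚ-homo-+ p@(mkℚ n d-1 _) q@(mkℚ m e-1 _) = fromℚ-unique (p ℚ.+ q) _ _ (ℚ.toℚᵘ-homo-+ p q) (begin
    fromℤ (+ (suc d-1 ℕ.* suc e-1)) * (x + y) ≈⟨ *-congʳ (fromℕ-homo-* (suc d-1) (suc e-1)) ⟩
    d * e * (x + y)                     ≈⟨ solve 4 (λ d e x y → d :* e :* (x :+ y) := (d :* x) :* e :+ (e :* y) :* d) refl d e x y ⟩
    d * x * e + e * y * d               ≈⟨ +-cong (*-congʳ (↧*fromℚ p)) (*-congʳ (↧*fromℚ q)) ⟩
    fromℤ n * e + fromℤ m * d           ≈⟨ +-cong (fromℤ-homo-* n (+ suc e-1)) (fromℤ-homo-* m (+ suc d-1)) ⟨
    fromℤ (n ℤ.* + suc e-1) + fromℤ (m ℤ.* + suc d-1)  ≈⟨ fromℤ-homo-+ (n ℤ.* + suc e-1) (m ℤ.* + suc d-1) ⟨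
    fromℤ (n ℤ.* + suc e-1 ℤ.+ m ℤ.* + suc d-1)  ∎)
    where
    d e x y : ℝ
    d = fromℤ (+ suc d-1)
    e = fromℤ (+ suc e-1)
    x = fromℚ p
    y = fromℚ q

  fromℚ-homo-* : ∀ p q → fromℚ (p ℚ.* q) ≈ fromℚ p * fromℚ q
  fromℚ-homo-* p@(mkℚ n d-1 _) q@(mkℚ m e-1 _) = fromℚ-unique (p ℚ.* q) _ _ (ℚ.toℚᵘ-homo-* p q) (begin
    fromℤ (+ (suc d-1 ℕ.* suc e-1)) * (x * y) ≈⟨ *-congʳ (fromℕ-homo-* (suc d-1) (suc e-1)) ⟩
    d * e * (x * y)                     ≈⟨ solve 4 (λ d e x y → d :* e :* (x :* y) := (d :* x) :* (e :* y)) refl d e x y ⟩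
    d * x * (e * y)                     ≈⟨ *-cong (↧*fromℚ p) (↧*fromℚ q) ⟩
    fromℤ n * fromℤ m                   ≈⟨ fromℤ-homo-* n m ⟨
    fromℤ (n ℤ.* m)  ∎)
    where
    d e x y : ℝ
    d = fromℤ (+ suc d-1)
    e = fromℤ (+ suc e-1)
    x = fromℚ p
    y = fromℚ q

  fromℚ-fromℤ : ∀ i → fromℚ (i ℚ./ 1) ≈ fromℤ i
  fromℚ-fromℤ i = fromℚ-unique (i ℚ./ 1) i 0 (ℚ.toℚᵘ-fromℚᵘ (ℚᵘ.mkℚᵘ i 0))
    (solve 1 (λ x → con (+ 1) :* x := x) refl (fromℤ i))

  fromℚ-homo-neg : ∀ p → fromℚ (ℚ.- p) ≈ - fromℚ p
  fromℚ-homo-neg p = begin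
    fromℚ (ℚ.- p)                          ≈⟨ solve 2 (λ x y → x := x :+ y :- y) refl _ (fromℚ p) ⟩
    fromℚ (ℚ.- p) + fromℚ p - fromℚ p      ≈⟨ +-congʳ (fromℚ-homo-+ (ℚ.- p) p) ⟨
    fromℚ (ℚ.- p ℚ.+ p) - fromℚ p          ≡⟨ cong (λ r → fromℚ r - fromℚ p) (ℚ.+-inverseˡ p) ⟩
    fromℚ 0ℚ - fromℚ p                     ≈⟨ +-congʳ (fromℚ-fromℤ (+ 0)) ⟩
    0# - fromℚ p                           ≈⟨ +-identityˡ _ ⟩
    - fromℚ p                              ∎

  fromℚ-pos : ∀ {q} → 0ℚ ℚ.< q → 0# < fromℚ q
  fromℚ-pos {q} 0<q = *-cancelˡ-<-pos (↧-pos q) (<-resp₂-≈ (sym (zeroʳ _)) (sym (↧*fromℚ q))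
    (fromℤ-pos (ℤ.positive⁻¹ (ℚ.↥ q) ⦃ positive-↥ q (ℚ.positive 0<q) ⦄)))
    where
    positive-↥ : ∀ q → ℚ.Positive q → ℤ.Positive (ℚ.↥ q)
    positive-↥ (mkℚ _ _ _) q>0 = q>0

  fromℚ-mono-< : ∀ {p q} → p ℚ.< q → fromℚ p < fromℚ q
  fromℚ-mono-< {p} {q} p<q = 0<y-x⇒x<y (<-respʳ-≈
    (trans (fromℚ-homo-+ q (ℚ.- p)) (+-congˡ (fromℚ-homo-neg p)))
    (fromℚ-pos (subst (ℚ._< q ℚ.- p) (ℚ.+-inverseʳ p) (ℚ.+-monoˡ-< (ℚ.- p) p<q))))

  -- Trichotomy holds in ℚ, and monotonicity refutes the two other cases.
  fromℚ-cancel-< : ∀ {p q} → fromℚ p < fromℚ q → p ℚ.< q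
  fromℚ-cancel-< {p} {q} fp<fq with p ℚ.<? q
  ... | yes p<q = p<q
  ... | no  p≮q with p ℚ.≟ q
  ...   | yes p≡q = contradiction fp<fq (<-irrefl (reflexive (cong fromℚ p≡q)))
  ...   | no  p≢q = contradiction (fromℚ-mono-< (≤∧≢⇒< (ℚ.≮⇒≥ p≮q) p≢q)) (<-asym fp<fq)
    where
    ≤∧≢⇒< : ∀ {p q} → q ℚ.≤ p → p ≢ q → q ℚ.< p
    ≤∧≢⇒< q≤p p≢q = ℚ.≰⇒> λ p≤q → p≢q (ℚ.≤-antisym p≤q q≤p)

  fromℚ-injective : ∀ {p q} → fromℚ p ≈ fromℚ q → p ≡ q
  fromℚ-injective fp≈fq = ℚ.≤-antisym
    (ℚ.≮⇒≥ λ q<p → <-irrefl (sym fp≈fq) (fromℚ-mono-< q<p))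
    (ℚ.≮⇒≥ λ p<q → <-irrefl fp≈fq (fromℚ-mono-< p<q))

-- Rational arithmetic and rounding to the nearest integer

ℚ-ring : ACR.AlmostCommutativeRing _ _
ℚ-ring = ACR.fromCommutativeRing ℚ.+-*-commutativeRing λ x → dec⇒maybe (0ℚ ℚ.≟ x)

module RationalProperties where
  open ≡ using (refl; sym; trans)
  open import Data.Rational.Base using (_+_; _*_; _-_; -_; _≤_; _<_)

  ι : ℤ → ℚ
  ι i = i ℚ./ 1

  toℚᵘ-ι : ∀ i → ℚ.toℚᵘ (ι i) ℚᵘ.≃ ℚᵘ.mkℚᵘ i 0
  toℚᵘ-ι i = ℚ.toℚᵘ-fromℚᵘ (ℚᵘ.mkℚᵘ i 0)

  ι-homo-+ : ∀ i j → ι (i ℤ.+ j) ≡ ι i + ι j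
  ι-homo-+ i j = ℚ.toℚᵘ-injective (ℚᵘ.≃-trans (toℚᵘ-ι (i ℤ.+ j)) (ℚᵘ.≃-sym (ℚᵘ.≃-trans (ℚ.toℚᵘ-homo-+ (ι i) (ι j))
    (ℚᵘ.≃-trans (ℚᵘ.+-cong (toℚᵘ-ι i) (toℚᵘ-ι j)) (ℚᵘ.*≡* (lemma i j))))))
    where
    lemma : ∀ i j → (i ℤ.* + 1 ℤ.+ j ℤ.* + 1) ℤ.* + 1 ≡ (i ℤ.+ j) ℤ.* (+ 1 ℤ.* + 1)
    lemma = ℤ-Solver.solve-∀

  ι-homo-* : ∀ i j → ι (i ℤ.* j) ≡ ι i * ι j
  ι-homo-* i j = ℚ.toℚᵘ-injective (ℚᵘ.≃-trans (toℚᵘ-ι (i ℤ.* j)) (ℚᵘ.≃-sym (ℚᵘ.≃-trans (ℚ.toℚᵘ-homo-* (ι i) (ι j))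
    (ℚᵘ.≃-trans (ℚᵘ.*-cong (toℚᵘ-ι i) (toℚᵘ-ι j)) (ℚᵘ.*≡* (lemma i j))))))
    where
    lemma : ∀ i j → (i ℤ.* j) ℤ.* + 1 ≡ (i ℤ.* j) ℤ.* (+ 1 ℤ.* + 1)
    lemma = ℤ-Solver.solve-∀

  ι-homo-neg : ∀ i → ι (ℤ.- i) ≡ - ι i
  ι-homo-neg (+ zero)  = refl
  ι-homo-neg (+ suc n) = refl
  ι-homo-neg -[1+ n ]  = sym (neg-involutive (ι (+ suc n)))
    where
    neg-involutive : ∀ p → - (- p) ≡ p
    neg-involutive = RingSolver.solve-∀ ℚ-ring

  ι-homo-- : ∀ i j → ι (i ℤ.- j) ≡ ι i - ι j
  ι-homo-- i j = trans (ι-homo-+ i (ℤ.- j)) (cong (λ x → ι i + x) (ι-homo-neg j))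

  ι-injective : ∀ {i j} → ι i ≡ ι j → i ≡ j
  ι-injective {i} {j} ιi≡ιj with ℚᵘ.≃-trans (ℚᵘ.≃-sym (toℚᵘ-ι i)) (ℚᵘ.≃-trans (ℚᵘ.≃-reflexive (cong ℚ.toℚᵘ ιi≡ιj)) (toℚᵘ-ι j))
  ... | ℚᵘ.*≡* eq = trans (sym (ℤ.*-identityʳ i)) (trans eq (ℤ.*-identityʳ j))

  ι-nonNeg : ∀ {i} → + 0 ℤ.≤ i → 0ℚ ≤ ι i
  ι-nonNeg {+ n} _ = ℚ.nonNegative⁻¹ (ι (+ n)) ⦃ ℚ.normalize-nonNeg n 1 ⦄

  ι-pos : ∀ {i} → + 0 ℤ.< i → 0ℚ < ι i
  ι-pos {+ suc n} _ = ℚ.positive⁻¹ (ι (+ suc n)) ⦃ ℚ.normalize-pos (suc n) 1 ⦄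
  ι-pos {+ zero} (ℤ.+<+ ())

  ↧*q : ∀ q → ι (ℚ.↧ q) * q ≡ ι (ℚ.↥ q)
  ↧*q q@(mkℚ n d-1 _) = ℚ.toℚᵘ-injective (ℚᵘ.≃-trans (ℚ.toℚᵘ-homo-* (ι (+ suc d-1)) q)
    (ℚᵘ.≃-trans (ℚᵘ.*-cong (toℚᵘ-ι (+ suc d-1)) (ℚᵘ.≃-refl {ℚ.toℚᵘ q})) (ℚᵘ.≃-trans (ℚᵘ.*≡* (lemma (+ suc d-1) n)) (ℚᵘ.≃-sym (toℚᵘ-ι n)))))
    where
    lemma : ∀ d n → (d ℤ.* n) ℤ.* + 1 ≡ n ℤ.* (+ 1 ℤ.* d)
    lemma = ℤ-Solver.solve-∀

  +-nonNeg : ∀ {p q} → 0ℚ ≤ p → 0ℚ ≤ q → 0ℚ ≤ p + q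
  +-nonNeg = ℚ.+-mono-≤

  +-pos-nonNeg : ∀ {p q} → 0ℚ < p → 0ℚ ≤ q → 0ℚ < p + q
  +-pos-nonNeg = ℚ.+-mono-<-≤

  *-nonNeg : ∀ {p q} → 0ℚ ≤ p → 0ℚ ≤ q → 0ℚ ≤ p * q
  *-nonNeg {p} {q} 0≤p 0≤q = ℚ.nonNegative⁻¹ (p * q)
    ⦃ ℚ.nonNeg*nonNeg⇒nonNeg p ⦃ ℚ.nonNegative 0≤p ⦄ q ⦃ ℚ.nonNegative 0≤q ⦄ ⦄

  *-pos : ∀ {p q} → 0ℚ < p → 0ℚ < q → 0ℚ < p * q
  *-pos {p} {q} 0<p 0<q = ℚ.positive⁻¹ (p * q)
    ⦃ ℚ.pos*pos⇒pos p ⦃ ℚ.positive 0<p ⦄ q ⦃ ℚ.positive 0<q ⦄ ⦄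

  0≤² : ∀ p → 0ℚ ≤ p * p
  0≤² p with ℚ.≤-total 0ℚ p
  ... | inj₁ 0≤p = *-nonNeg 0≤p 0≤p
  ... | inj₂ p≤0 = subst (0ℚ ≤_) (lemma p) (*-nonNeg (ℚ.neg-antimono-≤ p≤0) (ℚ.neg-antimono-≤ p≤0))
    where
    lemma : ∀ p → (- p) * (- p) ≡ p * p
    lemma = RingSolver.solve-∀ ℚ-ring

  *-cancelˡ-pos : ∀ {c p q} → 0ℚ < c → c * p ≡ c * q → p ≡ q
  *-cancelˡ-pos {c} 0<c eq = ℚ.≤-antisym
    (ℚ.*-cancelˡ-≤-pos c ⦃ ℚ.positive 0<c ⦄ (ℚ.≤-reflexive eq))
    (ℚ.*-cancelˡ-≤-pos c ⦃ ℚ.positive 0<c ⦄ (ℚ.≤-reflexive (sym eq)))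

  p≤q⇒0≤q-p : ∀ {p q} → p ≤ q → 0ℚ ≤ q - p
  p≤q⇒0≤q-p {p} {q} p≤q = subst (_≤ q - p) (ℚ.+-inverseʳ p) (ℚ.+-monoˡ-≤ (- p) p≤q)

  p*q≡0⇒q≡0 : ∀ p q → p ≢ 0ℚ → p * q ≡ 0ℚ → q ≡ 0ℚ
  p*q≡0⇒q≡0 p q p≢0 pq≡0 = begin
    q                   ≡⟨ ℚ.*-identityˡ q ⟨
    1ℚ * q              ≡⟨ cong (_* q) (ℚ.*-inverseˡ p) ⟨
    ℚ.1/ p * p * q      ≡⟨ ℚ.*-assoc (ℚ.1/ p) p q ⟩
    ℚ.1/ p * (p * q)    ≡⟨ cong (ℚ.1/ p *_) pq≡0 ⟩
    ℚ.1/ p * 0ℚ         ≡⟨ ℚ.*-zeroʳ (ℚ.1/ p) ⟩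
    0ℚ                  ∎
    where
    open ≡.≡-Reasoning
    instance _ = ℚ.≢-nonZero p≢0

  ι-nonNeg⁻¹ : ∀ i → 0ℚ ≤ ι i → + 0 ℤ.≤ i
  ι-nonNeg⁻¹ i 0≤ιi = ℤ.≮⇒≥ λ i<0 → ℚ.<-irrefl {0ℚ} {0ℚ} refl (subst (0ℚ <_)
    (trans (sym (ι-homo-+ (ℤ.- i) i)) (cong ι (ℤ.+-inverseˡ i)))
    (+-pos-nonNeg {ι (ℤ.- i)} {ι i} (ι-pos {ℤ.- i} (ℤ.neg-mono-< i<0)) 0≤ιi))

  -- The witness is the floor of q + 1/2, computed as the integer quotient of 2n + d by 2d for q =
  -- n/d. The remainder r satisfies r = d (1 + 2 (q - m)) and 2d - r = d (1 - 2 (q - m)), so 0 ≤ r <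
  -- 2d gives both bounds. They have the shape of the factors of 1 - 4 (q - m)².
  nearest-integer : ∀ q → ∃[ m ] 0ℚ ≤ 1ℚ - ι (+ 2) * (q - ι m) × 0ℚ ≤ 1ℚ + ι (+ 2) * (q - ι m)
  nearest-integer q@(mkℚ n d-1 _) = m , clear (+ 2 ℤ.* d ℤ.- r) 0≤2d-r lower , clear r (ℤ.+≤+ ℕ.z≤n) upper
    where
    open ≡.≡-Reasoning
    d a r m : ℤ
    d = + suc d-1
    a = + 2 ℤ.* n ℤ.+ d
    m = a ℤ./ (+ 2 ℤ.* d)
    r = + (a ℤ.% (+ 2 ℤ.* d))

    a≡r+2dm : a ≡ r ℤ.+ m ℤ.* (+ 2 ℤ.* d)
    a≡r+2dm = ℤ.a≡a%n+[a/n]*n a (+ 2 ℤ.* d)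

    0≤2d-r : + 0 ℤ.≤ + 2 ℤ.* d ℤ.- r
    0≤2d-r = ℤ.i≤j⇒0≤j-i (ℤ.<⇒≤ (ℤ.+<+ (ℤ.n%d<d a (+ 2 ℤ.* d))))

    clear : ∀ i {p} → + 0 ℤ.≤ i → ι i ≡ ι d * p → 0ℚ ≤ p
    clear i 0≤i eq = ℚ.*-cancelˡ-≤-pos (ι d) ⦃ ℚ.normalize-pos (suc d-1) 1 ⦄
      (subst₂ _≤_ (sym (ℚ.*-zeroʳ (ι d))) eq (ι-nonNeg 0≤i))

    upper : ι r ≡ ι d * (1ℚ + ι (+ 2) * (q - ι m))
    upper = begin
      ι r
        ≡⟨ cong ι (trans (solve₁ r (m ℤ.* (+ 2 ℤ.* d))) (cong (ℤ._- m ℤ.* (+ 2 ℤ.* d)) (sym a≡r+2dm))) ⟩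
      ι (a ℤ.- m ℤ.* (+ 2 ℤ.* d))
        ≡⟨ trans (ι-homo-- a (m ℤ.* (+ 2 ℤ.* d))) (cong₂ _-_ (trans (ι-homo-+ (+ 2 ℤ.* n) d) (cong (_+ ι d) (ι-homo-* (+ 2) n))) (trans (ι-homo-* m (+ 2 ℤ.* d)) (cong (ι m *_) (ι-homo-* (+ 2) d)))) ⟩
      ι (+ 2) * ι n + ι d - ι m * (ι (+ 2) * ι d)
        ≡⟨ cong (λ x → ι (+ 2) * x + ι d - ι m * (ι (+ 2) * ι d)) (sym (↧*q q)) ⟩
      ι (+ 2) * (ι d * q) + ι d - ι m * (ι (+ 2) * ι d)
        ≡⟨ solve₂ (ι (+ 2)) (ι d) q (ι m) ⟩
      ι d * (1ℚ + ι (+ 2) * (q - ι m))  ∎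
      where
      solve₁ : ∀ r s → r ≡ (r ℤ.+ s) ℤ.- s
      solve₁ = ℤ-Solver.solve-∀
      solve₂ : ∀ t d q m → t * (d * q) + d - m * (t * d) ≡ d * (1ℚ + t * (q - m))
      solve₂ = RingSolver.solve-∀ ℚ-ring

    lower : ι (+ 2 ℤ.* d ℤ.- r) ≡ ι d * (1ℚ - ι (+ 2) * (q - ι m))
    lower = begin
      ι (+ 2 ℤ.* d ℤ.- r)
        ≡⟨ trans (ι-homo-- (+ 2 ℤ.* d) r) (cong₂ _-_ (ι-homo-* (+ 2) d) upper) ⟩
      (1ℚ + 1ℚ) * ι d - ι d * (1ℚ + ι (+ 2) * (q - ι m))
        ≡⟨ solve₁ (ι (+ 2)) (ι d) q (ι m) ⟩
      ι d * (1ℚ - ι (+ 2) * (q - ι m))  ∎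
      where
      solve₁ : ∀ t d q m → (1ℚ + 1ℚ) * d - d * (1ℚ + t * (q - m)) ≡ d * (1ℚ - t * (q - m))
      solve₁ = RingSolver.solve-∀ ℚ-ring

  -- With a = 1 - 4r² ≥ 0 and b = 1 - 4s² ≥ 0, the difference 8 (ν - f(r, s)) equals
  -- 2ν + 3ν(a + b) + 2(ν + τ)(r - s)² + 2(ν - τ)(r + s)².
  reduced-form : ∀ {ν τ r s} → 0ℚ < ν → 0ℚ ≤ ν + τ → 0ℚ ≤ ν - τ →
    0ℚ ≤ 1ℚ - ι (+ 2) * r → 0ℚ ≤ 1ℚ + ι (+ 2) * r → 0ℚ ≤ 1ℚ - ι (+ 2) * s → 0ℚ ≤ 1ℚ + ι (+ 2) * s →
    ¬ (ν ≤ r * r * ν + s * s * ν + (r * s) * τ)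
  reduced-form {ν} {τ} {r} {s} 0<ν 0≤ν+τ 0≤ν-τ 1-2r 1+2r 1-2s 1+2s ν≤f =
    ℚ.<-irrefl {0ℚ} {0ℚ} refl (subst (0ℚ <_) (lemma ν τ r s) 0<total)
    where
    a b e f : ℚ
    a = (1ℚ - ι (+ 2) * r) * (1ℚ + ι (+ 2) * r)
    b = (1ℚ - ι (+ 2) * s) * (1ℚ + ι (+ 2) * s)
    e = (ν + τ) * ((r - s) * (r - s)) + (ν - τ) * ((r + s) * (r + s))
    f = r * r * ν + s * s * ν + (r * s) * τ

    0≤a : 0ℚ ≤ a
    0≤a = *-nonNeg 1-2r 1+2r

    0≤b : 0ℚ ≤ b
    0≤b = *-nonNeg 1-2s 1+2s

    0≤e : 0ℚ ≤ e
    0≤e = +-nonNeg (*-nonNeg 0≤ν+τ (0≤² (r - s))) (*-nonNeg 0≤ν-τ (0≤² (r + s)))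

    0≤νab : 0ℚ ≤ ν * (a + b)
    0≤νab = *-nonNeg (ℚ.<⇒≤ 0<ν) (+-nonNeg 0≤a 0≤b)

    0<total : 0ℚ < ν + ν + (ι (+ 3) * (ν * (a + b)) + ι (+ 2) * e) + ι (+ 8) * (f - ν)
    0<total = +-pos-nonNeg {ν + ν + (ι (+ 3) * (ν * (a + b)) + ι (+ 2) * e)} {ι (+ 8) * (f - ν)}
      (+-pos-nonNeg {ν + ν} (+-pos-nonNeg 0<ν (ℚ.<⇒≤ 0<ν))
        (+-nonNeg (*-nonNeg {ι (+ 3)} (ι-nonNeg {+ 3} (ℤ.+≤+ ℕ.z≤n)) 0≤νab)
                  (*-nonNeg {ι (+ 2)} (ι-nonNeg {+ 2} (ℤ.+≤+ ℕ.z≤n)) 0≤e)))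
      (*-nonNeg {ι (+ 8)} (ι-nonNeg {+ 8} (ℤ.+≤+ ℕ.z≤n)) (p≤q⇒0≤q-p ν≤f))

    lemma : ∀ ν τ r s →
      ν + ν + ((1ℚ + 1ℚ + 1ℚ) * (ν * ((1ℚ - (1ℚ + 1ℚ) * r) * (1ℚ + (1ℚ + 1ℚ) * r) + (1ℚ - (1ℚ + 1ℚ) * s) * (1ℚ + (1ℚ + 1ℚ) * s))) +
      (1ℚ + 1ℚ) * ((ν + τ) * ((r - s) * (r - s)) + (ν - τ) * ((r + s) * (r + s)))) +
      (1ℚ + 1ℚ + 1ℚ + 1ℚ + 1ℚ + 1ℚ + 1ℚ + 1ℚ) * (r * r * ν + s * s * ν + (r * s) * τ - ν) ≡ 0ℚ
    lemma = RingSolver.solve-∀ ℚ-ring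

-- The norm form of the quadratic field and coordinates in a basis

module QuadraticFieldProperties {R : RealNumbers} (F : ImaginaryQuadraticField R) where
  open ≡ using (refl; sym; trans)
  open RationalProperties
  open import Data.Rational.Base using (_+_; _*_; _-_; -_; _≤_; _<_)
  open ImaginaryQuadraticField F public using (d; d-squarefree; √d; √d>0; √d²≈d; K; embed; 0K; 1K; _·_; trace; ∑;
    IsFinitelyGenerated; CoefficientRing; Order; IsDiscriminant; embedSet)
    renaming (_+_ to _⊕_; _*_ to _⊛_; -_ to ⊖_)

  dℚ : ℚ
  dℚ = + d ℚ./ 1

  0<dℚ : 0ℚ < dℚ
  0<dℚ = ι-pos (ℤ.+<+ (ℕ.n≢0⇒n>0 d≢0))
    where
    d≢0 : d ≢ 0
    d≢0 d≡0 with d-squarefree 2 (subst (4 ℕ.∣_) (sym d≡0) (4 ℕ.∣0))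
    ... | ()

  -- The conjugate of α times β equals `T α β` + `det α β` √-d. Thus `T` is the dot product of the
  -- embedded elements, `N` is the field norm, and `gram` is the multiplicativity of the norm
  -- applied to this product.
  T : K → K → ℚ
  T (p , q) (p′ , q′) = p * p′ + dℚ * (q * q′)

  N : K → ℚ
  N α = T α α

  det : K → K → ℚ
  det (p , q) (p′ , q′) = p * q′ - q * p′

  N-linear : ∀ r s α β → N (r · α ⊕ s · β) ≡ r * r * N α + s * s * N β + (r * s) * (T α β + T α β)
  N-linear r s (p , q) (p′ , q′) = lemma dℚ r s p q p′ q′
    where
    lemma : ∀ D r s p q p′ q′ →
      (r * p + s * p′) * (r * p + s * p′) + D * ((r * q + s * q′) * (r * q + s * q′)) ≡
      r * r * (p * p + D * (q * q)) + s * s * (p′ * p′ + D * (q′ * q′)) +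
      (r * s) * ((p * p′ + D * (q * q′)) + (p * p′ + D * (q * q′)))
    lemma = RingSolver.solve-∀ ℚ-ring

  gram : ∀ α β → N α * N β ≡ T α β * T α β + dℚ * (det α β * det α β)
  gram (p , q) (p′ , q′) = lemma dℚ p q p′ q′
    where
    lemma : ∀ D p q p′ q′ → (p * p + D * (q * q)) * (p′ * p′ + D * (q′ * q′)) ≡
      (p * p′ + D * (q * q′)) * (p * p′ + D * (q * q′)) + D * ((p * q′ - q * p′) * (p * q′ - q * p′))
    lemma = RingSolver.solve-∀ ℚ-ring

  _≟K_ : (α β : K) → Dec (α ≡ β)
  (p , q) ≟K (p′ , q′) with p ℚ.≟ p′ | q ℚ.≟ q′
  ... | yes refl | yes refl = yes refl
  ... | no  p≢p′ | _        = no λ { refl → p≢p′ refl }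
  ... | _        | no q≢q′  = no λ { refl → q≢q′ refl }

  cramer : ∀ α β ξ → det α β ≢ 0ℚ → ∃₂ λ r s → ξ ≡ r · α ⊕ s · β
  cramer α@(p , q) β@(p′ , q′) ξ@(z , w) Δ≢0 = i * det ξ β , i * det α ξ ,
    cong₂ _,_ (trans (clear z) (lemma₁ i p q p′ q′ z w)) (trans (clear w) (lemma₂ i p q p′ q′ z w))
    where
    instance _ = ℚ.≢-nonZero Δ≢0
    i : ℚ
    i = ℚ.1/ (det α β)
    clear : ∀ z → z ≡ (i * det α β) * z
    clear z = sym (trans (cong (_* z) (ℚ.*-inverseˡ (det α β))) (ℚ.*-identityˡ z))
    lemma₁ : ∀ i p q p′ q′ z w → (i * (p * q′ - q * p′)) * z ≡ (i * (z * q′ - w * p′)) * p + (i * (p * w - q * z)) * p′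
    lemma₁ = RingSolver.solve-∀ ℚ-ring
    lemma₂ : ∀ i p q p′ q′ z w → (i * (p * q′ - q * p′)) * w ≡ (i * (z * q′ - w * p′)) * q + (i * (p * w - q * z)) * q′
    lemma₂ = RingSolver.solve-∀ ℚ-ring

  -- The coefficients `1ℚ` and `- 1ℚ` are what `ι (+ 1)` and `ι -[1+ 0 ]` evaluate to, so the left
  -- side is an instance of `ClosedUnderℤ`.
  difference : ∀ r s r′ s′ α β → 1ℚ · (r · α ⊕ s · β) ⊕ (- 1ℚ) · (r′ · α ⊕ s′ · β) ≡ (r - r′) · α ⊕ (s - s′) · β
  difference r s r′ s′ (p , q) (p′ , q′) = cong₂ _,_ (lemma r s r′ s′ p p′) (lemma r s r′ s′ q q′)
    where
    lemma : ∀ r s r′ s′ p p′ → 1ℚ * (r * p + s * p′) + (- 1ℚ) * (r′ * p + s′ * p′) ≡ (r - r′) * p + (s - s′) * p′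
    lemma = RingSolver.solve-∀ ℚ-ring

  difference≡0 : ∀ r s r′ s′ α β → (r - r′) · α ⊕ (s - s′) · β ≡ 0K → r · α ⊕ s · β ≡ r′ · α ⊕ s′ · β
  difference≡0 r s r′ s′ (p , q) (p′ , q′) eq = cong₂ _,_ (solution p p′ (cong proj₁ eq)) (solution q q′ (cong proj₂ eq))
    where
    lemma : ∀ r s r′ s′ p p′ → r * p + s * p′ ≡ ((r - r′) * p + (s - s′) * p′) + (r′ * p + s′ * p′)
    lemma = RingSolver.solve-∀ ℚ-ring
    solution : ∀ p p′ → (r - r′) * p + (s - s′) * p′ ≡ 0ℚ → r * p + s * p′ ≡ r′ * p + s′ * p′
    solution p p′ eq = trans (lemma r s r′ s′ p p′) (trans (cong (_+ (r′ * p + s′ * p′)) eq) (ℚ.+-identityˡ _))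

  nested-combination : ∀ m n r s r′ s′ α β → m · (r · α ⊕ s · β) ⊕ n · (r′ · α ⊕ s′ · β) ≡ (m * r + n * r′) · α ⊕ (m * s + n * s′) · β
  nested-combination m n r s r′ s′ (p , q) (p′ , q′) = cong₂ _,_ (lemma m n r s r′ s′ p p′) (lemma m n r s r′ s′ q q′)
    where
    lemma : ∀ m n r s r′ s′ p p′ → m * (r * p + s * p′) + n * (r′ * p + s′ * p′) ≡ (m * r + n * r′) * p + (m * s + n * s′) * p′
    lemma = RingSolver.solve-∀ ℚ-ring

  coordinates-unique : ∀ r s r′ s′ α β → det α β ≢ 0ℚ → r · α ⊕ s · β ≡ r′ · α ⊕ s′ · β → r ≡ r′ × s ≡ s′
  coordinates-unique r s r′ s′ α β Δ≢0 eq =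
    cancel r r′ (trans (sym (detˡ r s α β)) (trans (cong (λ ξ → det ξ β) eq) (detˡ r′ s′ α β))) ,
    cancel s s′ (trans (sym (detʳ r s α β)) (trans (cong (det α) eq) (detʳ r′ s′ α β)))
    where
    detˡ : ∀ r s α β → det (r · α ⊕ s · β) β ≡ det α β * r
    detˡ r s (p , q) (p′ , q′) = lemma r s p q p′ q′
      where
      lemma : ∀ r s p q p′ q′ → (r * p + s * p′) * q′ - (r * q + s * q′) * p′ ≡ (p * q′ - q * p′) * r
      lemma = RingSolver.solve-∀ ℚ-ring
    detʳ : ∀ r s α β → det α (r · α ⊕ s · β) ≡ det α β * s
    detʳ r s (p , q) (p′ , q′) = lemma r s p q p′ q′
      where
      lemma : ∀ r s p q p′ q′ → p * (r * q + s * q′) - q * (r * p + s * p′) ≡ (p * q′ - q * p′) * s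
      lemma = RingSolver.solve-∀ ℚ-ring
    cancel : ∀ r r′ → det α β * r ≡ det α β * r′ → r ≡ r′
    cancel r r′ eq = trans (lemma r r′) (trans (cong (_+ r′) r-r′≡0) (ℚ.+-identityˡ r′))
      where
      lemma : ∀ r r′ → r ≡ (r - r′) + r′
      lemma = RingSolver.solve-∀ ℚ-ring
      distrib : ∀ e r r′ → e * (r - r′) ≡ e * r - e * r′
      distrib = RingSolver.solve-∀ ℚ-ring
      r-r′≡0 : r - r′ ≡ 0ℚ
      r-r′≡0 = p*q≡0⇒q≡0 (det α β) (r - r′) Δ≢0 (trans (distrib (det α β) r r′)
        (trans (cong (_- det α β * r′) eq) (ℚ.+-inverseʳ (det α β * r′))))

  -- ℤ-submodules of K and generation by a pair of minimal elements

  ClosedUnderℤ : Pred K 0ℓ → Set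
  ClosedUnderℤ I = ∀ m n {x y} → x ∈ I → y ∈ I → ι m · x ⊕ ι n · y ∈ I

  ∑-linear : ∀ {n} (g : Fin n → K) (c c′ : Fin n → ℤ) i j →
    ∑ (λ k → ι (i ℤ.* c k ℤ.+ j ℤ.* c′ k) · g k) ≡ ι i · ∑ (λ k → ι (c k) · g k) ⊕ ι j · ∑ (λ k → ι (c′ k) · g k)
  ∑-linear {zero}  g c c′ i j = cong₂ _,_ (lemma (ι i) (ι j)) (lemma (ι i) (ι j))
    where
    lemma : ∀ i j → 0ℚ ≡ i * 0ℚ + j * 0ℚ
    lemma = RingSolver.solve-∀ ℚ-ring
  ∑-linear {suc n} g c c′ i j
    rewrite ι-homo-+ (i ℤ.* c Fin.zero) (j ℤ.* c′ Fin.zero) | ι-homo-* i (c Fin.zero) | ι-homo-* j (c′ Fin.zero)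
          | ∑-linear (g ∘ Fin.suc) (c ∘ Fin.suc) (c′ ∘ Fin.suc) i j =
    cong₂ _,_ (lemma (ι i) (ι j) (ι (c Fin.zero)) (ι (c′ Fin.zero)) (proj₁ (g Fin.zero)) _ _)
              (lemma (ι i) (ι j) (ι (c Fin.zero)) (ι (c′ Fin.zero)) (proj₂ (g Fin.zero)) _ _)
    where
    lemma : ∀ i j c c′ g s s′ → (i * c + j * c′) * g + (i * s + j * s′) ≡ i * (c * g + s) + j * (c′ * g + s′)
    lemma = RingSolver.solve-∀ ℚ-ring

  finitelyGenerated⇒closed : ∀ {I} → IsFinitelyGenerated I → ClosedUnderℤ I
  finitelyGenerated⇒closed (n , g , ∈⇔) i j {x} {y} x∈I y∈I
    with Equivalence.to (∈⇔ x) x∈I | Equivalence.to (∈⇔ y) y∈I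
  ... | c , refl | c′ , refl = Equivalence.from (∈⇔ _) ((λ k → i ℤ.* c k ℤ.+ j ℤ.* c′ k) , sym (∑-linear g c c′ i j))

  -- What survives in `K` of two pairs ± of minimal vectors; it serves both ideals. Linear
  -- independence is not a field: it follows from minimality and `α` ≠ ±`β`.
  record IsMinimalPair (I : Pred K 0ℓ) (α β : K) : Set where
    field
      closed  : ClosedUnderℤ I
      α∈I     : α ∈ I
      β∈I     : β ∈ I
      Nα≡Nβ   : N α ≡ N β
      0<N     : 0ℚ < N α
      α≢β     : α ≢ β
      α≢-β    : α ≢ ⊖ β
      minimal : ∀ x → x ∈ I → x ≢ 0K → N α ≤ N x

    ν τ : ℚ
    ν = N α
    τ = T α β + T α β

    N-coordinates : ∀ r s → N (r · α ⊕ s · β) ≡ r * r * ν + s * s * ν + (r * s) * τ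
    N-coordinates r s = trans (N-linear r s α β) (cong (λ x → r * r * ν + s * s * x + (r * s) * τ) (sym Nα≡Nβ))

    -- α + β is a nonzero element of norm 2ν + τ, so minimality gives 2ν + τ ≥ ν. The counterpart
    -- for ν - τ comes from α - β.
    0≤ν+τ : 0ℚ ≤ ν + τ
    0≤ν+τ = subst (0ℚ ≤_) (trans (cong (_- ν) (N-coordinates 1ℚ 1ℚ)) (lemma ν τ))
      (p≤q⇒0≤q-p (minimal _ (closed (+ 1) (+ 1) α∈I β∈I) λ eq → α≢-β
        (cong₂ _,_ (solution _ _ (cong proj₁ eq)) (solution _ _ (cong proj₂ eq)))))
      where
      lemma : ∀ ν τ → 1ℚ * 1ℚ * ν + 1ℚ * 1ℚ * ν + (1ℚ * 1ℚ) * τ - ν ≡ ν + τ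
      lemma = RingSolver.solve-∀ ℚ-ring
      lemma′ : ∀ p p′ → p ≡ (1ℚ * p + 1ℚ * p′) - p′
      lemma′ = RingSolver.solve-∀ ℚ-ring
      solution : ∀ p p′ → 1ℚ * p + 1ℚ * p′ ≡ 0ℚ → p ≡ - p′
      solution p p′ eq = trans (lemma′ p p′) (trans (cong (_- p′) eq) (ℚ.+-identityˡ _))

    0≤ν-τ : 0ℚ ≤ ν - τ
    0≤ν-τ = subst (0ℚ ≤_) (trans (cong (_- ν) (N-coordinates 1ℚ (- 1ℚ))) (lemma ν τ))
      (p≤q⇒0≤q-p (minimal _ (closed (+ 1) -[1+ 0 ] α∈I β∈I) λ eq → α≢β
        (cong₂ _,_ (solution _ _ (cong proj₁ eq)) (solution _ _ (cong proj₂ eq)))))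
      where
      lemma : ∀ ν τ → 1ℚ * 1ℚ * ν + (- 1ℚ) * (- 1ℚ) * ν + (1ℚ * (- 1ℚ)) * τ - ν ≡ ν - τ
      lemma = RingSolver.solve-∀ ℚ-ring
      lemma′ : ∀ p p′ → p ≡ (1ℚ * p + (- 1ℚ) * p′) + p′
      lemma′ = RingSolver.solve-∀ ℚ-ring
      solution : ∀ p p′ → 1ℚ * p + (- 1ℚ) * p′ ≡ 0ℚ → p ≡ p′
      solution p p′ eq = trans (lemma′ p p′) (trans (cong (_+ p′) eq) (ℚ.+-identityˡ _))

    -- By `gram`, (2ν + τ) (2ν - τ) equals four times `dℚ` times the squared determinant. Both
    -- factors are positive, as 2ν ± τ = ν + (ν ± τ).
    det≢0 : det α β ≢ 0ℚ
    det≢0 Δ≡0 = ℚ.<-irrefl refl (subst (0ℚ <_)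
      (trans (lemma ν (T α β) (dℚ * (det α β * det α β)) (trans (cong (ν *_) Nα≡Nβ) (gram α β)))
        (trans (cong (λ x → 4ℚ * (dℚ * (x * x))) Δ≡0) (lemma′ dℚ)))
      (*-pos (+-pos-nonNeg 0<N 0≤ν+τ) (+-pos-nonNeg 0<N 0≤ν-τ)))
      where
      4ℚ : ℚ
      4ℚ = 1ℚ + 1ℚ + 1ℚ + 1ℚ
      lemma″ : ∀ ν t → (ν + (ν + (t + t))) * (ν + (ν - (t + t))) ≡ (1ℚ + 1ℚ + 1ℚ + 1ℚ) * (ν * ν - t * t)
      lemma″ = RingSolver.solve-∀ ℚ-ring
      lemma‴ : ∀ t e → (t * t + e) - t * t ≡ e
      lemma‴ = RingSolver.solve-∀ ℚ-ring
      lemma : ∀ ν t e → ν * ν ≡ t * t + e → (ν + (ν + (t + t))) * (ν + (ν - (t + t))) ≡ 4ℚ * e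
      lemma ν t e eq = trans (lemma″ ν t) (cong (4ℚ *_) (trans (cong (_- t * t) eq) (lemma‴ t e)))
      lemma′ : ∀ D → (1ℚ + 1ℚ + 1ℚ + 1ℚ) * (D * (0ℚ * 0ℚ)) ≡ 0ℚ
      lemma′ = RingSolver.solve-∀ ℚ-ring

    -- Subtracting the nearest integral combination leaves an element of `I` whose coordinates are
    -- at most 1/2 in absolute value. Its norm is below ν by `reduced-form`, so by minimality it
    -- vanishes.
    round-coordinates : ∀ x r s → x ≡ r · α ⊕ s · β → x ∈ I → ∃₂ λ m n → x ≡ ι m · α ⊕ ι n · β
    round-coordinates x r s x≡ x∈I = m , n , trans x≡ (difference≡0 r s (ι m) (ι n) α β remainder≡0)
      where
      m n : ℤ
      m = proj₁ (nearest-integer r)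
      n = proj₁ (nearest-integer s)
      remainder : K
      remainder = (r - ι m) · α ⊕ (s - ι n) · β
      remainder∈I : remainder ∈ I
      remainder∈I = subst (_∈ I) (trans (cong (λ x → 1ℚ · x ⊕ (- 1ℚ) · (ι m · α ⊕ ι n · β)) x≡) (difference r s (ι m) (ι n) α β))
        (closed (+ 1) -[1+ 0 ] x∈I (closed m n α∈I β∈I))
      small : ¬ (ν ≤ N remainder)
      small ν≤N = reduced-form {ν} {τ} {r - ι m} {s - ι n} 0<N 0≤ν+τ 0≤ν-τ
        (proj₁ (proj₂ (nearest-integer r))) (proj₂ (proj₂ (nearest-integer r)))
        (proj₁ (proj₂ (nearest-integer s))) (proj₂ (proj₂ (nearest-integer s)))
        (subst (ν ≤_) (N-coordinates (r - ι m) (s - ι n)) ν≤N)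
      remainder≡0 : remainder ≡ 0K
      -- Minimality speaks only of nonzero elements and refutes `remainder ≢ 0K`; equality in `K` is
      -- decidable, so the double negation can be removed.
      remainder≡0 = decidable-stable (remainder ≟K 0K) λ ≢0 → small (minimal remainder remainder∈I ≢0)

    generate : ∀ x → x ∈ I → ∃₂ λ m n → x ≡ ι m · α ⊕ ι n · β
    generate x x∈I = let r , s , x≡ = cramer α β x det≢0 in round-coordinates x r s x≡ x∈I

-- A multiplier of the ideal and the bound it puts on the discriminant

module Discriminant {R : RealNumbers} (F : ImaginaryQuadraticField R) where
  open ≡ using (refl; sym; trans)
  open RationalProperties
  open QuadraticFieldProperties F
  open import Data.Rational.Base using (_+_; _*_; _-_; -_; _≤_; _<_)

  -- A nonzero `x` has x² ≥ 1, so ∣i∣ ≤ ∣i x²∣ = ∣z∣.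
  ∣i∣≤ : ∀ i x z → x ≢ + 0 → i ℤ.* (x ℤ.* x) ≡ ℤ.- z → + 0 ℤ.≤ z → + ∣ i ∣ ℤ.≤ z
  ∣i∣≤ i x z x≢0 ix²≡-z 0≤z = subst (+ ∣ i ∣ ℤ.≤_) (ℤ.0≤i⇒+∣i∣≡i 0≤z) (ℤ.+≤+ (begin
    ∣ i ∣                     ≤⟨ ℕ.m≤m*n ∣ i ∣ ∣ x ℤ.* x ∣ ⦃ x²-nonZero ⦄ ⟩
    ∣ i ∣ ℕ.* ∣ x ℤ.* x ∣     ≡⟨ ℤ.∣i*j∣≡∣i∣*∣j∣ i (x ℤ.* x) ⟨
    ∣ i ℤ.* (x ℤ.* x) ∣       ≡⟨ cong ∣_∣ ix²≡-z ⟩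
    ∣ ℤ.- z ∣                 ≡⟨ ℤ.∣-i∣≡∣i∣ z ⟩
    ∣ z ∣                     ∎))
    where
    open ℕ.≤-Reasoning
    x²-nonZero : ℕ.NonZero ∣ x ℤ.* x ∣
    x²-nonZero = subst ℕ.NonZero (sym (ℤ.∣i*j∣≡∣i∣*∣j∣ x x)) (ℕ.m*n≢0 ∣ x ∣ ∣ x ∣)
      where instance _ = ℕ.≢-nonZero (x≢0 ∘ ℤ.∣i∣≡0⇒i≡0)

  ⊛-linear : ∀ θ r s α β → θ ⊛ (r · α ⊕ s · β) ≡ r · (θ ⊛ α) ⊕ s · (θ ⊛ β)
  ⊛-linear (t , e) r s (p , q) (p′ , q′) = cong₂ _,_ (lemma₁ dℚ t e r s p q p′ q′) (lemma₂ t e r s p q p′ q′)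
    where
    lemma₁ : ∀ D t e r s p q p′ q′ → t * (r * p + s * p′) - D * (e * (r * q + s * q′)) ≡
             r * (t * p - D * (e * q)) + s * (t * p′ - D * (e * q′))
    lemma₁ = RingSolver.solve-∀ ℚ-ring
    lemma₂ : ∀ t e r s p q p′ q′ → t * (r * q + s * q′) + e * (r * p + s * p′) ≡
             r * (t * q + e * p) + s * (t * q′ + e * p′)
    lemma₂ = RingSolver.solve-∀ ℚ-ring

  det-linear : ∀ m n m′ n′ α β → det (m · α ⊕ n · β) (m′ · α ⊕ n′ · β) ≡ (m * n′ - n * m′) * det α β
  det-linear m n m′ n′ (p , q) (p′ , q′) = lemma m n m′ n′ p q p′ q′
    where
    lemma : ∀ m n m′ n′ p q p′ q′ →
      (m * p + n * p′) * (m′ * q + n′ * q′) - (m * q + n * q′) * (m′ * p + n′ * p′) ≡ (m * n′ - n * m′) * (p * q′ - q * p′)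
    lemma = RingSolver.solve-∀ ℚ-ring

  4ℚ : ℚ
  4ℚ = 1ℚ + 1ℚ + 1ℚ + 1ℚ

  disc-det : ∀ α β → trace (α ⊛ α) * trace (β ⊛ β) - trace (α ⊛ β) * trace (β ⊛ α) ≡ - (4ℚ * (dℚ * (det α β * det α β)))
  disc-det (p , q) (p′ , q′) = lemma dℚ p q p′ q′
    where
    lemma : ∀ D p q p′ q′ →
      ((p * p - D * (q * q)) + (p * p - D * (q * q))) * ((p′ * p′ - D * (q′ * q′)) + (p′ * p′ - D * (q′ * q′))) -
      ((p * p′ - D * (q * q′)) + (p * p′ - D * (q * q′))) * ((p′ * p - D * (q′ * q)) + (p′ * p - D * (q′ * q))) ≡
      - ((1ℚ + 1ℚ + 1ℚ + 1ℚ) * (D * ((p * q′ - q * p′) * (p * q′ - q * p′))))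
    lemma = RingSolver.solve-∀ ℚ-ring

  -- k N(α) β / α
  quotient : ℚ → K → K → K
  quotient k α β = k * T α β , k * det α β

  quotient-⊛ˡ : ∀ k α β → quotient k α β ⊛ α ≡ (k * N α) · β
  quotient-⊛ˡ k (p , q) (p′ , q′) = cong₂ _,_ (lemma₁ dℚ k p q p′ q′) (lemma₂ dℚ k p q p′ q′)
    where
    lemma₁ : ∀ D k p q p′ q′ → k * (p * p′ + D * (q * q′)) * p - D * (k * (p * q′ - q * p′) * q) ≡ k * (p * p + D * (q * q)) * p′
    lemma₁ = RingSolver.solve-∀ ℚ-ring
    lemma₂ : ∀ D k p q p′ q′ → k * (p * p′ + D * (q * q′)) * q + k * (p * q′ - q * p′) * p ≡ k * (p * p + D * (q * q)) * q′
    lemma₂ = RingSolver.solve-∀ ℚ-ring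

  -- With bars for conjugates, `quotient k α β` is k ᾱ β, and ᾱ β + α β̄ = 2 `T α β`. Hence ᾱ β β =
  -- 2 `T α β` β - `N β` α.
  quotient-⊛ʳ : ∀ k α β → quotient k α β ⊛ β ≡ (k * (T α β + T α β)) · β ⊕ (- (k * N β)) · α
  quotient-⊛ʳ k (p , q) (p′ , q′) = cong₂ _,_ (lemma₁ dℚ k p q p′ q′) (lemma₂ dℚ k p q p′ q′)
    where
    lemma₁ : ∀ D k p q p′ q′ → k * (p * p′ + D * (q * q′)) * p′ - D * (k * (p * q′ - q * p′) * q′) ≡
      k * ((p * p′ + D * (q * q′)) + (p * p′ + D * (q * q′))) * p′ + - (k * (p′ * p′ + D * (q′ * q′))) * p
    lemma₁ = RingSolver.solve-∀ ℚ-ring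
    lemma₂ : ∀ D k p q p′ q′ → k * (p * p′ + D * (q * q′)) * q′ + k * (p * q′ - q * p′) * p′ ≡
      k * ((p * p′ + D * (q * q′)) + (p * p′ + D * (q * q′))) * q′ + - (k * (p′ * p′ + D * (q′ * q′))) * q
    lemma₂ = RingSolver.solve-∀ ℚ-ring

  module _ {I : Pred K 0ℓ} {α β : K} (minimalPair : IsMinimalPair I α β)
           {δ σ : ℤ} (δ≢0 : δ ≢ + 0)
           (relation : ι δ * IsMinimalPair.τ minimalPair + ι σ * IsMinimalPair.ν minimalPair ≡ 0ℚ) where
    open IsMinimalPair minimalPair
    open ≡.≡-Reasoning

    private
      ν≢0 : ν ≢ 0ℚ
      ν≢0 ν≡0 = ℚ.<-irrefl (sym ν≡0) 0<N

      instance
        ν-nonZero : ℚ.NonZero ν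
        ν-nonZero = ℚ.≢-nonZero ν≢0

      -- The normalisation k N(α) = δ turns `quotient k α β` into δ β / α.
      k : ℚ
      k = ι δ * ℚ.1/ ν

      θ : K
      θ = quotient k α β

      kν≡δ : k * ν ≡ ι δ
      kν≡δ = trans (ℚ.*-assoc (ι δ) (ℚ.1/ ν) ν) (trans (cong (ι δ *_) (ℚ.*-inverseˡ ν)) (ℚ.*-identityʳ (ι δ)))

      kτ≡-σ : k * τ ≡ - ι σ
      kτ≡-σ = begin
        ι δ * i * τ                              ≡⟨ lemma (ι δ) i τ (ι σ) ν ⟩
        i * (ι δ * τ + ι σ * ν) - (i * ν) * ι σ  ≡⟨ cong₂ (λ x y → i * x - y * ι σ) relation (ℚ.*-inverseˡ ν) ⟩
        i * 0ℚ - 1ℚ * ι σ                        ≡⟨ lemma′ i (ι σ) ⟩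
        - ι σ                                    ∎
        where
        i : ℚ
        i = ℚ.1/ ν
        lemma : ∀ δ i τ σ ν → δ * i * τ ≡ i * (δ * τ + σ * ν) - (i * ν) * σ
        lemma = RingSolver.solve-∀ ℚ-ring
        lemma′ : ∀ i σ → i * 0ℚ - 1ℚ * σ ≡ - σ
        lemma′ = RingSolver.solve-∀ ℚ-ring

      θα∈I : θ ⊛ α ∈ I
      θα∈I = subst (_∈ I) (begin
        ι δ · β ⊕ 0ℚ · β   ≡⟨ cong₂ _,_ (lemma (ι δ) (proj₁ β)) (lemma (ι δ) (proj₂ β)) ⟩
        ι δ · β            ≡⟨ cong (_· β) kν≡δ ⟨
        (k * ν) · β        ≡⟨ quotient-⊛ˡ k α β ⟨
        θ ⊛ α              ∎) (closed δ (+ 0) β∈I β∈I)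
        where
        lemma : ∀ r p → r * p + 0ℚ * p ≡ r * p
        lemma = RingSolver.solve-∀ ℚ-ring

      θβ∈I : θ ⊛ β ∈ I
      θβ∈I = subst (_∈ I) (begin
        ι (ℤ.- σ) · β ⊕ ι (ℤ.- δ) · α          ≡⟨ cong₂ (λ x y → x · β ⊕ y · α) (trans (ι-homo-neg σ) (sym kτ≡-σ)) (trans (ι-homo-neg δ) (cong -_ (trans (sym kν≡δ) (cong (k *_) Nα≡Nβ)))) ⟩
        (k * τ) · β ⊕ (- (k * N β)) · α        ≡⟨ quotient-⊛ʳ k α β ⟨
        θ ⊛ β                                  ∎) (closed (ℤ.- σ) (ℤ.- δ) β∈I α∈I)

    -- θ sends α to δ β and β to -σ β - δ α, and these two images decide, since α and β generate
    -- `I`.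
    multiplier : θ ∈ CoefficientRing I
    multiplier x x∈I = let m , n , x≡ = generate x x∈I in
      subst (_∈ I) (sym (trans (cong (θ ⊛_) x≡) (⊛-linear θ (ι m) (ι n) α β))) (closed m n θα∈I θβ∈I)

    private
      -- θ has trace -σ and norm δ², so `Z` is minus the discriminant of its polynomial X² + σ X +
      -- δ². By `ιZ` it is also 4d times the square of `kΔ`, the coefficient of √-d in θ.
      Z : ℤ
      Z = + 4 ℤ.* (δ ℤ.* δ) ℤ.- σ ℤ.* σ

      kΔ : ℚ
      kΔ = k * det α β

      ιZ : ι Z ≡ 4ℚ * (dℚ * (kΔ * kΔ))
      ιZ = begin
        ι Z
          ≡⟨ trans (ι-homo-- (+ 4 ℤ.* (δ ℤ.* δ)) (σ ℤ.* σ)) (cong₂ _-_ (trans (ι-homo-* (+ 4) (δ ℤ.* δ)) (cong (4ℚ *_) (ι-homo-* δ δ))) (ι-homo-* σ σ)) ⟩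
        4ℚ * (ι δ * ι δ) - ι σ * ι σ
          ≡⟨ cong₂ (λ x y → 4ℚ * (x * x) - y) (sym kν≡δ) (trans (lemma₁ (ι σ)) (cong₂ _*_ (sym kτ≡-σ) (sym kτ≡-σ))) ⟩
        4ℚ * ((k * ν) * (k * ν)) - (k * τ) * (k * τ)
          ≡⟨ lemma₂ k ν (T α β) ⟩
        4ℚ * (k * k) * (ν * ν - T α β * T α β)
          ≡⟨ cong (λ x → 4ℚ * (k * k) * (x - T α β * T α β)) (trans (cong (ν *_) Nα≡Nβ) (gram α β)) ⟩
        4ℚ * (k * k) * (T α β * T α β + dℚ * (det α β * det α β) - T α β * T α β)
          ≡⟨ lemma₃ k (T α β) dℚ (det α β) ⟩
        4ℚ * (dℚ * (kΔ * kΔ))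
          ∎
        where
        lemma₁ : ∀ s → s * s ≡ (- s) * (- s)
        lemma₁ = RingSolver.solve-∀ ℚ-ring
        lemma₂ : ∀ k ν t → (1ℚ + 1ℚ + 1ℚ + 1ℚ) * ((k * ν) * (k * ν)) - (k * (t + t)) * (k * (t + t)) ≡ (1ℚ + 1ℚ + 1ℚ + 1ℚ) * (k * k) * (ν * ν - t * t)
        lemma₂ = RingSolver.solve-∀ ℚ-ring
        lemma₃ : ∀ k t D e → (1ℚ + 1ℚ + 1ℚ + 1ℚ) * (k * k) * (t * t + D * (e * e) - t * t) ≡ (1ℚ + 1ℚ + 1ℚ + 1ℚ) * (D * ((k * e) * (k * e)))
        lemma₃ = RingSolver.solve-∀ ℚ-ring

      0≤Z : + 0 ℤ.≤ Z
      0≤Z = ι-nonNeg⁻¹ Z (subst (0ℚ ≤_) (sym ιZ) (*-nonNeg (ι-nonNeg {+ 4} (ℤ.+≤+ ℕ.z≤n)) (*-nonNeg (ℚ.<⇒≤ 0<dℚ) (0≤² kΔ))))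

      kΔ≢0 : kΔ ≢ 0ℚ
      kΔ≢0 kΔ≡0 = det≢0 (p*q≡0⇒q≡0 (ι δ) (det α β) (δ≢0 ∘ ι-injective) (begin
        ι δ * det α β       ≡⟨ cong (_* det α β) kν≡δ ⟨
        k * ν * det α β     ≡⟨ lemma k ν (det α β) ⟩
        ν * kΔ              ≡⟨ cong (ν *_) kΔ≡0 ⟩
        ν * 0ℚ              ≡⟨ ℚ.*-zeroʳ ν ⟩
        0ℚ                  ∎))
        where
        lemma : ∀ k ν e → k * ν * e ≡ ν * (k * e)
        lemma = RingSolver.solve-∀ ℚ-ring

    -- `X` is the determinant of the coordinates of 1 and θ in the basis ω₁, ω₂, that is, up to
    -- sign, the index of ℤ[θ] in `𝒪`. It is nonzero because θ is not rational. Comparing `det 1K θ`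
    -- with `det ω₁ ω₂` gives D X² = -Z.
    discriminant-bound : ∀ {𝒪 D} → CoefficientRing I ⊆ Order.elements 𝒪 → IsDiscriminant 𝒪 D →
                         + ∣ D ∣ ℤ.≤ + 4 ℤ.* (δ ℤ.* δ) ℤ.- σ ℤ.* σ
    discriminant-bound {𝒪} {D} ring⊆𝒪 (ω₁ , ω₂ , (∈⇔ , _) , D≡) = ∣i∣≤ D X Z X≢0 DX²≡-Z 0≤Z
      where
      coordinates₁ = Equivalence.to (∈⇔ 1K) (Order.1∈ 𝒪)
      coordinatesθ = Equivalence.to (∈⇔ θ) (ring⊆𝒪 multiplier)
      m n m′ n′ X : ℤ
      m  = proj₁ coordinates₁
      n  = proj₁ (proj₂ coordinates₁)
      m′ = proj₁ coordinatesθ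
      n′ = proj₁ (proj₂ coordinatesθ)
      X  = m ℤ.* n′ ℤ.- n ℤ.* m′

      kΔ≡Xdet : kΔ ≡ ι X * det ω₁ ω₂
      kΔ≡Xdet = begin
        kΔ                                                     ≡⟨ lemma kΔ (k * T α β) ⟩
        det 1K θ                                               ≡⟨ cong₂ det (proj₂ (proj₂ coordinates₁)) (proj₂ (proj₂ coordinatesθ)) ⟩
        det (ι m · ω₁ ⊕ ι n · ω₂) (ι m′ · ω₁ ⊕ ι n′ · ω₂)      ≡⟨ det-linear (ι m) (ι n) (ι m′) (ι n′) ω₁ ω₂ ⟩
        (ι m * ι n′ - ι n * ι m′) * det ω₁ ω₂                  ≡⟨ cong (_* det ω₁ ω₂) (sym (trans (ι-homo-- (m ℤ.* n′) (n ℤ.* m′)) (cong₂ _-_ (ι-homo-* m n′) (ι-homo-* n m′)))) ⟩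
        ι X * det ω₁ ω₂                                        ∎
        where
        lemma : ∀ x y → x ≡ 1ℚ * x - 0ℚ * y
        lemma = RingSolver.solve-∀ ℚ-ring

      X≢0 : X ≢ + 0
      X≢0 X≡0 = kΔ≢0 (trans kΔ≡Xdet (trans (cong (λ x → ι x * det ω₁ ω₂) X≡0) (ℚ.*-zeroˡ (det ω₁ ω₂))))

      DX²≡-Z : D ℤ.* (X ℤ.* X) ≡ ℤ.- Z
      DX²≡-Z = ι-injective (begin
        ι (D ℤ.* (X ℤ.* X))            ≡⟨ trans (ι-homo-* D (X ℤ.* X)) (cong (ι D *_) (ι-homo-* X X)) ⟩
        ι D * (ι X * ι X)              ≡⟨ cong (_* (ι X * ι X)) (trans D≡ (disc-det ω₁ ω₂)) ⟩
        - (4ℚ * (dℚ * (det ω₁ ω₂ * det ω₁ ω₂))) * (ι X * ι X)  ≡⟨ lemma dℚ (det ω₁ ω₂) (ι X) ⟩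
        - (4ℚ * (dℚ * ((ι X * det ω₁ ω₂) * (ι X * det ω₁ ω₂))))  ≡⟨ cong (λ x → - (4ℚ * (dℚ * (x * x)))) kΔ≡Xdet ⟨
        - (4ℚ * (dℚ * (kΔ * kΔ)))      ≡⟨ trans (ι-homo-neg Z) (cong -_ ιZ) ⟨
        ι (ℤ.- Z)                      ∎)
        where
        lemma : ∀ D e X → - ((1ℚ + 1ℚ + 1ℚ + 1ℚ) * (D * (e * e))) * (X * X) ≡ - ((1ℚ + 1ℚ + 1ℚ + 1ℚ) * (D * ((X * e) * (X * e))))
        lemma = RingSolver.solve-∀ ℚ-ring

-- Determinant and index of a sublattice of ℤ²

module LatticeIndex where
  open ≡ using (refl; sym; trans)
  open import Data.Integer.Base using (_+_; _*_; _-_)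

  -- A greatest common divisor `g` with its cofactors; the last field certifies that these are
  -- coprime, also when `x` and `y` both vanish.
  record BézoutForm (x y : ℤ) : Set where
    field
      g       : ℕ
      a b u v : ℤ
      x≡ag    : x ≡ a * + g
      y≡bg    : y ≡ b * + g
      ua+vb≡1 : u * a + v * b ≡ + 1

  bézoutForm : ∀ x y → BézoutForm x y
  bézoutForm x y = go (ℕ.Bézout.lemma ∣ x ∣ ∣ y ∣)
    where
    open ≡.≡-Reasoning
    open ℤ∣._∣_ using (quotient; equality)
    -- These satisfy ∣x∣ = s x and ∣y∣ = t y, and so carry the identity for absolute values over to
    -- `x` and `y`.
    s t : ℤ
    s = quotient (ℤ∣.m∣∣m∣ {x})
    t = quotient (ℤ∣.m∣∣m∣ {y})

    fromIdentity : ∀ {g} (x∣ : + g ℤ∣.∣ x) (y∣ : + g ℤ∣.∣ y) (u v : ℤ) → u * x + v * y ≡ + g → BézoutForm x y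
    -- Here x = y = 0 and the given quotients say nothing; any coprime pair will do as cofactors.
    fromIdentity {zero} (ℤ∣.divides a x≡) (ℤ∣.divides b y≡) _ _ _ = record
      { g = 0 ; a = + 1 ; b = + 0 ; u = + 1 ; v = + 0
      ; x≡ag = trans x≡ (ℤ.*-zeroʳ a) ; y≡bg = trans y≡ (ℤ.*-zeroʳ b) ; ua+vb≡1 = refl }
    fromIdentity {g@(suc _)} (ℤ∣.divides a x≡) (ℤ∣.divides b y≡) u v eq = record
      { g = g ; a = a ; b = b ; u = u ; v = v ; x≡ag = x≡ ; y≡bg = y≡
      ; ua+vb≡1 = ℤ.*-cancelʳ-≡ (u * a + v * b) (+ 1) (+ g) (begin
          (u * a + v * b) * + g           ≡⟨ lemma u a v b (+ g) ⟩
          u * (a * + g) + v * (b * + g)   ≡⟨ cong₂ (λ x y → u * x + v * y) x≡ y≡ ⟨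
          u * x + v * y                   ≡⟨ eq ⟩
          + g                             ≡⟨ ℤ.*-identityˡ (+ g) ⟨
          + 1 * + g                       ∎) }
      where
      lemma : ∀ u a v b g → (u * a + v * b) * g ≡ u * (a * g) + v * (b * g)
      lemma = ℤ-Solver.solve-∀

    identity : ∀ {g m n x y s t} {p q : ℕ} → + m ≡ s * x → + n ≡ t * y → g ℕ.+ q ℕ.* n ≡ p ℕ.* m →
               (+ p * s) * x + (ℤ.- (+ q * t)) * y ≡ + g
    identity {g} {m} {n} {x} {y} {s} {t} {p} {q} m≡ n≡ eq = begin
      (+ p * s) * x + (ℤ.- (+ q * t)) * y   ≡⟨ lemma (+ p) s x (+ q) t y ⟩
      + p * (s * x) - + q * (t * y)         ≡⟨ cong₂ (λ a b → + p * a - + q * b) m≡ n≡ ⟨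
      + p * + m - + q * + n                 ≡⟨ cong (_- + q * + n) (trans (sym (ℤ.pos-* p m)) (trans (cong +_ (sym eq)) (cong (λ z → + g + z) (ℤ.pos-* q n)))) ⟩
      (+ g + + q * + n) - + q * + n         ≡⟨ lemma′ (+ g) (+ q * + n) ⟩
      + g                                   ∎
      where
      lemma : ∀ p s x q t y → (p * s) * x + (ℤ.- (q * t)) * y ≡ p * (s * x) - q * (t * y)
      lemma = ℤ-Solver.solve-∀
      lemma′ : ∀ g z → (g + z) - z ≡ g
      lemma′ = ℤ-Solver.solve-∀

    go : ℕ.Bézout.Lemma ∣ x ∣ ∣ y ∣ → BézoutForm x y
    go (ℕ.Bézout.result g isGCD (ℕ.Bézout.+- p q eq)) =
      fromIdentity {g} (ℤ∣.∣ᵤ⇒∣ (proj₁ (ℕ.GCD.commonDivisor isGCD))) (ℤ∣.∣ᵤ⇒∣ (proj₂ (ℕ.GCD.commonDivisor isGCD)))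
        (+ p * s) (ℤ.- (+ q * t)) (identity {s = s} {t} {p} {q} (equality (ℤ∣.m∣∣m∣ {x})) (equality (ℤ∣.m∣∣m∣ {y})) eq)
    go (ℕ.Bézout.result g isGCD (ℕ.Bézout.-+ p q eq)) =
      fromIdentity {g} (ℤ∣.∣ᵤ⇒∣ (proj₁ (ℕ.GCD.commonDivisor isGCD))) (ℤ∣.∣ᵤ⇒∣ (proj₂ (ℕ.GCD.commonDivisor isGCD)))
        (ℤ.- (+ p * s)) (+ q * t) (trans (ℤ.+-comm ((ℤ.- (+ p * s)) * x) ((+ q * t) * y))
          (identity {s = t} {s} {q} {p} (equality (ℤ∣.m∣∣m∣ {y})) (equality (ℤ∣.m∣∣m∣ {x})) eq))

  -- Two indices below n differ by less than n = ∣w∣, which leaves only the multiple zero.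
  small-multiple : ∀ {n} (i j : Fin n) c w → ∣ w ∣ ≡ n → + toℕ i - + toℕ j ≡ c * w → i ≡ j
  small-multiple {n} i j c w ∣w∣≡n eq = go ∣ c ∣ refl
    where
    open ℕ.≤-Reasoning
    go : ∀ m → ∣ c ∣ ≡ m → i ≡ j
    go zero ∣c∣≡ = Fin.toℕ-injective (ℤ.+-injective (ℤ.i-j≡0⇒i≡j (+ toℕ i) (+ toℕ j)
                 (trans eq (trans (cong (_* w) (ℤ.∣i∣≡0⇒i≡0 {c} ∣c∣≡)) (ℤ.*-zeroˡ w)))))
    go (suc k) ∣c∣≡ = contradiction (begin-strict
      n                          ≤⟨ ℕ.m≤m+n n (k ℕ.* n) ⟩
      suc k ℕ.* n                ≡⟨ cong₂ ℕ._*_ ∣c∣≡ ∣w∣≡n ⟨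
      ∣ c ∣ ℕ.* ∣ w ∣            ≡⟨ ℤ.∣i*j∣≡∣i∣*∣j∣ c w ⟨
      ∣ c * w ∣                  ≡⟨ cong ∣_∣ eq ⟨
      ∣ + toℕ i - + toℕ j ∣      ≡⟨ cong ∣_∣ (ℤ.m-n≡m⊖n (toℕ i) (toℕ j)) ⟩
      ∣ toℕ i ℤ.⊖ toℕ j ∣        ≤⟨ ℤ.∣m⊝n∣≤m⊔n (toℕ i) (toℕ j) ⟩
      toℕ i ℕ.⊔ toℕ j            <⟨ ℕ.⊔-pres-<m (Fin.toℕ<n i) (Fin.toℕ<n j) ⟩
      n                          ∎) (ℕ.<-irrefl refl)

  -- The points (i , j) with 0 ≤ i < g = gcd x₁ x₂ and 0 ≤ j < ∣ det ∣ / g lie in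
  -- distinct cosets of the lattice spanned by (x₁ , y₁) and (x₂ , y₂).
  det≤index : ∀ {ℓ} x₁ y₁ x₂ y₂ (coset : ℤ → ℤ → Fin ℓ) →
    (∀ i j i′ j′ → coset i j ≡ coset i′ j′ →
      ∃₂ λ m n → i - i′ ≡ m * x₁ + n * x₂ × j - j′ ≡ m * y₁ + n * y₂) →
    ∣ x₁ * y₂ - x₂ * y₁ ∣ ℕ.≤ ℓ
  det≤index {ℓ} x₁ y₁ x₂ y₂ coset same-coset =
    subst (ℕ._≤ ℓ) (sym ∣det∣≡gh) (Fin.injective⇒≤ {f = f} f-injective)
    where
    open ≡.≡-Reasoning
    open BézoutForm (bézoutForm x₁ x₂)
    e : ℤ
    e = a * y₂ - b * y₁
    h : ℕ
    h = ∣ e ∣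

    ∣det∣≡gh : ∣ x₁ * y₂ - x₂ * y₁ ∣ ≡ g ℕ.* h
    ∣det∣≡gh = begin
      ∣ x₁ * y₂ - x₂ * y₁ ∣                     ≡⟨ cong₂ (λ x y → ∣ x * y₂ - y * y₁ ∣) x≡ag y≡bg ⟩
      ∣ (a * + g) * y₂ - (b * + g) * y₁ ∣       ≡⟨ cong ∣_∣ (lemma a b (+ g) y₁ y₂) ⟩
      ∣ + g * e ∣                               ≡⟨ ℤ.∣i*j∣≡∣i∣*∣j∣ (+ g) e ⟩
      g ℕ.* h                                   ∎
      where
      lemma : ∀ a b g y₁ y₂ → (a * g) * y₂ - (b * g) * y₁ ≡ g * (a * y₂ - b * y₁)
      lemma = ℤ-Solver.solve-∀

    f : Fin (g ℕ.* h) → Fin ℓ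
    f k = let i , j = remQuot {g} h k in coset (+ toℕ i) (+ toℕ j)

    separated : ∀ (i i′ : Fin g) (j j′ : Fin h) →
                coset (+ toℕ i) (+ toℕ j) ≡ coset (+ toℕ i′) (+ toℕ j′) → i ≡ i′ × j ≡ j′
    separated i i′ j j′ eq with same-coset (+ toℕ i) (+ toℕ j) (+ toℕ i′) (+ toℕ j′) eq
    -- Both x₁ = a g and x₂ = b g are multiples of g, hence so is the difference of `i` and `i′`,
    -- and these agree. Then m a + n b = 0, and u a + v b = 1 makes (m , n) the multiple n u - m v
    -- of (-b , a); so the difference of `j` and `j′` is a multiple of `e`.
    ... | m , n , Δi , Δj = i≡i′ , small-multiple j j′ (n * u - m * v) e refl (begin
      + toℕ j - + toℕ j′                            ≡⟨ Δj ⟩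
      m * y₁ + n * y₂                               ≡⟨ lemma₁ m n y₁ y₂ ⟩
      + 1 * m * y₁ + + 1 * n * y₂                   ≡⟨ cong (λ z → z * m * y₁ + z * n * y₂) ua+vb≡1 ⟨
      (u * a + v * b) * m * y₁ + (u * a + v * b) * n * y₂ ≡⟨ lemma₂ m n y₁ y₂ a b u v ⟩
      (n * u - m * v) * e + (m * a + n * b) * (u * y₁ + v * y₂) ≡⟨ cong (λ z → (n * u - m * v) * e + z * (u * y₁ + v * y₂)) ma+nb≡0 ⟩
      (n * u - m * v) * e + + 0                     ≡⟨ ℤ.+-identityʳ _ ⟩
      (n * u - m * v) * e                           ∎)
      where
      lemma₀ : ∀ m n a b g → m * (a * g) + n * (b * g) ≡ (m * a + n * b) * g
      lemma₀ = ℤ-Solver.solve-∀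
      lemma₁ : ∀ m n y₁ y₂ → m * y₁ + n * y₂ ≡ + 1 * m * y₁ + + 1 * n * y₂
      lemma₁ = ℤ-Solver.solve-∀
      lemma₂ : ∀ m n y₁ y₂ a b u v → (u * a + v * b) * m * y₁ + (u * a + v * b) * n * y₂ ≡
        (n * u - m * v) * (a * y₂ - b * y₁) + (m * a + n * b) * (u * y₁ + v * y₂)
      lemma₂ = ℤ-Solver.solve-∀

      Δi≡ : + toℕ i - + toℕ i′ ≡ (m * a + n * b) * + g
      Δi≡ = trans Δi (trans (cong₂ (λ x y → m * x + n * y) x≡ag y≡bg) (lemma₀ m n a b (+ g)))

      i≡i′ : i ≡ i′
      i≡i′ = small-multiple i i′ (m * a + n * b) (+ g) refl Δi≡

      ma+nb≡0 : m * a + n * b ≡ + 0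
      ma+nb≡0 = ℤ.*-cancelʳ-≡ (m * a + n * b) (+ 0) (+ g) ⦃ g-nonZero i ⦄ (trans (sym Δi≡)
        (trans (ℤ.i≡j⇒i-j≡0 (cong (+_ ∘ toℕ) i≡i′)) (sym (ℤ.*-zeroˡ (+ g)))))
        where
        g-nonZero : ∀ {g} → Fin g → ℤ.NonZero (+ g)
        g-nonZero {suc _} _ = _

    f-injective : ∀ {k k′} → f k ≡ f k′ → k ≡ k′
    f-injective {k} {k′} fk≡fk′ = begin
      k                                   ≡⟨ Fin.combine-remQuot {g} h k ⟨
      combine (proj₁ (remQuot {g} h k)) (proj₂ (remQuot {g} h k))      ≡⟨ cong₂ combine (proj₁ same) (proj₂ same) ⟩
      combine (proj₁ (remQuot {g} h k′)) (proj₂ (remQuot {g} h k′))    ≡⟨ Fin.combine-remQuot {g} h k′ ⟩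
      k′                                  ∎
      where
      same : proj₁ (remQuot {g} h k) ≡ proj₁ (remQuot {g} h k′) × proj₂ (remQuot {g} h k) ≡ proj₂ (remQuot {g} h k′)
      same = separated (proj₁ (remQuot {g} h k)) (proj₁ (remQuot {g} h k′)) (proj₂ (remQuot {g} h k)) (proj₂ (remQuot {g} h k′)) fk≡fk′

-- Integral binary forms and the size of a harmless perturbation

module IntegerForms where
  open import Data.Integer.Base using (_+_; _*_; _-_; -_; _≤_; _<_)

  -- This is a times x² + t x y + y² for t = b/a. Its values are integers, so that unequal ones
  -- differ by at least 1.
  form : (a b x y : ℤ) → ℤ
  form a b x y = a * (x * x) + b * (x * y) + a * (y * y)

  +-nonNeg : ∀ {i j} → + 0 ≤ i → + 0 ≤ j → + 0 ≤ i + j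
  +-nonNeg = ℤ.+-mono-≤

  *-nonNeg : ∀ {i j} → + 0 ≤ i → + 0 ≤ j → + 0 ≤ i * j
  *-nonNeg {i} {j} 0≤i 0≤j = subst (_≤ i * j) (ℤ.*-zeroʳ i) (ℤ.*-monoˡ-≤-nonNeg i ⦃ ℤ.nonNegative 0≤i ⦄ 0≤j)

  *-pos : ∀ {i j} → + 0 < i → + 0 < j → + 0 < i * j
  *-pos {i} {j} 0<i 0<j = subst (_< i * j) (ℤ.*-zeroʳ i) (ℤ.*-monoˡ-<-pos i ⦃ ℤ.positive 0<i ⦄ 0<j)

  ∣i∣²≡i² : ∀ i → + (∣ i ∣ ℕ.* ∣ i ∣) ≡ i * i
  ∣i∣²≡i² (+ n)    = ℤ.pos-* n n
  ∣i∣²≡i² -[1+ n ] = ≡.refl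

  0≤² : ∀ i → + 0 ≤ i * i
  0≤² i = subst (+ 0 ≤_) (∣i∣²≡i² i) (ℤ.+≤+ ℕ.z≤n)

  i<j⇒0<j-i : ∀ {i j} → i < j → + 0 < j - i
  i<j⇒0<j-i {i} {j} i<j = subst (_< j - i) (ℤ.+-inverseʳ i) (ℤ.+-monoˡ-< (- i) i<j)

  0<j-i⇒i<j : ∀ {i j} → + 0 < j - i → i < j
  0<j-i⇒i<j {i} {j} 0<j-i = subst₂ _<_ (ℤ.+-identityˡ i) (lemma j i) (ℤ.+-monoˡ-< i 0<j-i)
    where
    lemma : ∀ j i → j - i + i ≡ j
    lemma = ℤ-Solver.solve-∀

  0≤4*⇒0≤ : ∀ {i} → + 0 ≤ + 4 * i → + 0 ≤ i
  0≤4*⇒0≤ {i} 0≤4i = ℤ.*-cancelˡ-≤-pos (+ 0) i (+ 4) 0≤4i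

  module _ {a b s : ℤ} (0<a : + 0 < a) (0≤a+b : + 0 ≤ a + b) (0≤a-b : + 0 ≤ a - b)
           (s-sign : s ≡ + 1 ⊎ s ≡ -[1+ 0 ]) where

    private
      0≤a-1 : + 0 ≤ a - + 1
      0≤a-1 = ℤ.i≤j⇒0≤j-i (ℤ.i<j⇒suc[i]≤j 0<a)

      0≤2a+b+s : + 0 ≤ (a + b) + (a + s)
      0≤2a+b+s = +-nonNeg 0≤a+b (lemma s-sign)
        where
        lemma : s ≡ + 1 ⊎ s ≡ -[1+ 0 ] → + 0 ≤ a + s
        lemma (inj₁ ≡.refl) = +-nonNeg (ℤ.<⇒≤ 0<a) (ℤ.+≤+ ℕ.z≤n)
        lemma (inj₂ ≡.refl) = 0≤a-1

      0≤2a-b-s : + 0 ≤ (a - b) + (a - s)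
      0≤2a-b-s = +-nonNeg 0≤a-b (lemma s-sign)
        where
        lemma : s ≡ + 1 ⊎ s ≡ -[1+ 0 ] → + 0 ≤ a - s
        lemma (inj₁ ≡.refl) = 0≤a-1
        lemma (inj₂ ≡.refl) = +-nonNeg (ℤ.<⇒≤ 0<a) (ℤ.+≤+ ℕ.z≤n)

    -- Four times this value is (2a + b + s) (x + y)² + (2a - b - s) (x - y)², with nonnegative
    -- coefficients because a ≥ 1 = ∣s∣. With both signs of `s` it bounds ∣x y∣ by the form.
    form+sxy-nonNeg : ∀ x y → + 0 ≤ form a b x y + s * (x * y)
    form+sxy-nonNeg x y = 0≤4*⇒0≤ (subst (+ 0 ≤_) (lemma a b s x y)
      (+-nonNeg (*-nonNeg 0≤2a+b+s (0≤² (x + y))) (*-nonNeg 0≤2a-b-s (0≤² (x - y)))))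
      where
      lemma : ∀ a b s x y → ((a + b) + (a + s)) * ((x + y) * (x + y)) + ((a - b) + (a - s)) * ((x - y) * (x - y)) ≡
        + 4 * (a * (x * x) + b * (x * y) + a * (y * y) + s * (x * y))
      lemma = ℤ-Solver.solve-∀

  private
    opposite : ∀ {s} → s ≡ + 1 ⊎ s ≡ -[1+ 0 ] → - s ≡ + 1 ⊎ - s ≡ -[1+ 0 ]
    opposite (inj₁ ≡.refl) = inj₂ ≡.refl
    opposite (inj₂ ≡.refl) = inj₁ ≡.refl

  -- The form is the mean of its two perturbations, by x y and by -x y.
  form-nonNeg : ∀ {a b} → + 0 < a → + 0 ≤ a + b → + 0 ≤ a - b → ∀ x y → + 0 ≤ form a b x y
  form-nonNeg {a} {b} 0<a 0≤a+b 0≤a-b x y = 0≤4*⇒0≤ (subst (+ 0 ≤_) (lemma (form a b x y) (x * y))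
    (+-nonNeg sum sum))
    where
    sum : + 0 ≤ (form a b x y + + 1 * (x * y)) + (form a b x y + (- + 1) * (x * y))
    sum = +-nonNeg (form+sxy-nonNeg 0<a 0≤a+b 0≤a-b (inj₁ ≡.refl) x y) (form+sxy-nonNeg 0<a 0≤a+b 0≤a-b (inj₂ ≡.refl) x y)
    lemma : ∀ f z → ((f + + 1 * z) + (f + (- + 1) * z)) + ((f + + 1 * z) + (f + (- + 1) * z)) ≡ + 4 * f
    lemma = ℤ-Solver.solve-∀

  -- Write k = f - f₀ ≥ 1.  As f + s x y and f₀ - s x₀ y₀ are nonnegative, the difference of
  -- the two sides is at least n k - k - 2 f₀ = (n - 1) (k - 1) + (n - 1 - 2 f₀).
  perturbed-< : ∀ {a b s n} → + 0 < a → + 0 ≤ a + b → + 0 ≤ a - b → s ≡ + 1 ⊎ s ≡ -[1+ 0 ] →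
    ∀ x₀ y₀ x y → + 0 < n → + 2 * form a b x₀ y₀ + + 1 < n → form a b x₀ y₀ < form a b x y →
    n * form a b x₀ y₀ + s * (x₀ * y₀) < n * form a b x y + s * (x * y)
  perturbed-< {a} {b} {s} {n} 0<a 0≤a+b 0≤a-b s-sign x₀ y₀ x y 0<n bound f₀<f =
    0<j-i⇒i<j (subst (+ 0 <_) (lemma (form a b x₀ y₀) (form a b x y) s n (x₀ * y₀) (x * y))
      (ℤ.+-mono-<-≤ (i<j⇒0<j-i bound)
        (+-nonNeg (*-nonNeg (ℤ.i≤j⇒0≤j-i (ℤ.i<j⇒suc[i]≤j 0<n)) (ℤ.i≤j⇒0≤j-i (ℤ.i<j⇒suc[i]≤j f₀<f)))
          (+-nonNeg (form+sxy-nonNeg 0<a 0≤a+b 0≤a-b s-sign x y) (form+sxy-nonNeg 0<a 0≤a+b 0≤a-b (opposite s-sign) x₀ y₀)))))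
    where
    lemma : ∀ f₀ f s n z₀ z →
      (n - (+ 2 * f₀ + + 1)) + ((n - + 1) * (f - (+ 1 + f₀)) + ((f + s * z) + (f₀ + (- s) * z₀))) ≡
      (n * f + s * z) - (n * f₀ + s * z₀)
    lemma = ℤ-Solver.solve-∀

  -- The second and third inequalities are the bounds that `perturbed-<` asks for at the minimal
  -- vectors, where the form has the values `a` and `f`. The last makes κ = 4a / (n (4a² - b²))
  -- smaller than 1; since 4a² - b² = (2a + b) (2a - b) ≥ 1, it is enough that n > 4a. The witness 2
  -- + 2f + 4a meets all of them.
  perturbation-size : ∀ {a b f} → + 0 < a → + 0 ≤ a + b → + 0 ≤ a - b → + 0 ≤ f →
    ∃[ n ] + 0 < n × + 2 * a + + 1 < n × + 2 * f + + 1 < n × + 4 * a < n * (+ 4 * (a * a) - b * b)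
  perturbation-size {a} {b} {f} 0<a 0≤a+b 0≤a-b 0≤f =
    n , 0<n , 0<j-i⇒i<j (subst (+ 0 <_) (lemma₁ a f) (ℤ.+-mono-<-≤ 0<1 (+-nonNeg 0≤f+f 0≤a+a)))
      , 0<j-i⇒i<j (subst (+ 0 <_) (lemma₂ a f) (ℤ.+-mono-<-≤ 0<1 (+-nonNeg 0≤a+a 0≤a+a)))
      , 0<j-i⇒i<j (subst (+ 0 <_) (lemma₃ a b f) (ℤ.+-mono-<-≤ 0<1 (+-nonNeg (ℤ.+≤+ {n = 1} ℕ.z≤n) (+-nonNeg 0≤f+f
          (*-nonNeg (ℤ.<⇒≤ 0<n) (ℤ.i≤j⇒0≤j-i (ℤ.i<j⇒suc[i]≤j 0<E)))))))
    where
    n : ℤ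
    n = + 2 + (f + f) + ((a + a) + (a + a))
    0<1 : + 0 < + 1
    0<1 = ℤ.+<+ (ℕ.s≤s ℕ.z≤n)
    0≤a+a : + 0 ≤ a + a
    0≤a+a = +-nonNeg (ℤ.<⇒≤ 0<a) (ℤ.<⇒≤ 0<a)
    0≤f+f : + 0 ≤ f + f
    0≤f+f = +-nonNeg 0≤f 0≤f
    0<n : + 0 < n
    0<n = ℤ.+-mono-<-≤ (ℤ.+-mono-<-≤ (ℤ.+<+ {n = 2} (ℕ.s≤s ℕ.z≤n)) 0≤f+f) (+-nonNeg 0≤a+a 0≤a+a)
    0<E : + 0 < (a + (a + b)) * (a + (a - b))
    0<E = *-pos (ℤ.+-mono-<-≤ 0<a 0≤a+b) (ℤ.+-mono-<-≤ 0<a 0≤a-b)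
    lemma₁ : ∀ a f → + 1 + ((f + f) + (a + a)) ≡ (+ 2 + (f + f) + ((a + a) + (a + a))) - (+ 2 * a + + 1)
    lemma₁ = ℤ-Solver.solve-∀
    lemma₂ : ∀ a f → + 1 + ((a + a) + (a + a)) ≡ (+ 2 + (f + f) + ((a + a) + (a + a))) - (+ 2 * f + + 1)
    lemma₂ = ℤ-Solver.solve-∀
    lemma₃ : ∀ a b f →
      + 1 + (+ 1 + ((f + f) + (+ 2 + (f + f) + ((a + a) + (a + a))) * ((a + (a + b)) * (a + (a - b)) - + 1))) ≡
      (+ 2 + (f + f) + ((a + a) + (a + a))) * (+ 4 * (a * a) - b * b) - + 4 * a
    lemma₃ = ℤ-Solver.solve-∀

-- The perturbed quadratic form: positivity and values on the lattice

module Perturbation (R : RealNumbers) where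
  open RealProperties R
  open Plane R
  open Solver using (solve; _:=_; _:+_; _:*_; _:-_; :-_; con)
  open CommutativeRing commutativeRing using (setoid)
  open Relation.Binary.Reasoning.Setoid setoid

  cross : ℝ² → ℝ² → ℝ
  cross (x , y) (x′ , y′) = x * y′ - y * x′

  lagrange : ∀ v w → A v * A w ≈ ⟨ v , w ⟩ * ⟨ v , w ⟩ + cross v w * cross v w
  lagrange (x , y) (p , q) = solve 4 (λ x y p q → (x :* x :+ y :* y) :* (p :* p :+ q :* q) :=
    (x :* p :+ y :* q) :* (x :* p :+ y :* q) :+ (x :* q :- y :* p) :* (x :* q :- y :* p)) refl x y p q

  A-pos : ∀ v → v #₂ 0₂ → 0# < A v
  A-pos (x , y) (inj₁ x#0) = +-pos-nonNeg (#0⇒0<² x#0) (0≤² y)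
  A-pos (x , y) (inj₂ y#0) = <-respʳ-≈ (+-comm _ _) (+-pos-nonNeg (#0⇒0<² y#0) (0≤² x))

  A-cong : ∀ {v w} → v ≈₂ w → A v ≈ A w
  A-cong (x≈ , y≈) = +-cong (*-cong x≈ x≈) (*-cong y≈ y≈)

  value-cong : ∀ Q {v w} → v ≈₂ w → value Q v ≈ value Q w
  value-cong Q (x≈ , y≈) = +-cong (+-cong (*-congˡ (*-cong x≈ x≈)) (*-congˡ (*-cong x≈ y≈))) (*-congˡ (*-cong y≈ y≈))

  -- In the coordinates of the basis v₁, v₂ the form cross v v₂ * cross v₁ v is a multiple of x y.
  perturbed : ℝ → ℝ² → ℝ² → QuadraticForm
  perturbed κ (p , q) (p′ , q′) = record
    { a = 1# - κ * (q * q′)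
    ; b = κ * (p * q′ + q * p′)
    ; c = 1# - κ * (p * p′)
    }

  value-perturbed : ∀ κ v₁ v₂ v → value (perturbed κ v₁ v₂) v ≈ A v + κ * (cross v v₂ * cross v₁ v)
  value-perturbed κ (p , q) (p′ , q′) (x , y) = trans
    (+-cong (+-congʳ (*-congʳ (+-congʳ (sym 1≈)))) (*-congʳ (+-congʳ (sym 1≈))))
    (solve 7 (λ κ p q p′ q′ x y →
      (con (+ 1) :- κ :* (q :* q′)) :* (x :* x) :+ κ :* (p :* q′ :+ q :* p′) :* (x :* y) :+ (con (+ 1) :- κ :* (p :* p′)) :* (y :* y) :=
      (x :* x :+ y :* y) :+ κ :* ((x :* q′ :- y :* p′) :* (p :* y :- q :* x))) refl κ p q p′ q′ x y)
    where
    1≈ : fromℤ (+ 1) ≈ 1#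
    1≈ = +-identityʳ 1#

  module _ {v₁ v₂ : ℝ²} (Av₁≈1 : A v₁ ≈ 1#) (Av₂≈1 : A v₂ ≈ 1#) where

    -- Write dᵢ and cᵢ for the dot and cross products of v with vᵢ. As A(vᵢ) = 1, Lagrange's
    -- identity reads A(v) = dᵢ² + cᵢ². With s² = 1 this rewrites twice the value as 2 (1 - κ) A(v)
    -- + κ (d₁² + d₂² + (c₂ + s c₁)²).
    perturbed-posDef : ∀ {κ s} → s * s ≈ 1# → 0# < κ → κ < 1# → PositiveDefinite (perturbed (s * κ) v₁ v₂)
    perturbed-posDef {κ} {s} s²≈1 0<κ κ<1 v v#0 = *-cancelˡ-<-pos 0<2 (<-resp₂-≈ (sym (zeroʳ 2#)) (sym 2B≈)
      (+-pos-nonNeg (*-pos 0<2 (*-pos (x<y⇒0<y-x κ<1) (A-pos v v#0)))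
        (*-nonNeg 0<κ (+-nonNeg (+-nonNeg (0≤² d₁) (0≤² d₂)) (0≤² (c₂ + s * c₁))))))
      where
      2# : ℝ
      2# = fromℤ (+ 2)
      0<2 : 0# < 2#
      0<2 = fromℤ-pos {+ 2} (ℤ.+<+ (ℕ.s≤s ℕ.z≤n))
      d₁ d₂ c₁ c₂ : ℝ
      d₁ = ⟨ v , v₁ ⟩
      d₂ = ⟨ v , v₂ ⟩
      c₁ = cross v₁ v
      c₂ = cross v v₂

      Av≈₁ : A v ≈ d₁ * d₁ + c₁ * c₁
      Av≈₁ = begin
        A v               ≈⟨ *-identityʳ _ ⟨
        A v * 1#          ≈⟨ *-congˡ Av₁≈1 ⟨
        A v * A v₁        ≈⟨ lagrange v v₁ ⟩
        d₁ * d₁ + cross v v₁ * cross v v₁  ≈⟨ +-congˡ (swap v v₁) ⟩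
        d₁ * d₁ + c₁ * c₁ ∎
        where
        swap : ∀ v w → cross v w * cross v w ≈ cross w v * cross w v
        swap (x , y) (p , q) = solve 4 (λ x y p q → (x :* q :- y :* p) :* (x :* q :- y :* p) := (p :* y :- q :* x) :* (p :* y :- q :* x)) refl x y p q

      Av≈₂ : A v ≈ d₂ * d₂ + c₂ * c₂
      Av≈₂ = trans (sym (*-identityʳ _)) (trans (*-congˡ (sym Av₂≈1)) (lagrange v v₂))

      2B≈ : 2# * value (perturbed (s * κ) v₁ v₂) v ≈
            2# * ((1# - κ) * A v) + κ * (d₁ * d₁ + d₂ * d₂ + (c₂ + s * c₁) * (c₂ + s * c₁))
      2B≈ = begin
        2# * value (perturbed (s * κ) v₁ v₂) v    ≈⟨ *-congˡ (value-perturbed (s * κ) v₁ v₂ v) ⟩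
        2# * (A v + (s * κ) * (c₂ * c₁))
          ≈⟨ solve 5 (λ A s κ c₁ c₂ → con (+ 2) :* (A :+ (s :* κ) :* (c₂ :* c₁)) :=
               con (+ 2) :* ((con (+ 1) :- κ) :* A) :+ κ :* (A :+ A :+ (c₂ :* c₁ :* s) :+ (c₂ :* c₁ :* s))) refl (A v) s κ c₁ c₂ ⟩
        2# * ((fromℤ (+ 1) - κ) * A v) + κ * (A v + A v + c₂ * c₁ * s + c₂ * c₁ * s)
          ≈⟨ +-cong (*-congˡ (*-congʳ (+-congʳ (+-identityʳ 1#)))) (*-congˡ (+-congʳ (+-congʳ (+-cong Av≈₁ Av≈₂)))) ⟩
        2# * ((1# - κ) * A v) + κ * (d₁ * d₁ + c₁ * c₁ + (d₂ * d₂ + c₂ * c₂) + c₂ * c₁ * s + c₂ * c₁ * s)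
          ≈⟨ +-congˡ (*-congˡ (+-congʳ (+-congʳ (+-congʳ (+-congˡ (trans (sym (*-identityˡ _)) (*-congʳ (sym s²≈1)))))))) ⟩
        2# * ((1# - κ) * A v) + κ * (d₁ * d₁ + (s * s) * (c₁ * c₁) + (d₂ * d₂ + c₂ * c₂) + c₂ * c₁ * s + c₂ * c₁ * s)
          ≈⟨ +-congˡ (*-congˡ (solve 5 (λ d₁ d₂ s c₁ c₂ →
               d₁ :* d₁ :+ (s :* s) :* (c₁ :* c₁) :+ (d₂ :* d₂ :+ c₂ :* c₂) :+ c₂ :* c₁ :* s :+ c₂ :* c₁ :* s :=
               d₁ :* d₁ :+ d₂ :* d₂ :+ (c₂ :+ s :* c₁) :* (c₂ :+ s :* c₁)) refl d₁ d₂ s c₁ c₂)) ⟩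
        2# * ((1# - κ) * A v) + κ * (d₁ * d₁ + d₂ * d₂ + (c₂ + s * c₁) * (c₂ + s * c₁)) ∎

    module _ {a b : ℤ} (2a⟨v₁,v₂⟩≈b : fromℤ (+ 2 ℤ.* a) * ⟨ v₁ , v₂ ⟩ ≈ fromℤ b) where
      open IntegerForms using (form)

      private
        g Δ a# b# : ℝ
        g  = ⟨ v₁ , v₂ ⟩
        Δ  = cross v₁ v₂
        a# = fromℤ a
        b# = fromℤ b

        2ag≈b : fromℤ (+ 2) * a# * g ≈ b#
        2ag≈b = trans (*-congʳ (sym (fromℤ-homo-* (+ 2) a))) 2a⟨v₁,v₂⟩≈b

        1≈g²+Δ² : 1# ≈ g * g + Δ * Δ
        1≈g²+Δ² = trans (sym (trans (*-cong Av₁≈1 Av₂≈1) (*-identityʳ 1#))) (lagrange v₁ v₂)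

        fromℤ-form : ∀ x y → fromℤ (form a b x y) ≈
          a# * (fromℤ x * fromℤ x) + b# * (fromℤ x * fromℤ y) + a# * (fromℤ y * fromℤ y)
        fromℤ-form x y = trans (fromℤ-homo-+ (a ℤ.* (x ℤ.* x) ℤ.+ b ℤ.* (x ℤ.* y)) (a ℤ.* (y ℤ.* y)))
          (+-cong (trans (fromℤ-homo-+ (a ℤ.* (x ℤ.* x)) (b ℤ.* (x ℤ.* y))) (+-cong (monomial a x x) (monomial b x y)))
                  (monomial a y y))
          where
          monomial : ∀ c x y → fromℤ (c ℤ.* (x ℤ.* y)) ≈ fromℤ c * (fromℤ x * fromℤ y)
          monomial c x y = trans (fromℤ-homo-* c (x ℤ.* y)) (*-congˡ (fromℤ-homo-* x y))

      A-coordinates : ∀ x y {v} → v ≈₂ fromℤ x · v₁ +₂ fromℤ y · v₂ → a# * A v ≈ fromℤ (form a b x y)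
      A-coordinates x y {v} v≈ = begin
        a# * A v                                          ≈⟨ *-congˡ (trans (A-cong v≈) (expand X Y v₁ v₂)) ⟩
        a# * (X * X * A v₁ + Y * Y * A v₂ + fromℤ (+ 2) * (X * Y) * g) ≈⟨ *-congˡ (+-congʳ (+-cong (trans (*-congˡ Av₁≈1) (*-identityʳ _)) (trans (*-congˡ Av₂≈1) (*-identityʳ _)))) ⟩
        a# * (X * X + Y * Y + fromℤ (+ 2) * (X * Y) * g)  ≈⟨ solve 4 (λ a X Y g → a :* (X :* X :+ Y :* Y :+ con (+ 2) :* (X :* Y) :* g) := a :* (X :* X) :+ con (+ 2) :* a :* g :* (X :* Y) :+ a :* (Y :* Y)) refl a# X Y g ⟩
        a# * (X * X) + fromℤ (+ 2) * a# * g * (X * Y) + a# * (Y * Y) ≈⟨ +-congʳ (+-congˡ (*-congʳ 2ag≈b)) ⟩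
        a# * (X * X) + b# * (X * Y) + a# * (Y * Y)        ≈⟨ fromℤ-form x y ⟨
        fromℤ (form a b x y)                              ∎
        where
        X Y : ℝ
        X = fromℤ x
        Y = fromℤ y
        expand : ∀ X Y v w → A (X · v +₂ Y · w) ≈ X * X * A v + Y * Y * A w + fromℤ (+ 2) * (X * Y) * ⟨ v , w ⟩
        expand X Y (p , q) (p′ , q′) = solve 6 (λ X Y p q p′ q′ →
          (X :* p :+ Y :* p′) :* (X :* p :+ Y :* p′) :+ (X :* q :+ Y :* q′) :* (X :* q :+ Y :* q′) :=
          X :* X :* (p :* p :+ q :* q) :+ Y :* Y :* (p′ :* p′ :+ q′ :* q′) :+ con (+ 2) :* (X :* Y) :* (p :* p′ :+ q :* q′)) refl X Y p q p′ q′

      -- In coordinates the two cross products are X Δ and Y Δ. Since 4a² - b² = 4a² Δ², the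
      -- hypothesis on κ says n a κ Δ² = 1: the area Δ, possibly irrational, disappears and an
      -- integer remains.
      perturbed-coordinates : ∀ {n κ s} → + 0 ℤ.< a → fromℤ n * (fromℤ (+ 4 ℤ.* (a ℤ.* a) ℤ.- b ℤ.* b) * κ) ≈ fromℤ (+ 4 ℤ.* a) →
        ∀ x y {v} → v ≈₂ fromℤ x · v₁ +₂ fromℤ y · v₂ →
        fromℤ (n ℤ.* a) * value (perturbed (fromℤ s * κ) v₁ v₂) v ≈ fromℤ (n ℤ.* form a b x y ℤ.+ s ℤ.* (x ℤ.* y))
      perturbed-coordinates {n} {κ} {s} 0<a κ≈ x y {v} v≈ = begin
        fromℤ (n ℤ.* a) * value B v
          ≈⟨ *-cong (fromℤ-homo-* n a) (value-perturbed (s# * κ) v₁ v₂ v) ⟩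
        n# * a# * (A v + (s# * κ) * (cross v v₂ * cross v₁ v))
          ≈⟨ *-congˡ (+-congˡ (*-congˡ (*-cong (trans (cross-congˡ v₂ v≈) (crossˡ X Y v₁ v₂)) (trans (cross-congʳ v₁ v≈) (crossʳ X Y v₁ v₂))))) ⟩
        n# * a# * (A v + (s# * κ) * ((X * Δ) * (Y * Δ)))
          ≈⟨ solve 8 (λ n a A s κ X Y Δ → n :* a :* (A :+ (s :* κ) :* ((X :* Δ) :* (Y :* Δ))) := n :* (a :* A) :+ (n :* (a :* (κ :* (Δ :* Δ)))) :* (s :* (X :* Y))) refl n# a# (A v) s# κ X Y Δ ⟩
        n# * (a# * A v) + (n# * (a# * (κ * (Δ * Δ)))) * (s# * (X * Y))
          ≈⟨ +-cong (*-congˡ (A-coordinates x y v≈)) (trans (*-congʳ naκΔ²≈1) (*-identityˡ _)) ⟩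
        n# * fromℤ (form a b x y) + s# * (X * Y)
          ≈⟨ +-cong (fromℤ-homo-* n (form a b x y)) (trans (fromℤ-homo-* s (x ℤ.* y)) (*-congˡ (fromℤ-homo-* x y))) ⟨
        fromℤ (n ℤ.* form a b x y) + fromℤ (s ℤ.* (x ℤ.* y))
          ≈⟨ fromℤ-homo-+ (n ℤ.* form a b x y) (s ℤ.* (x ℤ.* y)) ⟨
        fromℤ (n ℤ.* form a b x y ℤ.+ s ℤ.* (x ℤ.* y))
          ∎
        where
        B : QuadraticForm
        B = perturbed (fromℤ s * κ) v₁ v₂
        n# s# X Y : ℝ
        n# = fromℤ n
        s# = fromℤ s
        X = fromℤ x
        Y = fromℤ y
        cross-congˡ : ∀ w {v v′} → v ≈₂ v′ → cross v w ≈ cross v′ w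
        cross-congˡ w (x≈ , y≈) = +-cong (*-congʳ x≈) (-‿cong (*-congʳ y≈))
        cross-congʳ : ∀ w {v v′} → v ≈₂ v′ → cross w v ≈ cross w v′
        cross-congʳ w (x≈ , y≈) = +-cong (*-congˡ y≈) (-‿cong (*-congˡ x≈))
        crossˡ : ∀ X Y v w → cross (X · v +₂ Y · w) w ≈ X * cross v w
        crossˡ X Y (p , q) (p′ , q′) = solve 6 (λ X Y p q p′ q′ →
          (X :* p :+ Y :* p′) :* q′ :- (X :* q :+ Y :* q′) :* p′ := X :* (p :* q′ :- q :* p′)) refl X Y p q p′ q′
        crossʳ : ∀ X Y v w → cross v (X · v +₂ Y · w) ≈ Y * cross v w
        crossʳ X Y (p , q) (p′ , q′) = solve 6 (λ X Y p q p′ q′ →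
          p :* (X :* q :+ Y :* q′) :- q :* (X :* p :+ Y :* p′) := Y :* (p :* q′ :- q :* p′)) refl X Y p q p′ q′

        E≈ : fromℤ (+ 4 ℤ.* (a ℤ.* a) ℤ.- b ℤ.* b) ≈ fromℤ (+ 4) * (a# * a#) * (Δ * Δ)
        E≈ = begin
          fromℤ (+ 4 ℤ.* (a ℤ.* a) ℤ.- b ℤ.* b)
            ≈⟨ trans (fromℤ-homo-+ (+ 4 ℤ.* (a ℤ.* a)) (ℤ.- (b ℤ.* b))) (+-cong (trans (fromℤ-homo-* (+ 4) (a ℤ.* a)) (*-congˡ (fromℤ-homo-* a a))) (trans (fromℤ-homo-neg (b ℤ.* b)) (-‿cong (fromℤ-homo-* b b)))) ⟩
          fromℤ (+ 4) * (a# * a#) - b# * b#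
            ≈⟨ +-cong (trans (sym (*-identityʳ _)) (*-congˡ 1≈g²+Δ²)) (-‿cong (*-cong (sym 2ag≈b) (sym 2ag≈b))) ⟩
          fromℤ (+ 4) * (a# * a#) * (g * g + Δ * Δ) - (fromℤ (+ 2) * a# * g) * (fromℤ (+ 2) * a# * g)
            ≈⟨ solve 3 (λ a g Δ → con (+ 4) :* (a :* a) :* (g :* g :+ Δ :* Δ) :- (con (+ 2) :* a :* g) :* (con (+ 2) :* a :* g) := con (+ 4) :* (a :* a) :* (Δ :* Δ)) refl a# g Δ ⟩
          fromℤ (+ 4) * (a# * a#) * (Δ * Δ) ∎

        naκΔ²≈1 : n# * (a# * (κ * (Δ * Δ))) ≈ 1#
        naκΔ²≈1 = *-cancelˡ-pos (*-pos (fromℤ-pos {+ 4} (ℤ.+<+ (ℕ.s≤s ℕ.z≤n))) (fromℤ-pos 0<a)) (begin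
          (fromℤ (+ 4) * a#) * (n# * (a# * (κ * (Δ * Δ))))
            ≈⟨ solve 4 (λ a n κ Δ → (con (+ 4) :* a) :* (n :* (a :* (κ :* (Δ :* Δ)))) := n :* (con (+ 4) :* (a :* a) :* (Δ :* Δ) :* κ)) refl a# n# κ Δ ⟩
          n# * (fromℤ (+ 4) * (a# * a#) * (Δ * Δ) * κ)   ≈⟨ *-congˡ (*-congʳ E≈) ⟨
          n# * (fromℤ (+ 4 ℤ.* (a ℤ.* a) ℤ.- b ℤ.* b) * κ) ≈⟨ κ≈ ⟩
          fromℤ (+ 4 ℤ.* a)                              ≈⟨ fromℤ-homo-* (+ 4) a ⟩
          fromℤ (+ 4) * a#                               ≈⟨ *-identityʳ _ ⟨
          (fromℤ (+ 4) * a#) * 1#                        ∎)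

-- Perfection excludes equal products of coordinates

module Perfection (R : RealNumbers) where
  open RealProperties R
  open Plane R
  open Perturbation R
  open IntegerForms using (form)
  open Solver using (solve; _:=_; _:+_; _:*_; _:-_; :-_; con)
  open CommutativeRing commutativeRing using (setoid)
  open Relation.Binary.Reasoning.Setoid setoid

  ≈₂-trans : ∀ {u v w} → u ≈₂ v → v ≈₂ w → u ≈₂ w
  ≈₂-trans (x≈ , y≈) (x≈′ , y≈′) = trans x≈ x≈′ , trans y≈ y≈′

  ≈₂-sym : ∀ {v w} → v ≈₂ w → w ≈₂ v
  ≈₂-sym (x≈ , y≈) = sym x≈ , sym y≈

  ≈₂-refl : ∀ {v} → v ≈₂ v
  ≈₂-refl = refl , refl

  -₂-cong : ∀ {v w} → v ≈₂ w → (-₂ v) ≈₂ (-₂ w)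
  -₂-cong (x≈ , y≈) = -‿cong x≈ , -‿cong y≈

  -₂-combination : ∀ i j v w → (-₂ (fromℤ i · v +₂ fromℤ j · w)) ≈₂ fromℤ (ℤ.- i) · v +₂ fromℤ (ℤ.- j) · w
  -₂-combination i j (p , q) (p′ , q′) = component p p′ , component q q′
    where
    component : ∀ p p′ → - (fromℤ i * p + fromℤ j * p′) ≈ fromℤ (ℤ.- i) * p + fromℤ (ℤ.- j) * p′
    component p p′ = trans
      (solve 4 (λ i j p p′ → :- (i :* p :+ j :* p′) := (:- i) :* p :+ (:- j) :* p′) refl (fromℤ i) (fromℤ j) p p′)
      (sym (+-cong (*-congʳ (fromℤ-homo-neg i)) (*-congʳ (fromℤ-homo-neg j))))

  fromℤ-injective : ∀ {i j} → fromℤ i ≈ fromℤ j → i ≡ j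
  fromℤ-injective i≈j = ℤ.≤-antisym
    (ℤ.≮⇒≥ λ j<i → <-irrefl (sym i≈j) (fromℤ-mono-< j<i))
    (ℤ.≮⇒≥ λ i<j → <-irrefl i≈j (fromℤ-mono-< i<j))

  first : ∀ v w → v ≈₂ fromℤ (+ 1) · v +₂ fromℤ (+ 0) · w
  first (p , q) (p′ , q′) = component p p′ , component q q′
    where
    component : ∀ p p′ → p ≈ fromℤ (+ 1) * p + fromℤ (+ 0) * p′
    component = solve 2 (λ p p′ → p := con (+ 1) :* p :+ con (+ 0) :* p′) refl

  second : ∀ v w → w ≈₂ fromℤ (+ 0) · v +₂ fromℤ (+ 1) · w
  second (p , q) (p′ , q′) = component p p′ , component q q′
    where
    component : ∀ p p′ → p′ ≈ fromℤ (+ 0) * p + fromℤ (+ 1) * p′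
    component = solve 2 (λ p p′ → p′ := con (+ 0) :* p :+ con (+ 1) :* p′) refl

  -- Zero also receives a sign, because the perturbation must not vanish.
  sign-of : ∀ e → ∃[ s ] (s ≡ + 1 ⊎ s ≡ -[1+ 0 ]) × + 0 ℤ.≤ s ℤ.* e
  sign-of (+ n)    = + 1 , inj₁ ≡.refl , subst (+ 0 ℤ.≤_) (≡.sym (ℤ.*-identityˡ (+ n))) (ℤ.+≤+ ℕ.z≤n)
  sign-of -[1+ n ] = -[1+ 0 ] , inj₂ ≡.refl , subst (+ 0 ℤ.≤_) (≡.sym (ℤ.-1*i≡-i -[1+ n ])) (ℤ.+≤+ ℕ.z≤n)

  -- If x₁ y₁ = x₂ y₂, adding a small multiple of the form x y to A leaves the
  -- two vectors of S and the equality of the two values on S′ intact.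
  module _ {ℓ : ℕ} {L M : Subset} (tempered : TemperedPerfect ℓ L M) where
    open TemperedPerfect tempered
    open Conditions[i-iv] cond-i-iv

    M₁⊆L₁ : M₁ ⊆ L₁
    M₁⊆L₁ (v , v∈M , w≈) = v , M⊆L v∈M , w≈

    module _ (S-pairs : ConsistsOfPairs 2 S) (S′-pairs : ConsistsOfPairs 2 S′) where
      v₁ v₂ w₁ w₂ : ℝ²
      v₁ = proj₁ S-pairs Fin.zero
      v₂ = proj₁ S-pairs (Fin.suc Fin.zero)
      w₁ = proj₁ S′-pairs Fin.zero
      w₂ = proj₁ S′-pairs (Fin.suc Fin.zero)

      S-member : ∀ i → proj₁ S-pairs i ∈ S
      S-member i = Equivalence.from (proj₁ (proj₂ S-pairs) _) (i , inj₁ ≈₂-refl)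

      S′-member : ∀ i → proj₁ S′-pairs i ∈ S′
      S′-member i = Equivalence.from (proj₁ (proj₂ S′-pairs) _) (i , inj₁ ≈₂-refl)

      Av₁≈1 : A v₁ ≈ 1#
      Av₁≈1 = cond-i v₁ (S-member _)

      Av₂≈1 : A v₂ ≈ 1#
      Av₂≈1 = cond-i v₂ (S-member _)

      module Degenerate {a b n s : ℤ} (0<a : + 0 ℤ.< a) (0≤a+b : + 0 ℤ.≤ a ℤ.+ b) (0≤a-b : + 0 ℤ.≤ a ℤ.- b)
        (2a⟨v₁,v₂⟩≈b : fromℤ (+ 2 ℤ.* a) * ⟨ v₁ , v₂ ⟩ ≈ fromℤ b)
        (coordinates : ∀ v → v ∈ L₁ → ∃₂ λ x y → v ≈₂ fromℤ x · v₁ +₂ fromℤ y · v₂)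
        (x₁ y₁ x₂ y₂ : ℤ) (w₁≈ : w₁ ≈₂ fromℤ x₁ · v₁ +₂ fromℤ y₁ · v₂) (w₂≈ : w₂ ≈₂ fromℤ x₂ · v₁ +₂ fromℤ y₂ · v₂)
        (x₁y₁≡x₂y₂ : x₁ ℤ.* y₁ ≡ x₂ ℤ.* y₂)
        (s-sign : s ≡ + 1 ⊎ s ≡ -[1+ 0 ]) (0≤se : + 0 ℤ.≤ s ℤ.* (x₁ ℤ.* y₁))
        (0<n : + 0 ℤ.< n) (2a+1<n : + 2 ℤ.* a ℤ.+ + 1 ℤ.< n) (2F₁+1<n : + 2 ℤ.* form a b x₁ y₁ ℤ.+ + 1 ℤ.< n)
        (4a<nE : + 4 ℤ.* a ℤ.< n ℤ.* (+ 4 ℤ.* (a ℤ.* a) ℤ.- b ℤ.* b)) where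

        s²≡1 : ∀ {s} → s ≡ + 1 ⊎ s ≡ -[1+ 0 ] → s ℤ.* s ≡ + 1
        s²≡1 (inj₁ ≡.refl) = ≡.refl
        s²≡1 (inj₂ ≡.refl) = ≡.refl

        s²≈1 : fromℤ s * fromℤ s ≈ 1#
        s²≈1 = trans (sym (fromℤ-homo-* s s)) (trans (reflexive (cong fromℤ (s²≡1 s-sign))) (+-identityʳ 1#))

        F₁ E : ℤ
        F₁ = form a b x₁ y₁
        E = + 4 ℤ.* (a ℤ.* a) ℤ.- b ℤ.* b

        A-form : ∀ x y {v} → v ≈₂ fromℤ x · v₁ +₂ fromℤ y · v₂ → fromℤ a * A v ≈ fromℤ (form a b x y)
        A-form = A-coordinates Av₁≈1 Av₂≈1 {a} {b} 2a⟨v₁,v₂⟩≈b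

        A-<-form : ∀ x y x′ y′ {v v′} → v ≈₂ fromℤ x · v₁ +₂ fromℤ y · v₂ → v′ ≈₂ fromℤ x′ · v₁ +₂ fromℤ y′ · v₂ →
                   A v < A v′ → form a b x y ℤ.< form a b x′ y′
        A-<-form x y x′ y′ v≈ v′≈ Av<Av′ = fromℤ-cancel-< (<-resp₂-≈ (A-form x y v≈) (A-form x′ y′ v′≈)
          (*-monoʳ-<-pos (fromℤ-pos 0<a) Av<Av′))

        form₁₀ : form a b (+ 1) (+ 0) ≡ a
        form₁₀ = lemma a b
          where
          lemma : ∀ a b → a ℤ.* (+ 1 ℤ.* + 1) ℤ.+ b ℤ.* (+ 1 ℤ.* + 0) ℤ.+ a ℤ.* (+ 0 ℤ.* + 0) ≡ a
          lemma = ℤ-Solver.solve-∀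

        -- This is u ≥ 1 multiplied by a: the form takes the value a at v₁ and F₁ at w₁.
        a≤F₁ : a ℤ.≤ F₁
        a≤F₁ = ℤ.≮⇒≥ λ F₁<a → proj₁ cond-iii (<-resp₂-≈ (proj₂ cond-iii w₁ (S′-member _)) Av₁≈1
          (*-cancelˡ-<-pos (fromℤ-pos 0<a) (<-resp₂-≈ (sym (A-form x₁ y₁ w₁≈)) (sym (A-form (+ 1) (+ 0) (first v₁ v₂)))
            (fromℤ-mono-< (subst (F₁ ℤ.<_) (≡.sym form₁₀) F₁<a)))))

        F₂≡F₁ : form a b x₂ y₂ ≡ F₁
        F₂≡F₁ = fromℤ-injective (trans (sym (A-form x₂ y₂ w₂≈)) (trans (*-congˡ (trans (proj₂ cond-iii w₂ (S′-member _))
          (sym (proj₂ cond-iii w₁ (S′-member _))))) (A-form x₁ y₁ w₁≈)))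

        0<nE : 0# < fromℤ (n ℤ.* E)
        0<nE = <-trans (fromℤ-pos {+ 4 ℤ.* a} (IntegerForms.*-pos {+ 4} (ℤ.+<+ (ℕ.s≤s ℕ.z≤n)) 0<a)) (fromℤ-mono-< 4a<nE)

        -- Solves n E κ = 4a, the normalisation under which n a B is integral on the lattice.
        κ : ℝ
        κ = proj₁ (invPos 0<nE) * fromℤ (+ 4 ℤ.* a)

        nEκ≈4a : fromℤ (n ℤ.* E) * κ ≈ fromℤ (+ 4 ℤ.* a)
        nEκ≈4a = begin
          fromℤ (n ℤ.* E) * (y * fromℤ (+ 4 ℤ.* a))  ≈⟨ *-assoc _ _ _ ⟨
          fromℤ (n ℤ.* E) * y * fromℤ (+ 4 ℤ.* a)    ≈⟨ *-congʳ (trans (*-comm _ _) (proj₂ (proj₂ (invPos 0<nE)))) ⟩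
          1# * fromℤ (+ 4 ℤ.* a)                     ≈⟨ *-identityˡ _ ⟩
          fromℤ (+ 4 ℤ.* a)                          ∎
          where
          y : ℝ
          y = proj₁ (invPos 0<nE)

        0<κ : 0# < κ
        0<κ = *-pos (proj₁ (proj₂ (invPos 0<nE))) (fromℤ-pos {+ 4 ℤ.* a} (IntegerForms.*-pos {+ 4} (ℤ.+<+ (ℕ.s≤s ℕ.z≤n)) 0<a))

        κ<1 : κ < 1#
        κ<1 = *-cancelˡ-<-pos 0<nE (<-resp₂-≈ (sym nEκ≈4a) (sym (*-identityʳ _)) (fromℤ-mono-< 4a<nE))

        B : QuadraticForm
        B = perturbed (fromℤ s * κ) v₁ v₂

        B-numerator : ℤ → ℤ → ℤ
        B-numerator x y = n ℤ.* form a b x y ℤ.+ s ℤ.* (x ℤ.* y)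

        B-form : ∀ x y {v} → v ≈₂ fromℤ x · v₁ +₂ fromℤ y · v₂ → fromℤ (n ℤ.* a) * value B v ≈ fromℤ (B-numerator x y)
        B-form = perturbed-coordinates Av₁≈1 Av₂≈1 {a} {b} 2a⟨v₁,v₂⟩≈b {n} {κ} {s} 0<a
          (trans (trans (sym (*-assoc _ _ _)) (*-congʳ (sym (fromℤ-homo-* n E)))) nEκ≈4a)

        0<na : 0# < fromℤ (n ℤ.* a)
        0<na = fromℤ-pos {n ℤ.* a} (IntegerForms.*-pos 0<n 0<a)

        B-≈ : ∀ x y x′ y′ {v v′} → v ≈₂ fromℤ x · v₁ +₂ fromℤ y · v₂ → v′ ≈₂ fromℤ x′ · v₁ +₂ fromℤ y′ · v₂ →
              B-numerator x y ≡ B-numerator x′ y′ → value B v ≈ value B v′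
        B-≈ x y x′ y′ v≈ v′≈ eq = *-cancelˡ-pos 0<na
          (trans (B-form x y v≈) (trans (reflexive (cong fromℤ eq)) (sym (B-form x′ y′ v′≈))))

        -- Multiplied by a, the inequality for A is one between integers, hence a gap of at least 1.
        -- The factor n magnifies it beyond what the terms s x y can undo; only the smaller value
        -- has to be bounded.
        B-< : ∀ x y x′ y′ {v v′} → v ≈₂ fromℤ x · v₁ +₂ fromℤ y · v₂ → v′ ≈₂ fromℤ x′ · v₁ +₂ fromℤ y′ · v₂ →
              + 2 ℤ.* form a b x y ℤ.+ + 1 ℤ.< n → A v < A v′ → value B v < value B v′
        B-< x y x′ y′ v≈ v′≈ bound Av<Av′ = *-cancelˡ-<-pos 0<na (<-resp₂-≈ (sym (B-form x y v≈)) (sym (B-form x′ y′ v′≈))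
          (fromℤ-mono-< (IntegerForms.perturbed-< 0<a 0≤a+b 0≤a-b s-sign x y x′ y′ 0<n bound (A-<-form x y x′ y′ v≈ v′≈ Av<Av′))))

        B-even : ∀ x y → B-numerator (ℤ.- x) (ℤ.- y) ≡ B-numerator x y
        B-even x y = lemma n a b s x y
          where
          lemma : ∀ n a b s x y →
            n ℤ.* (a ℤ.* ((ℤ.- x) ℤ.* (ℤ.- x)) ℤ.+ b ℤ.* ((ℤ.- x) ℤ.* (ℤ.- y)) ℤ.+ a ℤ.* ((ℤ.- y) ℤ.* (ℤ.- y))) ℤ.+ s ℤ.* ((ℤ.- x) ℤ.* (ℤ.- y)) ≡
            n ℤ.* (a ℤ.* (x ℤ.* x) ℤ.+ b ℤ.* (x ℤ.* y) ℤ.+ a ℤ.* (y ℤ.* y)) ℤ.+ s ℤ.* (x ℤ.* y)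
          lemma = ℤ-Solver.solve-∀

        B-neg : ∀ x y {v w} → w ≈₂ fromℤ x · v₁ +₂ fromℤ y · v₂ → v ≈₂ -₂ w → value B v ≈ value B w
        B-neg x y w≈ v≈-w = B-≈ (ℤ.- x) (ℤ.- y) x y
          (≈₂-trans v≈-w (≈₂-trans (-₂-cong w≈) (-₂-combination x y v₁ v₂))) w≈ (B-even x y)

        Bv₁≈1 : value B v₁ ≈ 1#
        Bv₁≈1 = *-cancelˡ-pos 0<na (trans (B-form (+ 1) (+ 0) (first v₁ v₂))
          (trans (reflexive (cong fromℤ (lemma n a b s))) (sym (*-identityʳ _))))
          where
          lemma : ∀ n a b s → n ℤ.* (a ℤ.* (+ 1 ℤ.* + 1) ℤ.+ b ℤ.* (+ 1 ℤ.* + 0) ℤ.+ a ℤ.* (+ 0 ℤ.* + 0)) ℤ.+ s ℤ.* (+ 1 ℤ.* + 0) ≡ n ℤ.* a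
          lemma = ℤ-Solver.solve-∀

        Bv₂≈1 : value B v₂ ≈ 1#
        Bv₂≈1 = trans (B-≈ (+ 0) (+ 1) (+ 1) (+ 0) (second v₁ v₂) (first v₁ v₂) (lemma n a b s)) Bv₁≈1
          where
          lemma : ∀ n a b s → n ℤ.* (a ℤ.* (+ 0 ℤ.* + 0) ℤ.+ b ℤ.* (+ 0 ℤ.* + 1) ℤ.+ a ℤ.* (+ 1 ℤ.* + 1)) ℤ.+ s ℤ.* (+ 0 ℤ.* + 1) ≡
            n ℤ.* (a ℤ.* (+ 1 ℤ.* + 1) ℤ.+ b ℤ.* (+ 1 ℤ.* + 0) ℤ.+ a ℤ.* (+ 0 ℤ.* + 0)) ℤ.+ s ℤ.* (+ 1 ℤ.* + 0)
          lemma = ℤ-Solver.solve-∀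

        Bw₂≈Bw₁ : value B w₂ ≈ value B w₁
        Bw₂≈Bw₁ = B-≈ x₂ y₂ x₁ y₁ w₂≈ w₁≈ (cong₂ (λ f e → n ℤ.* f ℤ.+ s ℤ.* e) F₂≡F₁ (≡.sym x₁y₁≡x₂y₂))

        u′ : ℝ
        u′ = value B w₁

        B-cond-i : ∀ v → v ∈ S → value B v ≈ 1#
        B-cond-i v v∈S = cases (Equivalence.to (proj₁ (proj₂ S-pairs) v) v∈S)
          where
          cases : ∃[ i ] (v ≈₂ proj₁ S-pairs i ⊎ v ≈₂ -₂ (proj₁ S-pairs i)) → value B v ≈ 1#
          cases (Fin.zero         , inj₁ v≈)  = trans (value-cong B v≈) Bv₁≈1
          cases (Fin.zero         , inj₂ v≈-) = trans (B-neg (+ 1) (+ 0) (first v₁ v₂) v≈-) Bv₁≈1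
          cases (Fin.suc Fin.zero , inj₁ v≈)  = trans (value-cong B v≈) Bv₂≈1
          cases (Fin.suc Fin.zero , inj₂ v≈-) = trans (B-neg (+ 0) (+ 1) (second v₁ v₂) v≈-) Bv₂≈1

        B-cond-ii : ∀ v → v ∈ L₁ → v ∉ M₁ → v ∉ S → 1# < value B v
        B-cond-ii v v∈L v∉M v∉S = let x , y , v≈ = coordinates v v∈L in
          <-respˡ-≈ Bv₁≈1 (B-< (+ 1) (+ 0) x y (first v₁ v₂) v≈ (subst (λ f → + 2 ℤ.* f ℤ.+ + 1 ℤ.< n) (≡.sym form₁₀) 2a+1<n) (<-respˡ-≈ (sym Av₁≈1) (cond-ii v v∈L v∉M v∉S)))

        -- The sign `s` was chosen for this: n a u′ = n F₁ + s x₁ y₁, where F₁ ≥ a and s x₁ y₁ ≥ 0.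
        1≤u′ : 1# ≤ u′
        1≤u′ u′<1 = ℤ.<⇒≱ numerators na≤
          where
          numerators : B-numerator x₁ y₁ ℤ.< n ℤ.* a
          numerators = fromℤ-cancel-< (<-resp₂-≈ (B-form x₁ y₁ w₁≈) (*-identityʳ _) (*-monoʳ-<-pos 0<na u′<1))
          na≤ : n ℤ.* a ℤ.≤ B-numerator x₁ y₁
          na≤ = subst (ℤ._≤ B-numerator x₁ y₁) (ℤ.+-identityʳ (n ℤ.* a))
            (ℤ.+-mono-≤ (ℤ.*-monoˡ-≤-nonNeg n ⦃ ℤ.nonNegative (ℤ.<⇒≤ 0<n) ⦄ a≤F₁) 0≤se)

        B-cond-iii : ∀ v → v ∈ S′ → value B v ≈ u′
        B-cond-iii v v∈S′ = cases (Equivalence.to (proj₁ (proj₂ S′-pairs) v) v∈S′)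
          where
          cases : ∃[ i ] (v ≈₂ proj₁ S′-pairs i ⊎ v ≈₂ -₂ (proj₁ S′-pairs i)) → value B v ≈ u′
          cases (Fin.zero         , inj₁ v≈)  = value-cong B v≈
          cases (Fin.zero         , inj₂ v≈-) = B-neg x₁ y₁ w₁≈ v≈-
          cases (Fin.suc Fin.zero , inj₁ v≈)  = trans (value-cong B v≈) Bw₂≈Bw₁
          cases (Fin.suc Fin.zero , inj₂ v≈-) = trans (B-neg x₂ y₂ w₂≈ v≈-) Bw₂≈Bw₁

        B-cond-iv : ∀ v → v ∈ M₁ → ¬ (v ≈₂ 0₂) → v ∉ S′ → u′ < value B v
        B-cond-iv v v∈M v≉0 v∉S′ = let x , y , v≈ = coordinates v (M₁⊆L₁ v∈M) in
          -- The smaller vector is now w₁, at which A equals u; hence the bound on n in terms of F₁.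
          B-< x₁ y₁ x y w₁≈ v≈ 2F₁+1<n (<-respˡ-≈ (sym (proj₂ cond-iii w₁ (S′-member _))) (cond-iv v v∈M v≉0 v∉S′))

        B≈A : ∀ v → value B v ≈ A v
        B≈A = proj₁ (cond-v B u′ (perturbed-posDef Av₁≈1 Av₂≈1 s²≈1 0<κ κ<1) (record
          { cond-i = B-cond-i ; cond-ii = B-cond-ii ; cond-iii = 1≤u′ , B-cond-iii ; cond-iv = B-cond-iv }))

        -- At v₁ + v₂, where x y = 1, the integers n a B and n a A differ by exactly s, but
        -- condition (v) equates B and A.
        s≡0 : s ≡ + 0
        s≡0 = ≡.trans (≡.sym (lemma (n ℤ.* form a b (+ 1) (+ 1)) s)) (ℤ.i≡j⇒i-j≡0 (fromℤ-injective {B-numerator (+ 1) (+ 1)} {n ℤ.* form a b (+ 1) (+ 1)} (begin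
          fromℤ (B-numerator (+ 1) (+ 1))       ≈⟨ B-form (+ 1) (+ 1) {z} ≈₂-refl ⟨
          fromℤ (n ℤ.* a) * value B z           ≈⟨ *-cong (fromℤ-homo-* n a) (B≈A z) ⟩
          fromℤ n * fromℤ a * A z               ≈⟨ *-assoc _ _ _ ⟩
          fromℤ n * (fromℤ a * A z)             ≈⟨ *-congˡ (A-form (+ 1) (+ 1) ≈₂-refl) ⟩
          fromℤ n * fromℤ (form a b (+ 1) (+ 1)) ≈⟨ fromℤ-homo-* n (form a b (+ 1) (+ 1)) ⟨
          fromℤ (n ℤ.* form a b (+ 1) (+ 1))    ∎)))
          where
          z : ℝ²
          z = fromℤ (+ 1) · v₁ +₂ fromℤ (+ 1) · v₂
          lemma : ∀ f s → f ℤ.+ s ℤ.* (+ 1 ℤ.* + 1) ℤ.- f ≡ s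
          lemma = ℤ-Solver.solve-∀

      perfect : ∀ {a b} → + 0 ℤ.< a → + 0 ℤ.≤ a ℤ.+ b → + 0 ℤ.≤ a ℤ.- b →
        fromℤ (+ 2 ℤ.* a) * ⟨ v₁ , v₂ ⟩ ≈ fromℤ b →
        (∀ v → v ∈ L₁ → ∃₂ λ x y → v ≈₂ fromℤ x · v₁ +₂ fromℤ y · v₂) →
        ∀ x₁ y₁ x₂ y₂ → w₁ ≈₂ fromℤ x₁ · v₁ +₂ fromℤ y₁ · v₂ → w₂ ≈₂ fromℤ x₂ · v₁ +₂ fromℤ y₂ · v₂ →
        x₁ ℤ.* y₁ ≢ x₂ ℤ.* y₂
      perfect {a} {b} 0<a 0≤a+b 0≤a-b 2a⟨v₁,v₂⟩≈b coordinates x₁ y₁ x₂ y₂ w₁≈ w₂≈ x₁y₁≡x₂y₂ =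
        let s , s-sign , 0≤se = sign-of (x₁ ℤ.* y₁)
            n , 0<n , 2a+1<n , 2F₁+1<n , 4a<nE = IntegerForms.perturbation-size {a} {b} 0<a 0≤a+b 0≤a-b
              (IntegerForms.form-nonNeg 0<a 0≤a+b 0≤a-b x₁ y₁)
        in sign≢0 s-sign (Degenerate.s≡0 {a} {b} {n} {s} 0<a 0≤a+b 0≤a-b 2a⟨v₁,v₂⟩≈b coordinates
             x₁ y₁ x₂ y₂ w₁≈ w₂≈ x₁y₁≡x₂y₂ s-sign 0≤se 0<n 2a+1<n 2F₁+1<n 4a<nE)
        where
        sign≢0 : ∀ {s} → s ≡ + 1 ⊎ s ≡ -[1+ 0 ] → s ≢ + 0
        sign≢0 (inj₁ ≡.refl) ()
        sign≢0 (inj₂ ≡.refl) ()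

-- Vectors of the rescaled lattices and elements of the ideals

module Correspondence {R : RealNumbers} (F : ImaginaryQuadraticField R) {𝒪 : ImaginaryQuadraticField.Order F}
  {L M : Plane.Subset R} (arises : ArisesFrom F 𝒪 L M)
  {scale : RealNumbers.Carrier R} (scale>0 : RealNumbers._<_ R (RealNumbers.0# R) scale) where
  open RealProperties R
  open Plane R
  open Perfection R using (≈₂-trans; ≈₂-sym; ≈₂-refl)
  open RationalProperties using (ι)
  open QuadraticFieldProperties F using (d; √d; √d>0; √d²≈d; K; embed; embedSet; ClosedUnderℤ; _⊕_; ⊖_; T; dℚ) renaming (_·_ to _∙_)
  open ArisesFrom arises
  open Solver using (solve; _:=_; _:+_; _:*_; _:-_; :-_; con)
  open CommutativeRing commutativeRing using (setoid)
  open Relation.Binary.Reasoning.Setoid setoid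

  -- `rotateScale` carries the original lattices to the ideals, whereas `v` is taken from a rescaled
  -- one; rotation commutes with scaling, so the factor appears on the right.
  record Corresponds (v : ℝ²) (α : K) : Set where
    constructor corresponds
    field rotated≈ : rotateScale v ≈₂ scale · embed α

  private
    ·-cong : ∀ r {v w} → v ≈₂ w → r · v ≈₂ r · w
    ·-cong r (x≈ , y≈) = *-congˡ x≈ , *-congˡ y≈

  rotateScale-cong : ∀ {v w} → v ≈₂ w → rotateScale v ≈₂ rotateScale w
  rotateScale-cong (x≈ , y≈) = *-congˡ (+-cong (*-congˡ x≈) (-‿cong (*-congˡ y≈))) , *-congˡ (+-cong (*-congˡ y≈) (*-congˡ x≈))

  rotateScale-· : ∀ r v → rotateScale (r · v) ≈₂ r · rotateScale v
  rotateScale-· r (x , y) =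
    solve 6 (λ c g h r x y → c :* (g :* (r :* x) :- h :* (r :* y)) := r :* (c :* (g :* x :- h :* y))) refl c (proj₁ ρ) (proj₂ ρ) r x y ,
    solve 6 (λ c g h r x y → c :* (g :* (r :* y) :+ h :* (r :* x)) := r :* (c :* (g :* y :+ h :* x))) refl c (proj₁ ρ) (proj₂ ρ) r x y

  rotateScale-linear : ∀ r s v w → rotateScale (r · v +₂ s · w) ≈₂ r · rotateScale v +₂ s · rotateScale w
  rotateScale-linear r s (x , y) (x′ , y′) =
    solve 9 (λ c g h r s x y x′ y′ → c :* (g :* (r :* x :+ s :* x′) :- h :* (r :* y :+ s :* y′)) :=
      r :* (c :* (g :* x :- h :* y)) :+ s :* (c :* (g :* x′ :- h :* y′))) refl c (proj₁ ρ) (proj₂ ρ) r s x y x′ y′ ,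
    solve 9 (λ c g h r s x y x′ y′ → c :* (g :* (r :* y :+ s :* y′) :+ h :* (r :* x :+ s :* x′)) :=
      r :* (c :* (g :* y :+ h :* x)) :+ s :* (c :* (g :* y′ :+ h :* x′))) refl c (proj₁ ρ) (proj₂ ρ) r s x y x′ y′

  rotateScale-⟨⟩ : ∀ v w → ⟨ rotateScale v , rotateScale w ⟩ ≈ c * c * ⟨ v , w ⟩
  rotateScale-⟨⟩ (x , y) (x′ , y′) = begin
    ⟨ rotateScale (x , y) , rotateScale (x′ , y′) ⟩
      ≈⟨ solve 7 (λ c g h x y x′ y′ → (c :* (g :* x :- h :* y)) :* (c :* (g :* x′ :- h :* y′)) :+ (c :* (g :* y :+ h :* x)) :* (c :* (g :* y′ :+ h :* x′)) :=
           (g :* g :+ h :* h) :* (c :* c :* (x :* x′ :+ y :* y′))) refl c (proj₁ ρ) (proj₂ ρ) x y x′ y′ ⟩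
    ⟨ ρ , ρ ⟩ * (c * c * ⟨ (x , y) , (x′ , y′) ⟩)   ≈⟨ *-congʳ ∣ρ∣≈1 ⟩
    1# * (c * c * ⟨ (x , y) , (x′ , y′) ⟩)          ≈⟨ *-identityˡ _ ⟩
    c * c * ⟨ (x , y) , (x′ , y′) ⟩                 ∎

  -- Multiplication by the conjugate of ρ undoes the rotation because ∣ρ∣ = 1, and leaves the factor
  -- c > 0.
  rotateScale-injective : ∀ {v w} → rotateScale v ≈₂ rotateScale w → v ≈₂ w
  rotateScale-injective {v} {w} (X≈ , Y≈) = *-cancelˡ-pos c>0 (trans (invert₁ v) (trans (+-cong (*-congˡ X≈) (*-congˡ Y≈)) (sym (invert₁ w)))) ,
    *-cancelˡ-pos c>0 (trans (invert₂ v) (trans (+-cong (*-congˡ Y≈) (-‿cong (*-congˡ X≈))) (sym (invert₂ w))))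
    where
    invert₁ : ∀ v → c * proj₁ v ≈ proj₁ ρ * proj₁ (rotateScale v) + proj₂ ρ * proj₂ (rotateScale v)
    invert₁ (x , y) = trans (sym (*-identityˡ _)) (trans (*-congʳ (sym ∣ρ∣≈1))
      (solve 5 (λ c g h x y → (g :* g :+ h :* h) :* (c :* x) := g :* (c :* (g :* x :- h :* y)) :+ h :* (c :* (g :* y :+ h :* x))) refl c (proj₁ ρ) (proj₂ ρ) x y))
    invert₂ : ∀ v → c * proj₂ v ≈ proj₁ ρ * proj₂ (rotateScale v) - proj₂ ρ * proj₁ (rotateScale v)
    invert₂ (x , y) = trans (sym (*-identityˡ _)) (trans (*-congʳ (sym ∣ρ∣≈1))
      (solve 5 (λ c g h x y → (g :* g :+ h :* h) :* (c :* y) := g :* (c :* (g :* y :+ h :* x)) :- h :* (c :* (g :* x :- h :* y))) refl c (proj₁ ρ) (proj₂ ρ) x y))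

  embed-injective : ∀ {α β} → embed α ≈₂ embed β → α ≡ β
  embed-injective {p , q} {p′ , q′} (p≈ , q√d≈) = cong₂ _,_ (fromℚ-injective p≈)
    (fromℚ-injective (*-cancelˡ-pos √d>0 (trans (*-comm _ _) (trans q√d≈ (*-comm _ _)))))

  embed-linear : ∀ m n α β → embed (ι m ∙ α ⊕ ι n ∙ β) ≈₂ fromℤ m · embed α +₂ fromℤ n · embed β
  embed-linear m n (p , q) (p′ , q′) = component p p′ , trans (*-congʳ (component q q′))
    (solve 5 (λ m n q q′ r → (m :* q :+ n :* q′) :* r := m :* (q :* r) :+ n :* (q′ :* r)) refl (fromℤ m) (fromℤ n) (fromℚ q) (fromℚ q′) √d)
    where
    component : ∀ p p′ → fromℚ (ι m ℚ.* p ℚ.+ ι n ℚ.* p′) ≈ fromℤ m * fromℚ p + fromℤ n * fromℚ p′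
    component p p′ = trans (fromℚ-homo-+ (ι m ℚ.* p) (ι n ℚ.* p′))
      (+-cong (trans (fromℚ-homo-* (ι m) p) (*-congʳ (fromℚ-fromℤ m))) (trans (fromℚ-homo-* (ι n) p′) (*-congʳ (fromℚ-fromℤ n))))

  embed-⊖ : ∀ α → embed (⊖ α) ≈₂ -₂ (embed α)
  embed-⊖ (p , q) = fromℚ-homo-neg p , trans (*-congʳ (fromℚ-homo-neg q))
    (solve 2 (λ q r → (:- q) :* r := :- (q :* r)) refl (fromℚ q) √d)

  embed-⟨⟩ : ∀ α β → ⟨ embed α , embed β ⟩ ≈ fromℚ (T α β)
  embed-⟨⟩ (p , q) (p′ , q′) = begin
    fromℚ p * fromℚ p′ + (fromℚ q * √d) * (fromℚ q′ * √d)
      ≈⟨ solve 5 (λ p p′ q q′ r → p :* p′ :+ (q :* r) :* (q′ :* r) := p :* p′ :+ (r :* r) :* (q :* q′)) refl (fromℚ p) (fromℚ p′) (fromℚ q) (fromℚ q′) √d ⟩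
    fromℚ p * fromℚ p′ + (√d * √d) * (fromℚ q * fromℚ q′)
      ≈⟨ +-cong (sym (fromℚ-homo-* p p′)) (*-cong (trans √d²≈d (sym (fromℚ-fromℤ (+ d)))) (sym (fromℚ-homo-* q q′))) ⟩
    fromℚ (p ℚ.* p′) + fromℚ dℚ * fromℚ (q ℚ.* q′)
      ≈⟨ trans (fromℚ-homo-+ (p ℚ.* p′) (dℚ ℚ.* (q ℚ.* q′))) (+-congˡ (fromℚ-homo-* dℚ (q ℚ.* q′))) ⟨
    fromℚ (p ℚ.* p′ ℚ.+ dℚ ℚ.* (q ℚ.* q′)) ∎

  corresponds-linear : ∀ m n {v w α β} → Corresponds v α → Corresponds w β →
                       Corresponds (fromℤ m · v +₂ fromℤ n · w) (ι m ∙ α ⊕ ι n ∙ β)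
  corresponds-linear m n {v} {w} {α} {β} (corresponds (X≈ , Y≈)) (corresponds (X≈′ , Y≈′)) =
    corresponds $ ≈₂-trans (rotateScale-linear (fromℤ m) (fromℤ n) v w)
      (≈₂-trans (+-cong (*-congˡ X≈) (*-congˡ X≈′) , +-cong (*-congˡ Y≈) (*-congˡ Y≈′))
        (≈₂-trans (component (proj₁ (embed α)) (proj₁ (embed β)) , component (proj₂ (embed α)) (proj₂ (embed β)))
          (·-cong scale (≈₂-sym (embed-linear m n α β)))))
    where
    component : ∀ p p′ → fromℤ m * (scale * p) + fromℤ n * (scale * p′) ≈ scale * (fromℤ m * p + fromℤ n * p′)
    component p p′ = solve 5 (λ m n s p p′ → m :* (s :* p) :+ n :* (s :* p′) := s :* (m :* p :+ n :* p′)) refl (fromℤ m) (fromℤ n) scale p p′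

  corresponds-neg : ∀ {v α} → Corresponds v α → Corresponds (-₂ v) (⊖ α)
  corresponds-neg {v} {α} (corresponds (X≈ , Y≈)) = corresponds $ ≈₂-trans (neg v) (≈₂-trans (-‿cong X≈ , -‿cong Y≈)
    (≈₂-trans (component (proj₁ (embed α)) , component (proj₂ (embed α))) (·-cong scale (≈₂-sym (embed-⊖ α)))))
    where
    neg : ∀ v → rotateScale (-₂ v) ≈₂ -₂ (rotateScale v)
    neg (x , y) = solve 5 (λ c g h x y → c :* (g :* (:- x) :- h :* (:- y)) := :- (c :* (g :* x :- h :* y))) refl c (proj₁ ρ) (proj₂ ρ) x y ,
      solve 5 (λ c g h x y → c :* (g :* (:- y) :+ h :* (:- x)) := :- (c :* (g :* y :+ h :* x))) refl c (proj₁ ρ) (proj₂ ρ) x y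
    component : ∀ p → - (scale * p) ≈ scale * - p
    component p = solve 2 (λ s p → :- (s :* p) := s :* (:- p)) refl scale p

  -- Both sides are the dot product of the rotated vectors. The factors depend on neither vector, so
  -- comparisons of A-values become comparisons of rational norms.
  corresponds-⟨⟩ : ∀ {v w α β} → Corresponds v α → Corresponds w β →
                   c * c * ⟨ v , w ⟩ ≈ scale * scale * fromℚ (T α β)
  corresponds-⟨⟩ {v} {w} {α} {β} (corresponds (X≈ , Y≈)) (corresponds (X≈′ , Y≈′)) = begin
    c * c * ⟨ v , w ⟩                              ≈⟨ rotateScale-⟨⟩ v w ⟨
    ⟨ rotateScale v , rotateScale w ⟩              ≈⟨ +-cong (*-cong X≈ X≈′) (*-cong Y≈ Y≈′) ⟩
    ⟨ scale · embed α , scale · embed β ⟩          ≈⟨ solve 5 (λ s p q p′ q′ → (s :* p) :* (s :* p′) :+ (s :* q) :* (s :* q′) := s :* s :* (p :* p′ :+ q :* q′)) refl scale (proj₁ (embed α)) (proj₂ (embed α)) (proj₁ (embed β)) (proj₂ (embed β)) ⟩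
    scale * scale * ⟨ embed α , embed β ⟩          ≈⟨ *-congˡ (embed-⟨⟩ α β) ⟩
    scale * scale * fromℚ (T α β)                  ∎

  corresponds-injective : ∀ {v w α} → Corresponds v α → Corresponds w α → v ≈₂ w
  corresponds-injective (corresponds v~α) (corresponds w~α) = rotateScale-injective (≈₂-trans v~α (≈₂-sym w~α))

  corresponds-functional : ∀ {v α β} → Corresponds v α → Corresponds v β → α ≡ β
  corresponds-functional (corresponds v~α) (corresponds v~β) = let X≈ , Y≈ = ≈₂-trans (≈₂-sym v~α) v~β in
    embed-injective (*-cancelˡ-pos scale>0 X≈ , *-cancelˡ-pos scale>0 Y≈)

  module _ {X : Subset} {I : Pred K 0ℓ} (X↦I : Image rotateScale X ≐ embedSet I) where

    member⇒element : ∀ {w} → w ∈ Image (scale ·_) X → ∃[ α ] α ∈ I × Corresponds w α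
    member⇒element (v , v∈X , w≈) = let α , α∈I , eq = proj₁ X↦I (v , v∈X , ≈₂-refl) in
      α , α∈I , (corresponds $ ≈₂-trans (rotateScale-cong w≈) (≈₂-trans (rotateScale-· scale v) (·-cong scale eq)))

    element⇒member : ∀ {α} → α ∈ I → ∃[ w ] w ∈ Image (scale ·_) X × Corresponds w α
    element⇒member {α} α∈I = let v , v∈X , eq = proj₂ X↦I (α , α∈I , ≈₂-refl) in
      scale · v , (v , v∈X , ≈₂-refl) , corresponds (≈₂-trans (rotateScale-· scale v) (·-cong scale (≈₂-sym eq)))

  module _ {ℓ : ℕ} (index : HasIndex ℓ L M) (J-closed : ClosedUnderℤ J) where

    private
      preimage : ∀ {α} → α ∈ I → ∃[ v ] v ∈ L × embed α ≈₂ rotateScale v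
      preimage {α} α∈I = proj₂ L↦I (α , α∈I , ≈₂-refl)

    -- The preimage in L is read off from the membership proof, so the coset is a function of that
    -- proof; one fixed proof for each pair of coordinates makes it a function on ℤ².
    coset : ∀ {α} → α ∈ I → Fin ℓ
    coset α∈I = let v , v∈L , _ = preimage α∈I in proj₁ (proj₂ (proj₂ index) v v∈L)

    -- The common representative cancels: α - β is the difference of the images of v - rᵢ and w -
    -- rᵢ, which both lie in `J`.
    same-coset : ∀ {α β} (α∈I : α ∈ I) (β∈I : β ∈ I) → coset α∈I ≡ coset β∈I →
                 ι (+ 1) ∙ α ⊕ ι -[1+ 0 ] ∙ β ∈ J
    same-coset {α} {β} α∈I β∈I i≡j =
      let v , v∈L , α≈ = preimage α∈I
          w , w∈L , β≈ = preimage β∈I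
          r = proj₁ index
          i , v-r∈M , _ = proj₂ (proj₂ index) v v∈L
          j , w-r∈M , _ = proj₂ (proj₂ index) w w∈L
          w-r∈M′ = subst (λ k → w -₂ r k ∈ M) (≡.sym i≡j) w-r∈M
          γ , γ∈J , γ≈ = proj₁ M↦J (v -₂ r i , v-r∈M , ≈₂-refl)
          δ , δ∈J , δ≈ = proj₁ M↦J (w -₂ r i , w-r∈M′ , ≈₂-refl)
      in subst (_∈ J) (embed-injective (transport v w (r i) γ δ α≈ β≈ γ≈ δ≈)) (J-closed (+ 1) -[1+ 0 ] γ∈J δ∈J)
      where
      transport : ∀ v w r γ δ → embed α ≈₂ rotateScale v → embed β ≈₂ rotateScale w →
        rotateScale (v -₂ r) ≈₂ embed γ → rotateScale (w -₂ r) ≈₂ embed δ →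
        embed (ι (+ 1) ∙ γ ⊕ ι -[1+ 0 ] ∙ δ) ≈₂ embed (ι (+ 1) ∙ α ⊕ ι -[1+ 0 ] ∙ β)
      transport v w r γ δ (αx , αy) (βx , βy) (γx , γy) (δx , δy) =
        ≈₂-trans (embed-linear (+ 1) -[1+ 0 ] γ δ)
        (≈₂-trans (+-cong (*-congˡ (sym γx)) (*-congˡ (sym δx)) , +-cong (*-congˡ (sym γy)) (*-congˡ (sym δy)))
        (≈₂-trans (≈₂-sym (rotateScale-linear (fromℤ (+ 1)) (fromℤ -[1+ 0 ]) (v -₂ r) (w -₂ r)))
        (≈₂-trans (rotateScale-cong (component (proj₁ v) (proj₁ w) (proj₁ r) , component (proj₂ v) (proj₂ w) (proj₂ r)))
        (≈₂-trans (rotateScale-linear (fromℤ (+ 1)) (fromℤ -[1+ 0 ]) v w)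
        (≈₂-trans (+-cong (*-congˡ (sym αx)) (*-congˡ (sym βx)) , +-cong (*-congˡ (sym αy)) (*-congˡ (sym βy)))
          (≈₂-sym (embed-linear (+ 1) -[1+ 0 ] α β)))))))
        where
        component : ∀ x y r → fromℤ (+ 1) * (x - r) + fromℤ -[1+ 0 ] * (y - r) ≈ fromℤ (+ 1) * x + fromℤ -[1+ 0 ] * y
        component = solve 3 (λ x y r → con (+ 1) :* (x :- r) :+ con -[1+ 0 ] :* (y :- r) := con (+ 1) :* x :+ con -[1+ 0 ] :* y) refl

-- With p = x₁² - x₂² and q = y₁² - y₂² one has σ = p + q and
-- 4 (x₁ y₂ - x₂ y₁)² - (4 δ² - σ²) = (p - q)².
4δ²-σ²≤4ℓ² : ∀ x₁ y₁ x₂ y₂ {m ℓ} → ∣ x₁ ℤ.* y₂ ℤ.- x₂ ℤ.* y₁ ∣ ℕ.≤ ℓ →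
  let δ = x₁ ℤ.* y₁ ℤ.- x₂ ℤ.* y₂
      σ = x₁ ℤ.* x₁ ℤ.+ y₁ ℤ.* y₁ ℤ.- (x₂ ℤ.* x₂ ℤ.+ y₂ ℤ.* y₂)
  in + m ℤ.≤ + 4 ℤ.* (δ ℤ.* δ) ℤ.- σ ℤ.* σ → m ℕ.≤ 4 ℕ.* ℓ ℕ.^ 2
4δ²-σ²≤4ℓ² x₁ y₁ x₂ y₂ {m} {ℓ} e≤ℓ m≤ = ℕ.≤-trans (ℤ.drop‿+≤+ (ℤ.≤-trans m≤ 4δ²-σ²≤4e²)) 4e²≤4ℓ²
  where
  e : ℤ
  e = x₁ ℤ.* y₂ ℤ.- x₂ ℤ.* y₁
  lemma : ∀ x₁ y₁ x₂ y₂ →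
    (+ 4 ℤ.* ((x₁ ℤ.* y₁ ℤ.- x₂ ℤ.* y₂) ℤ.* (x₁ ℤ.* y₁ ℤ.- x₂ ℤ.* y₂)) ℤ.-
      (x₁ ℤ.* x₁ ℤ.+ y₁ ℤ.* y₁ ℤ.- (x₂ ℤ.* x₂ ℤ.+ y₂ ℤ.* y₂)) ℤ.* (x₁ ℤ.* x₁ ℤ.+ y₁ ℤ.* y₁ ℤ.- (x₂ ℤ.* x₂ ℤ.+ y₂ ℤ.* y₂))) ℤ.+
    (x₁ ℤ.* x₁ ℤ.- x₂ ℤ.* x₂ ℤ.- (y₁ ℤ.* y₁ ℤ.- y₂ ℤ.* y₂)) ℤ.* (x₁ ℤ.* x₁ ℤ.- x₂ ℤ.* x₂ ℤ.- (y₁ ℤ.* y₁ ℤ.- y₂ ℤ.* y₂)) ≡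
    + 4 ℤ.* ((x₁ ℤ.* y₂ ℤ.- x₂ ℤ.* y₁) ℤ.* (x₁ ℤ.* y₂ ℤ.- x₂ ℤ.* y₁))
  lemma = ℤ-Solver.solve-∀
  4δ²-σ²≤4e² : _ ℤ.≤ + (4 ℕ.* (∣ e ∣ ℕ.* ∣ e ∣))
  4δ²-σ²≤4e² = subst₂ ℤ._≤_ (ℤ.+-identityʳ _)
    (≡.trans (lemma x₁ y₁ x₂ y₂) (≡.sym (≡.trans (ℤ.pos-* 4 (∣ e ∣ ℕ.* ∣ e ∣)) (cong (+ 4 ℤ.*_) (IntegerForms.∣i∣²≡i² e)))))
    (ℤ.+-monoʳ-≤ (+ 4 ℤ.* ((x₁ ℤ.* y₁ ℤ.- x₂ ℤ.* y₂) ℤ.* (x₁ ℤ.* y₁ ℤ.- x₂ ℤ.* y₂)) ℤ.-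
      (x₁ ℤ.* x₁ ℤ.+ y₁ ℤ.* y₁ ℤ.- (x₂ ℤ.* x₂ ℤ.+ y₂ ℤ.* y₂)) ℤ.* (x₁ ℤ.* x₁ ℤ.+ y₁ ℤ.* y₁ ℤ.- (x₂ ℤ.* x₂ ℤ.+ y₂ ℤ.* y₂)))
      (IntegerForms.0≤² (x₁ ℤ.* x₁ ℤ.- x₂ ℤ.* x₂ ℤ.- (y₁ ℤ.* y₁ ℤ.- y₂ ℤ.* y₂))))
  4e²≤4ℓ² : 4 ℕ.* (∣ e ∣ ℕ.* ∣ e ∣) ℕ.≤ 4 ℕ.* ℓ ℕ.^ 2
  4e²≤4ℓ² = ℕ.*-monoʳ-≤ 4 (subst (∣ e ∣ ℕ.* ∣ e ∣ ℕ.≤_) (cong (ℓ ℕ.*_) (≡.sym (ℕ.*-identityʳ ℓ))) (ℕ.*-mono-≤ e≤ℓ e≤ℓ))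

-- Assembly: the ideals of a 2-and-2 form

module TwoAndTwoForm {R : RealNumbers} {ℓ : ℕ} {F : ImaginaryQuadraticField R} {𝒪 : ImaginaryQuadraticField.Order F}
  {L M : Plane.Subset R} (twoAndTwo : Plane._-and-_FormOfIndex R 2 2 ℓ L M) (arises : ArisesFrom F 𝒪 L M) where
  open RealProperties R
  open Plane R
  open _-and-_FormOfIndex twoAndTwo
  open TemperedPerfect temperedPerfect
  open Conditions[i-iv] cond-i-iv
  open ArisesFrom arises
  open Perfection R using (≈₂-trans; M₁⊆L₁; S-member; S′-member; perfect)
  open RationalProperties using (ι; ι-homo-+; ι-homo-*; ι-homo--; ι-homo-neg; ι-injective; ι-pos; ι-nonNeg⁻¹; ↧*q)
  open QuadraticFieldProperties F
    using (K; 0K; embed; IsDiscriminant; N; T; _⊕_; ⊖_; IsMinimalPair; finitelyGenerated⇒closed; ClosedUnderℤ;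
           nested-combination; difference; coordinates-unique)
    renaming (_·_ to _∙_)
  open Correspondence F arises scale>0
  open Discriminant F using (discriminant-bound)
  open LatticeIndex using (det≤index)
  open CommutativeRing commutativeRing using (setoid)

  private
    v₁ v₂ w₁ w₂ : ℝ²
    v₁ = proj₁ S-pairs Fin.zero
    v₂ = proj₁ S-pairs (Fin.suc Fin.zero)
    w₁ = proj₁ S′-pairs Fin.zero
    w₂ = proj₁ S′-pairs (Fin.suc Fin.zero)

  S∋ : ∀ i → proj₁ S-pairs i ∈ S
  S∋ = S-member temperedPerfect S-pairs S′-pairs

  S′∋ : ∀ i → proj₁ S′-pairs i ∈ S′
  S′∋ = S′-member temperedPerfect S-pairs S′-pairs

  0<c² : 0# < c * c
  0<c² = *-pos c>0 c>0

  0<scale² : 0# < scale * scale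
  0<scale² = *-pos scale>0 scale>0

  N-mono-< : ∀ {v w α β} → Corresponds v α → Corresponds w β → N α ℚ.< N β → A v < A w
  N-mono-< v~α w~β Nα<Nβ = *-cancelˡ-<-pos 0<c² (<-resp₂-≈ (sym (corresponds-⟨⟩ v~α v~α)) (sym (corresponds-⟨⟩ w~β w~β))
    (*-monoʳ-<-pos 0<scale² (fromℚ-mono-< Nα<Nβ)))

  N-≡ : ∀ {v w α β} → Corresponds v α → Corresponds w β → A v ≈ A w → N α ≡ N β
  N-≡ v~α w~β Av≈Aw = fromℚ-injective (*-cancelˡ-pos 0<scale²
    (trans (sym (corresponds-⟨⟩ v~α v~α)) (trans (*-congˡ Av≈Aw) (corresponds-⟨⟩ w~β w~β))))

  -- Membership in `M₁` and `S` need not be decided: assuming A w < 1 refutes both, the former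
  -- through 1 ≤ u, and condition (ii) then contradicts the assumption.
  1≤A : ∀ w → w ∈ L₁ → ¬ (w ≈₂ 0₂) → 1# ≤ A w
  1≤A w w∈L w≉0 Aw<1 = <-asym Aw<1 (cond-ii w w∈L w∉M w∉S)
    where
    w∉S : w ∉ S
    w∉S w∈S = <-irrefl (cond-i w w∈S) Aw<1
    w∉M : w ∉ M₁
    w∉M w∈M = proj₁ cond-iii (<-trans (cond-iv w w∈M w≉0 w∉S′) Aw<1)
      where
      w∉S′ : w ∉ S′
      w∉S′ w∈S′ = proj₁ cond-iii (<-respˡ-≈ (proj₂ cond-iii w w∈S′) Aw<1)

  u≤A : ∀ w → w ∈ M₁ → ¬ (w ≈₂ 0₂) → u ≤ A w
  u≤A w w∈M w≉0 Aw<u = <-asym Aw<u (cond-iv w w∈M w≉0 λ w∈S′ → <-irrefl (proj₂ cond-iii w w∈S′) Aw<u)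

  zero-corresponds : ∀ {w α} → Corresponds w α → w ≈₂ 0₂ → α ≡ 0K
  zero-corresponds {w} w~α w≈0 = corresponds-functional w~α
    (corresponds (≈₂-trans (rotateScale-cong w≈0) (component₁ , component₂)))
    where
    open Solver
    component₁ : proj₁ (rotateScale 0₂) ≈ scale * proj₁ (embed 0K)
    component₁ = trans (solve 3 (λ c g h → c :* (g :* con (+ 0) :- h :* con (+ 0)) := con (+ 0)) refl c (proj₁ ρ) (proj₂ ρ))
      (sym (trans (*-congˡ (fromℚ-fromℤ (+ 0))) (zeroʳ scale)))
    component₂ : proj₂ (rotateScale 0₂) ≈ scale * proj₂ (embed 0K)
    component₂ = trans (solve 3 (λ c g h → c :* (g :* con (+ 0) :+ h :* con (+ 0)) := con (+ 0)) refl c (proj₁ ρ) (proj₂ ρ))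
      (sym (trans (*-congˡ (trans (*-congʳ (fromℚ-fromℤ (+ 0))) (zeroˡ _))) (zeroʳ scale)))

  I-closed : ClosedUnderℤ I
  I-closed = finitelyGenerated⇒closed (proj₁ (proj₁ I-proper))

  J-closed : ClosedUnderℤ J
  J-closed = finitelyGenerated⇒closed (proj₁ (proj₁ J-proper))

  -- The inclusion of M in L passes to the ideals, since a vector corresponds to at most one
  -- element.
  J⊆I : ∀ {α} → α ∈ J → α ∈ I
  J⊆I α∈J =
    let w , w∈M , w~α = element⇒member M↦J α∈J
        β , β∈I , w~β = member⇒element L↦I (M₁⊆L₁ temperedPerfect w∈M)
    in subst (_∈ I) (corresponds-functional w~β w~α) β∈I

  distinct-elements : ∀ {v w α β} → ¬ (v ≈₂ w) → Corresponds v α → Corresponds w β → α ≢ β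
  distinct-elements v≉w v~α w~β ≡.refl = v≉w (corresponds-injective v~α w~β)

  minimalPair : ∀ {X : Subset} {I : Pred K 0ℓ} → ((∀ {α} → α ∈ I → ∃[ w ] w ∈ X × Corresponds w α)) → ClosedUnderℤ I →
    ∀ {v w α β} → Corresponds v α → Corresponds w β → α ∈ I → β ∈ I → A v ≈ A w → 0# < A v →
    ¬ (v ≈₂ w) → ¬ (v ≈₂ -₂ w) → (∀ x → x ∈ X → ¬ (x ≈₂ 0₂) → A v ≤ A x) → IsMinimalPair I α β
  minimalPair {I = I} element⇒ I-closed {v} {α = α} v~α w~β α∈I β∈I Av≈Aw 0<Av v≉w v≉-w minimal = record
    { closed = I-closed ; α∈I = α∈I ; β∈I = β∈I
    ; Nα≡Nβ = N-≡ v~α w~β Av≈Aw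
    ; 0<N = 0<N
    ; α≢β = distinct-elements v≉w v~α w~β
    ; α≢-β = distinct-elements v≉-w v~α (corresponds-neg w~β)
    ; minimal = λ x x∈I x≢0 → let y , y∈X , y~x = element⇒ x∈I in
        ℚ.≮⇒≥ λ Nx<Nα → minimal y y∈X (x≢0 ∘ zero-corresponds y~x) (N-mono-< y~x v~α Nx<Nα)
    }
    where
    0<N : 0ℚ ℚ.< N α
    0<N = fromℚ-cancel-< (*-cancelˡ-<-pos 0<scale² (<-resp₂-≈
      (sym (trans (*-congˡ (fromℚ-fromℤ (+ 0))) (zeroʳ _))) (corresponds-⟨⟩ v~α v~α) (*-pos 0<c² 0<Av)))

  module Elements {α₁ α₂ β₁ β₂ : K} (α₁∈I : α₁ ∈ I) (α₂∈I : α₂ ∈ I) (β₁∈J : β₁ ∈ J) (β₂∈J : β₂ ∈ J)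
    (v₁~α₁ : Corresponds v₁ α₁) (v₂~α₂ : Corresponds v₂ α₂)
    (w₁~β₁ : Corresponds w₁ β₁) (w₂~β₂ : Corresponds w₂ β₂) where

    private
      Av₁≈ : A v₁ ≈ 1#
      Av₁≈ = cond-i v₁ (S∋ _)

      Aw₁≈ : A w₁ ≈ u
      Aw₁≈ = proj₂ cond-iii w₁ (S′∋ _)

      0≢1 : Fin.zero ≢ Fin.suc {1} Fin.zero
      0≢1 ()

    α-minimal : IsMinimalPair I α₁ α₂
    α-minimal = minimalPair (element⇒member L↦I) I-closed v₁~α₁ v₂~α₂ α₁∈I α₂∈I
      (trans Av₁≈ (sym (cond-i v₂ (S∋ _)))) (<-respʳ-≈ (sym Av₁≈) 0<1)
      (proj₁ (proj₂ (proj₂ S-pairs) _ _ 0≢1)) (proj₂ (proj₂ (proj₂ S-pairs) _ _ 0≢1))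
      λ x x∈L x≉0 → ≤-resp₂-≈ (sym Av₁≈) refl (1≤A x x∈L x≉0)

    β-minimal : IsMinimalPair J β₁ β₂
    β-minimal = minimalPair (element⇒member M↦J) J-closed w₁~β₁ w₂~β₂ β₁∈J β₂∈J
      (trans Aw₁≈ (sym (proj₂ cond-iii w₂ (S′∋ _)))) (<-respʳ-≈ (sym Aw₁≈) 0<u)
      (proj₁ (proj₂ (proj₂ S′-pairs) _ _ 0≢1)) (proj₂ (proj₂ (proj₂ S′-pairs) _ _ 0≢1))
      λ x x∈M x≉0 → ≤-resp₂-≈ (sym Aw₁≈) refl (u≤A x x∈M x≉0)
      where
      0<u : 0# < u
      0<u = <-≤-trans 0<1 (proj₁ cond-iii)

    open IsMinimalPair α-minimal using (ν; τ; 0<N; Nα≡Nβ; 0≤ν+τ; 0≤ν-τ; det≢0; generate; N-coordinates)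

    -- Coordinates found in `K` hold in the plane too: the combination of v₁ and v₂ corresponds to
    -- the same element as `v`, and correspondence is injective.
    lift-coordinates : ∀ {v ξ} x y → Corresponds v ξ → ξ ≡ ι x ∙ α₁ ⊕ ι y ∙ α₂ → v ≈₂ fromℤ x · v₁ +₂ fromℤ y · v₂
    lift-coordinates x y v~ξ ≡.refl = corresponds-injective v~ξ (corresponds-linear x y v₁~α₁ v₂~α₂)

    lattice-coordinates : ∀ v → v ∈ L₁ → ∃₂ λ x y → v ≈₂ fromℤ x · v₁ +₂ fromℤ y · v₂
    lattice-coordinates v v∈L =
      let ξ , ξ∈I , v~ξ = member⇒element L↦I v∈L
          x , y , ξ≡ = generate ξ ξ∈I
      in x , y , lift-coordinates x y v~ξ ξ≡

    -- Here t = τ/ν is 2⟨v₁, v₂⟩ for the unit vectors v₁ and v₂. It is rational because these come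
    -- from `K`; its denominator `a` and numerator `b` are the coefficients of the integral form in
    -- the perturbation argument.
    module Slope (a b : ℤ) (t : ℚ) (at≡b : ι a ℚ.* t ≡ ι b) (tν≡τ : t ℚ.* ν ≡ τ) (0<a : + 0 ℤ.< a) where

      aτ≡bν : ι a ℚ.* τ ≡ ι b ℚ.* ν
      aτ≡bν = ≡.trans (cong (ι a ℚ.*_) (≡.sym tν≡τ)) (≡.trans (≡.sym (ℚ.*-assoc (ι a) t ν)) (cong (ℚ._* ν) at≡b))

      private
        cancel-ν : ∀ i → 0ℚ ℚ.≤ ι i ℚ.* ν → + 0 ℤ.≤ i
        cancel-ν i 0≤iν = ι-nonNeg⁻¹ i (ℚ.*-cancelʳ-≤-pos ν ⦃ ℚ.positive 0<N ⦄ (subst (ℚ._≤ ι i ℚ.* ν) (≡.sym (ℚ.*-zeroˡ ν)) 0≤iν))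

      0≤a+b : + 0 ℤ.≤ a ℤ.+ b
      0≤a+b = cancel-ν (a ℤ.+ b) (subst (0ℚ ℚ.≤_) eq (RationalProperties.*-nonNeg (ℚ.<⇒≤ (ι-pos 0<a)) 0≤ν+τ))
        where
        eq : ι a ℚ.* (ν ℚ.+ τ) ≡ ι (a ℤ.+ b) ℚ.* ν
        eq = ≡.trans (ℚ.*-distribˡ-+ (ι a) ν τ) (≡.trans (cong (λ x → ι a ℚ.* ν ℚ.+ x) aτ≡bν)
          (≡.trans (≡.sym (ℚ.*-distribʳ-+ ν (ι a) (ι b))) (cong (ℚ._* ν) (≡.sym (ι-homo-+ a b)))))

      0≤a-b : + 0 ℤ.≤ a ℤ.- b
      0≤a-b = cancel-ν (a ℤ.- b) (subst (0ℚ ℚ.≤_) eq (RationalProperties.*-nonNeg (ℚ.<⇒≤ (ι-pos 0<a)) 0≤ν-τ))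
        where
        distrib : ∀ a x y → a ℚ.* (x ℚ.- y) ≡ a ℚ.* x ℚ.- a ℚ.* y
        distrib = RingSolver.solve-∀ ℚ-ring
        collect : ∀ a b x → a ℚ.* x ℚ.- b ℚ.* x ≡ (a ℚ.- b) ℚ.* x
        collect = RingSolver.solve-∀ ℚ-ring
        eq : ι a ℚ.* (ν ℚ.- τ) ≡ ι (a ℤ.- b) ℚ.* ν
        eq = ≡.trans (distrib (ι a) ν τ) (≡.trans (cong (λ x → ι a ℚ.* ν ℚ.- x) aτ≡bν)
          (≡.trans (collect (ι a) (ι b) ν) (cong (ℚ._* ν) (≡.sym (ι-homo-- a b)))))

      2a⟨v₁,v₂⟩≈b : fromℤ (+ 2 ℤ.* a) * ⟨ v₁ , v₂ ⟩ ≈ fromℤ b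
      2a⟨v₁,v₂⟩≈b = *-cancelˡ-pos 0<c² (begin
        c * c * (fromℤ (+ 2 ℤ.* a) * ⟨ v₁ , v₂ ⟩)               ≈⟨ swap (c * c) (fromℤ (+ 2 ℤ.* a)) ⟨ v₁ , v₂ ⟩ ⟩
        fromℤ (+ 2 ℤ.* a) * (c * c * ⟨ v₁ , v₂ ⟩)               ≈⟨ *-cong (sym (fromℚ-fromℤ (+ 2 ℤ.* a))) (corresponds-⟨⟩ v₁~α₁ v₂~α₂) ⟩
        fromℚ (ι (+ 2 ℤ.* a)) * (scale * scale * fromℚ (T α₁ α₂)) ≈⟨ swap (fromℚ (ι (+ 2 ℤ.* a))) (scale * scale) (fromℚ (T α₁ α₂)) ⟩
        scale * scale * (fromℚ (ι (+ 2 ℤ.* a)) * fromℚ (T α₁ α₂)) ≈⟨ *-congˡ (fromℚ-homo-* (ι (+ 2 ℤ.* a)) (T α₁ α₂)) ⟨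
        scale * scale * fromℚ (ι (+ 2 ℤ.* a) ℚ.* T α₁ α₂)       ≈⟨ *-congˡ (reflexive (cong fromℚ 2aT≡bν)) ⟩
        scale * scale * fromℚ (ι b ℚ.* ν)                       ≈⟨ *-congˡ (fromℚ-homo-* (ι b) ν) ⟩
        scale * scale * (fromℚ (ι b) * fromℚ ν)                 ≈⟨ swap (scale * scale) (fromℚ (ι b)) (fromℚ ν) ⟩
        fromℚ (ι b) * (scale * scale * fromℚ ν)                 ≈⟨ *-cong (fromℚ-fromℤ b) (sym (corresponds-⟨⟩ v₁~α₁ v₁~α₁)) ⟩
        fromℤ b * (c * c * A v₁)                                ≈⟨ *-congˡ (trans (*-congˡ Av₁≈) (*-identityʳ _)) ⟩
        fromℤ b * (c * c)                                       ≈⟨ *-comm _ _ ⟩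
        c * c * fromℤ b                                         ∎)
        where
        open Relation.Binary.Reasoning.Setoid setoid
        open Solver
        swap : ∀ x y z → x * (y * z) ≈ y * (x * z)
        swap = solve 3 (λ x y z → x :* (y :* z) := y :* (x :* z)) refl
        2aT≡bν : ι (+ 2 ℤ.* a) ℚ.* T α₁ α₂ ≡ ι b ℚ.* ν
        2aT≡bν = ≡.trans (cong (ℚ._* T α₁ α₂) (ι-homo-* (+ 2) a)) (≡.trans (double (ι a) (T α₁ α₂)) aτ≡bν)
          where
          double : ∀ a T → (1ℚ ℚ.+ 1ℚ) ℚ.* a ℚ.* T ≡ a ℚ.* (T ℚ.+ T)
          double = RingSolver.solve-∀ ℚ-ring

    module Coordinates (x₁ y₁ x₂ y₂ : ℤ) (β₁≡ : β₁ ≡ ι x₁ ∙ α₁ ⊕ ι y₁ ∙ α₂) (β₂≡ : β₂ ≡ ι x₂ ∙ α₁ ⊕ ι y₂ ∙ α₂) where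

      δ σ : ℤ
      δ = x₁ ℤ.* y₁ ℤ.- x₂ ℤ.* y₂
      σ = x₁ ℤ.* x₁ ℤ.+ y₁ ℤ.* y₁ ℤ.- (x₂ ℤ.* x₂ ℤ.+ y₂ ℤ.* y₂)

      δ≢0 : δ ≢ + 0
      δ≢0 δ≡0 = perfect temperedPerfect S-pairs S′-pairs {a} {b} 0<a 0≤a+b 0≤a-b 2a⟨v₁,v₂⟩≈b lattice-coordinates
        x₁ y₁ x₂ y₂ (lift-coordinates x₁ y₁ w₁~β₁ β₁≡) (lift-coordinates x₂ y₂ w₂~β₂ β₂≡) (ℤ.i-j≡0⇒i≡j (x₁ ℤ.* y₁) (x₂ ℤ.* y₂) δ≡0)
        where
        instance _ = ℚ.>-nonZero 0<N
        t : ℚ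
        t = τ ℚ.* ℚ.1/ ν
        a b : ℤ
        a = ℚ.↧ t
        b = ℚ.↥ t
        0<a : + 0 ℤ.< a
        0<a = ℤ.+<+ (ℕ.s≤s ℕ.z≤n)
        open Slope a b t (↧*q t) (≡.trans (ℚ.*-assoc τ (ℚ.1/ ν) ν) (≡.trans (cong (τ ℚ.*_) (ℚ.*-inverseˡ ν)) (ℚ.*-identityʳ τ))) 0<a

      relation : ι δ ℚ.* τ ℚ.+ ι σ ℚ.* ν ≡ 0ℚ
      relation = begin
        ι δ ℚ.* τ ℚ.+ ι σ ℚ.* ν
          ≡⟨ cong₂ (λ d s → d ℚ.* τ ℚ.+ s ℚ.* ν)
               (≡.trans (ι-homo-- (x₁ ℤ.* y₁) (x₂ ℤ.* y₂)) (cong₂ ℚ._-_ (ι-homo-* x₁ y₁) (ι-homo-* x₂ y₂)))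
               (≡.trans (ι-homo-- (x₁ ℤ.* x₁ ℤ.+ y₁ ℤ.* y₁) (x₂ ℤ.* x₂ ℤ.+ y₂ ℤ.* y₂)) (cong₂ ℚ._-_ (squares x₁ y₁) (squares x₂ y₂))) ⟩
        (X₁ ℚ.* Y₁ ℚ.- X₂ ℚ.* Y₂) ℚ.* τ ℚ.+ (X₁ ℚ.* X₁ ℚ.+ Y₁ ℚ.* Y₁ ℚ.- (X₂ ℚ.* X₂ ℚ.+ Y₂ ℚ.* Y₂)) ℚ.* ν
          ≡⟨ lemma X₁ Y₁ X₂ Y₂ τ ν ⟩
        (X₁ ℚ.* X₁ ℚ.* ν ℚ.+ Y₁ ℚ.* Y₁ ℚ.* ν ℚ.+ (X₁ ℚ.* Y₁) ℚ.* τ) ℚ.- (X₂ ℚ.* X₂ ℚ.* ν ℚ.+ Y₂ ℚ.* Y₂ ℚ.* ν ℚ.+ (X₂ ℚ.* Y₂) ℚ.* τ)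
          ≡⟨ cong₂ ℚ._-_ (N-coordinates X₁ Y₁) (N-coordinates X₂ Y₂) ⟨
        N (X₁ ∙ α₁ ⊕ Y₁ ∙ α₂) ℚ.- N (X₂ ∙ α₁ ⊕ Y₂ ∙ α₂)
          ≡⟨ cong₂ (λ x y → N x ℚ.- N y) β₁≡ β₂≡ ⟨
        N β₁ ℚ.- N β₂
          ≡⟨ cong (ℚ._- N β₂) (IsMinimalPair.Nα≡Nβ β-minimal) ⟩
        N β₂ ℚ.- N β₂
          ≡⟨ ℚ.+-inverseʳ (N β₂) ⟩
        0ℚ ∎
        where
        open ≡.≡-Reasoning
        X₁ Y₁ X₂ Y₂ : ℚ
        X₁ = ι x₁
        Y₁ = ι y₁
        X₂ = ι x₂
        Y₂ = ι y₂
        squares : ∀ x y → ι (x ℤ.* x ℤ.+ y ℤ.* y) ≡ ι x ℚ.* ι x ℚ.+ ι y ℚ.* ι y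
        squares x y = ≡.trans (ι-homo-+ (x ℤ.* x) (y ℤ.* y)) (cong₂ ℚ._+_ (ι-homo-* x x) (ι-homo-* y y))
        lemma : ∀ X₁ Y₁ X₂ Y₂ τ ν →
          (X₁ ℚ.* Y₁ ℚ.- X₂ ℚ.* Y₂) ℚ.* τ ℚ.+ (X₁ ℚ.* X₁ ℚ.+ Y₁ ℚ.* Y₁ ℚ.- (X₂ ℚ.* X₂ ℚ.+ Y₂ ℚ.* Y₂)) ℚ.* ν ≡
          (X₁ ℚ.* X₁ ℚ.* ν ℚ.+ Y₁ ℚ.* Y₁ ℚ.* ν ℚ.+ (X₁ ℚ.* Y₁) ℚ.* τ) ℚ.- (X₂ ℚ.* X₂ ℚ.* ν ℚ.+ Y₂ ℚ.* Y₂ ℚ.* ν ℚ.+ (X₂ ℚ.* Y₂) ℚ.* τ)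
        lemma = RingSolver.solve-∀ ℚ-ring

      -- Two combinations of α₁ and α₂ in one coset differ by an element of `J`, which β₁ and β₂
      -- generate. Since coordinates in α₁, α₂ are unique, the resulting equation in `K` splits into
      -- two integer equations.
      det≤ℓ : ∣ x₁ ℤ.* y₂ ℤ.- x₂ ℤ.* y₁ ∣ ℕ.≤ ℓ
      det≤ℓ = det≤index x₁ y₁ x₂ y₂ (λ i j → coset index J-closed (combination∈I i j)) separated
        where
        combination∈I : ∀ i j → ι i ∙ α₁ ⊕ ι j ∙ α₂ ∈ I
        combination∈I i j = I-closed i j α₁∈I α₂∈I
        ι-combination : ∀ m x n y → ι m ℚ.* ι x ℚ.+ ι n ℚ.* ι y ≡ ι (m ℤ.* x ℤ.+ n ℤ.* y)
        ι-combination m x n y = ≡.sym (≡.trans (ι-homo-+ (m ℤ.* x) (n ℤ.* y)) (cong₂ ℚ._+_ (ι-homo-* m x) (ι-homo-* n y)))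
        separated : ∀ i j i′ j′ → coset index J-closed (combination∈I i j) ≡ coset index J-closed (combination∈I i′ j′) →
          ∃₂ λ m n → i ℤ.- i′ ≡ m ℤ.* x₁ ℤ.+ n ℤ.* x₂ × j ℤ.- j′ ≡ m ℤ.* y₁ ℤ.+ n ℤ.* y₂
        separated i j i′ j′ eq = m , n , ι-injective (≡.trans (ι-homo-- i i′) (≡.trans (proj₁ unique) (ι-combination m x₁ n x₂)))
          , ι-injective (≡.trans (ι-homo-- j j′) (≡.trans (proj₂ unique) (ι-combination m y₁ n y₂)))
          where
          open ≡.≡-Reasoning
          generated = IsMinimalPair.generate β-minimal _ (same-coset index J-closed (combination∈I i j) (combination∈I i′ j′) eq)
          m n : ℤ
          m = proj₁ generated
          n = proj₁ (proj₂ generated)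
          unique = coordinates-unique (ι i ℚ.- ι i′) (ι j ℚ.- ι j′) (ι m ℚ.* ι x₁ ℚ.+ ι n ℚ.* ι x₂) (ι m ℚ.* ι y₁ ℚ.+ ι n ℚ.* ι y₂) α₁ α₂ det≢0 (begin
            (ι i ℚ.- ι i′) ∙ α₁ ⊕ (ι j ℚ.- ι j′) ∙ α₂                                       ≡⟨ difference (ι i) (ι j) (ι i′) (ι j′) α₁ α₂ ⟨
            1ℚ ∙ (ι i ∙ α₁ ⊕ ι j ∙ α₂) ⊕ (ℚ.- 1ℚ) ∙ (ι i′ ∙ α₁ ⊕ ι j′ ∙ α₂)                 ≡⟨ proj₂ (proj₂ generated) ⟩
            ι m ∙ β₁ ⊕ ι n ∙ β₂                                                             ≡⟨ cong₂ (λ x y → ι m ∙ x ⊕ ι n ∙ y) β₁≡ β₂≡ ⟩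
            ι m ∙ (ι x₁ ∙ α₁ ⊕ ι y₁ ∙ α₂) ⊕ ι n ∙ (ι x₂ ∙ α₁ ⊕ ι y₂ ∙ α₂)                   ≡⟨ nested-combination (ι m) (ι n) (ι x₁) (ι y₁) (ι x₂) (ι y₂) α₁ α₂ ⟩
            (ι m ℚ.* ι x₁ ℚ.+ ι n ℚ.* ι x₂) ∙ α₁ ⊕ (ι m ℚ.* ι y₁ ℚ.+ ι n ℚ.* ι y₂) ∙ α₂    ∎)

      bound : ∀ D → IsDiscriminant 𝒪 D → ∣ D ∣ ℕ.≤ 4 ℕ.* ℓ ℕ.^ 2
      -- Properness of `I` enters as the inclusion of its coefficient ring in `𝒪`, which puts the
      -- multiplier δ α₂ / α₁ into `𝒪`.
      bound D disc = 4δ²-σ²≤4ℓ² x₁ y₁ x₂ y₂ det≤ℓ (discriminant-bound α-minimal {δ} {σ} δ≢0 relation {𝒪} {D} (proj₁ (proj₂ I-proper)) disc)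

  |D|≤4ℓ² : ∀ D → IsDiscriminant 𝒪 D → ∣ D ∣ ℕ.≤ 4 ℕ.* ℓ ℕ.^ 2
  |D|≤4ℓ² D disc =
    let α₁ , α₁∈I , v₁~α₁ = member⇒element L↦I (proj₁ (S⊆L-M v₁ (S∋ _)))
        α₂ , α₂∈I , v₂~α₂ = member⇒element L↦I (proj₁ (S⊆L-M v₂ (S∋ _)))
        β₁ , β₁∈J , w₁~β₁ = member⇒element M↦J (proj₁ (S′⊆M-0 w₁ (S′∋ _)))
        β₂ , β₂∈J , w₂~β₂ = member⇒element M↦J (proj₁ (S′⊆M-0 w₂ (S′∋ _)))
        open Elements α₁∈I α₂∈I β₁∈J β₂∈J v₁~α₁ v₂~α₂ w₁~β₁ w₂~β₂
        x₁ , y₁ , β₁≡ = IsMinimalPair.generate α-minimal β₁ (J⊆I β₁∈J)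
        x₂ , y₂ , β₂≡ = IsMinimalPair.generate α-minimal β₂ (J⊆I β₂∈J)
    in Coordinates.bound x₁ y₁ x₂ y₂ β₁≡ β₂≡ D disc

open import Data.Nat.Base using (_≤_; _*_; _^_)

theorem2 : (R : RealNumbers) (ℓ : ℕ) → Prime ℓ →
    (F : ImaginaryQuadraticField R) (𝒪 : ImaginaryQuadraticField.Order F) (D : ℤ) →
    ImaginaryQuadraticField.IsDiscriminant F 𝒪 D →
    (L M : Plane.Subset R) →
    Plane._-and-_FormOfIndex R 2 2 ℓ L M →
    ArisesFrom F 𝒪 L M →
    ∣ D ∣ ≤ 4 * ℓ ^ 2
theorem2 R ℓ _ F 𝒪 D disc L M twoAndTwo arises = TwoAndTwoForm.|D|≤4ℓ² twoAndTwo arises D disc
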